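{- Let $G$ be a finite simple connected graph on $n\geqslant 5$ vertices and let $\alpha\in[0,1)$ be rational. Assume that it is not the case that both $n$ is even and $c_\alpha$ is odd with $c_\alpha\geqslant 3$. If $\frac{\det \tilde{W}_{\alpha}(G)}{2^{\lfloor n/2\rfloor}}$ is an odd and square-free integer, and $\tilde{W}_{\alpha}(G)$ has full rank $n$ over $\mathbb{F}_p$ for every odd prime $p$ dividing $c_\alpha$, then $G$ is determined by its generalized $A_\alpha$-spectrum (DGA$_\alpha$S).
   Context: All graphs are finite, simple and undirected. For a graph $G$ on vertices $v_1,\dots,v_n$, $A(G)$ is its adjacency matrix, $D(G)=\mathrm{diag}(d_1,\dots,d_n)$ its diagonal degree matrix, and for $\alpha\in[0,1]$, $A_\alpha(G)=\alpha D(G)+(1-\alpha)A(G)$. The $A_\alpha$-spectrum $\mathrm{Spec}_\alpha(G)$ is the multiset of eigenvalues of $A_\alpha(G)$. $\bar G$ denotes the complement of $G$. For rational $\alpha\in[0,1)$, $c_\alpha$ is the smallest positive integer such that $c_\alpha\alpha$ and $c_\alpha(1-\alpha)$ are (nonnegative) integers, and $A_{c_\alpha}(G)=c_\alpha A_\alpha(G)$ (an integral matrix). With $\mathbf 1$ the all-ones vector, $\tilde W_\alpha(G)=\left[\mathbf 1,\frac{A_{c_\alpha}(G)\mathbf 1}{c_\alpha},\dots,\frac{A_{c_\alpha}(G)^{n-1}\mathbf 1}{c_\alpha}\right]$, an $n\times n$ integral matrix. Two graphs $G,H$ share the same generalized $A_\alpha$-spectrum if $\mathrm{Spec}_\alpha(G)=\mathrm{Spec}_\alpha(H)$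 and $\mathrm{Spec}_\alpha(\bar G)=\mathrm{Spec}_\alpha(\bar H)$. $G$ is DGA$_\alpha$S if every graph $H$ sharing the same generalized $A_\alpha$-spectrum with $G$ is isomorphic to $G$. -}

module Defs where

open import Data.Nat as ℕ using (ℕ; zero; suc; _≤_)
open import Data.Nat.Primality using (Prime)
open import Data.Nat.Divisibility as ℕD using ()
open import Data.Integer as ℤ using (ℤ; +_)
open import Data.Integer.Divisibility as ℤD using ()
open import Data.Rational as ℚ using (ℚ; 0ℚ; 1ℚ; _+_; _*_; _-_; -_; _<_)
open import Data.Fin using (Fin; zero; suc; toℕ; punchIn)
open import Data.Bool using (Bool; true; false; if_then_else_; not; _∧_)
open import Data.Product using (Σ; ∃; _×_; _,_)
open import Function.Bundles using (_↔_; Inverse)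
open import Relation.Binary.PropositionalEquality using (_≡_; _≢_)
open import Relation.Nullary using (¬_; does)
open import Data.Fin using (_≟_)

record Graph (n : ℕ) : Set where
  field
    adj   : Fin n → Fin n → Bool
    adj-sym : ∀ i j → adj i j ≡ adj j i
    adj-irrefl : ∀ i → adj i i ≡ false
open Graph public

complement : ∀ {n} → Graph n → Graph n
complement {n} G = record
  { adj = λ i j → not (does (i ≟ j)) ∧ not (adj G i j)
  ; adj-sym = symC
  ; adj-irrefl = irrC }
  where
  open import Relation.Binary.PropositionalEquality using (refl; sym; cong₂)
  symC : ∀ i j → (not (does (i ≟ j)) ∧ not (adj G i j)) ≡ (not (does (j ≟ i)) ∧ not (adj G j i))
  symC i j with i ≟ j | j ≟ i
  ... | Relation.Nullary.yes _ | Relation.Nullary.yes _ = refl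
  ... | Relation.Nullary.no _ | Relation.Nullary.no _ = Relation.Binary.PropositionalEquality.cong not (Graph.adj-sym G i j)
  ... | Relation.Nullary.yes p | Relation.Nullary.no q = Data.Empty.⊥-elim (q (sym p))
    where import Data.Empty
  ... | Relation.Nullary.no p | Relation.Nullary.yes q = Data.Empty.⊥-elim (p (sym q))
    where import Data.Empty
  irrC : ∀ i → (not (does (i ≟ i)) ∧ not (adj G i i)) ≡ false
  irrC i with i ≟ i
  ... | Relation.Nullary.yes _ = refl
  ... | Relation.Nullary.no ¬p = Data.Empty.⊥-elim (¬p refl)
    where import Data.Empty

data Reach {n : ℕ} (G : Graph n) : Fin n → Fin n → Set where
  here : ∀ {i} → Reach G i i
  step : ∀ {i k j} → adj G i k ≡ true → Reach G k j → Reach G i j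

Connected : ∀ {n} → Graph n → Set
Connected G = ∀ i j → Reach G i j

Isomorphic : ∀ {n} → Graph n → Graph n → Set
Isomorphic {n} G H =
  Σ (Fin n ↔ Fin n) λ σ → ∀ i j → adj H (Inverse.to σ i) (Inverse.to σ j) ≡ adj G i j

Matrix : ℕ → Set
Matrix n = Fin n → Fin n → ℚ

Vector : ℕ → Set
Vector n = Fin n → ℚ

sumFin : ∀ {n} → (Fin n → ℚ) → ℚ
sumFin {zero}  f = 0ℚ
sumFin {suc n} f = f zero + sumFin (λ i → f (suc i))

det : ∀ {n} → Matrix n → ℚ
det {zero}  M = 1ℚ
det {suc n} M = go 1ℚ M
  where
  altSum : ∀ {m} → ℚ → (Fin m → ℚ) → ℚ
  altSum {zero} s f = 0ℚ
  altSum {suc m} s f = s * f zero + altSum (- s) (λ i → f (suc i))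
  go : ℚ → Matrix (suc n) → ℚ
  go s M = altSum s (λ j → M zero j * det (λ a b → M (suc a) (punchIn j b)))

identity : ∀ {n} → Matrix n
identity i j = if does (i ≟ j) then 1ℚ else 0ℚ

matVec : ∀ {n} → Matrix n → Vector n → Vector n
matVec M v i = sumFin (λ j → M i j * v j)

powVec : ∀ {n} → Matrix n → ℕ → Vector n → Vector n
powVec M zero v = v
powVec M (suc k) v = matVec M (powVec M k v)

ones : ∀ {n} → Vector n
ones _ = 1ℚ

charPolyAt : ∀ {n} → Matrix n → ℚ → ℚ
charPolyAt M t = det (λ i j → t * identity i j - M i j)

-- same spectrum (eigenvalues with multiplicity = roots of the characteristic
-- polynomial); two monic polynomials over ℚ agree iff they agree on all of ℚ
SameSpectrum : ∀ {n} → Matrix n → Matrix n → Set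
SameSpectrum M N = ∀ t → charPolyAt M t ≡ charPolyAt N t

ℕtoℚ : ℕ → ℚ
ℕtoℚ k = + k ℚ./ 1

ℤtoℚ : ℤ → ℚ
ℤtoℚ z = z ℚ./ 1

degree : ∀ {n} → Graph n → Fin n → ℚ
degree G i = sumFin (λ j → if adj G i j then 1ℚ else 0ℚ)

adjMatrix : ∀ {n} → Graph n → Matrix n
adjMatrix G i j = if adj G i j then 1ℚ else 0ℚ

degMatrix : ∀ {n} → Graph n → Matrix n
degMatrix G i j = if does (i ≟ j) then degree G i else 0ℚ

Aα : ∀ {n} → ℚ → Graph n → Matrix n
Aα α G i j = α * degMatrix G i j + (1ℚ - α) * adjMatrix G i j

SameGenSpectrum : ∀ {n} → ℚ → Graph n → Graph n → Set
SameGenSpectrum α G H =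
  SameSpectrum (Aα α G) (Aα α H) × SameSpectrum (Aα α (complement G)) (Aα α (complement H))

DGAαS : ∀ {n} → ℚ → Graph n → Set
DGAαS {n} α G = ∀ (H : Graph n) → SameGenSpectrum α G H → Isomorphic G H

IsIntegral : ℚ → Set
IsIntegral q = ∃ λ (z : ℤ) → q ≡ ℤtoℚ z

IsCα : ℚ → ℕ → Set
IsCα α c =
  1 ≤ c × IsIntegral (ℕtoℚ c * α) × IsIntegral (ℕtoℚ c * (1ℚ - α)) ×
  (∀ d → 1 ≤ d → IsIntegral (ℕtoℚ d * α) → IsIntegral (ℕtoℚ d * (1ℚ - α)) → c ≤ d)

Ac : ∀ {n} → ℚ → ℕ → Graph n → Matrix n
Ac α c G i j = ℕtoℚ c * Aα α G i j

-- division by a positive natural number c (the c = 0 clause is never used,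
-- since c_α ≥ 1)
divℕ : ℚ → ℕ → ℚ
divℕ q zero = 0ℚ
divℕ q (suc k) = q * (+ 1 ℚ./ suc k)

Wtilde : ∀ {n} → ℚ → ℕ → Graph n → Matrix n
Wtilde α c G i zero = 1ℚ
Wtilde α c G i (suc k) = divℕ (powVec (Ac α c G) (suc (toℕ k)) ones i) c

OddInt : ℤ → Set
OddInt m = ¬ (+ 2 ℤD.∣ m)

SquareFreeInt : ℤ → Set
SquareFreeInt m = ∀ (d : ℕ) → 2 ≤ d → ¬ (+ (d ℕ.* d) ℤD.∣ m)

-- an (integral) n×n matrix has full rank n over F_p: its only kernel vector
-- mod p is zero (x integral with W x ≡ 0 mod p implies x ≡ 0 mod p)
FullRankModP : ∀ {n} → ℕ → Matrix n → Set
FullRankModP {n} p W =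
  ∀ (x : Fin n → ℤ) →
  (∀ i → ∃ λ (z : ℤ) → matVec W (λ j → ℤtoℚ (x j)) i ≡ ℤtoℚ (+ p ℤ.* z)) →
  ∀ j → + p ℤD.∣ x j

module Submission where

-- Write A = cα Aα, an integral matrix, and let W = W̃ have the columns w₀ = 1, w₁ = d, w₂ = Ad, ...
-- with d the degree vector. The two characteristic polynomials determine all walk counts 1ᵀAᵏ1: evaluated at
-- t = 1/(cα s) they give det (1 - sA) and the sum of its cofactors, and modulo s^(k+1) their quotient is the
-- truncated generating function of the walk counts. Hence the Gram matrices WᵀW and WᵀAW agree for G and H,
-- and some integral matrix V with column sums N satisfies VᵀV = N², A V = V A', where N = det W.
-- Prime factors common to N and all entries of V are removed until N = 1, when V is a permutation matrix.
--
-- Odd p dividing N, p not dividing cα: a column v of V is in the left kernel of W mod p, which is one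
-- dimensional as p² does not divide det W. If v were nonzero mod p, then Av = μv + pβ with β orthogonal to v,
-- so β = (A - μ)y + s1 mod p, and v' = v - py satisfies (A - μ)v' = ps1 mod p². The row v'W/p is then killed by
-- a nonzero vector of the right kernel of W mod p, so replacing a row of W by it shows p² | det W. For p | cα
-- the full rank hypothesis gives v = 0 mod p at once.
--
-- p = 2: all entries of WᵀW are even, except 1ᵀ1 for odd n. If a combination x of w₀, ..., w_r satisfies
-- xᵀAᵏx = 0 mod 4 for all k, then the squares of its coefficients give a relation mod 4 between the even-indexed
-- rows of WᵀW, whose determinant det² W has too few factors 2 for this unless the coefficients are even. A column v
-- that is odd somewhere would therefore be independent of w₁, ..., w_r mod 2, and kernel vectors of W mod 2
-- contribute factors of 2 to det W: one too many. When N = ±2 and n is even, w₀ = 1 must be used as well; it is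
-- independent of v because vᵀv = 4 < n forces v to have an even entry.

-- No polynomial ring or notion of rank modulo p is introduced: such statements are expressed by the
-- number of factors p in det W, and the main contradictions produce one factor too many. For odd p
-- a single left kernel vector is compatible with the hypothesis on det W, so second-order
-- information is needed: vᵀAˡv is divisible by N² because VᵀAˡV = N²A'ˡ. For odd p only l = 0 and l
-- = 1 enter, for p = 2 all l. The columns of W are not a Krylov sequence: A w₀ = cα w₁, while A w_k
-- = w_(k+1) for k > 0. Orthogonality to A w₀ modulo p gives orthogonality to w₁ only if p does not
-- divide cα. This separates the primes dividing cα and puts weights in cα into many identities.

module Development where

  open import Data.Nat.Base as ℕ using (ℕ; zero; suc)
  import Data.Nat.Divisibility as ℕ
  import Data.Nat.Properties as ℕ
  import Data.Nat.DivMod as ℕ using (m*n/n≡m; +-distrib-/-∣ʳ)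
  open import Data.Nat.Induction using (<-rec)
  import Data.Nat.GCD as GCD
  open import Data.Nat.Coprimality using (Coprime; coprime-Bézout)
  open import Data.Nat.Primality using (Prime; euclidsLemma; prime⇒irreducible; prime⇒nonZero; prime⇒nonTrivial; prime[2])
  open import Data.Nat.Primality.Factorisation using (factorise)
  import Data.List.Base as List
  import Data.List.Relation.Unary.All as All
  open import Data.Integer.Base as ℤ using (ℤ; -[1+_]; +≤+; +_; 0ℤ; 1ℤ; _+_; _*_; _-_; -_; _^_) renaming (∣_∣ to abs)
  open import Data.Integer.Properties hiding (_≟_)
  import Data.Integer.Properties as ℤ using (_≟_)
  open import Data.Integer.Divisibility.Signed
  import Data.Integer.DivMod as ℤ
  open import Data.Integer.Tactic.RingSolver using (solve-∀)
  open import Data.Fin.Base using (Fin; zero; suc; punchIn; toℕ; fromℕ<)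
  open import Data.Fin.Properties using (_≟_; suc-injective; all?; any?; ¬∀⟶∃¬; toℕ-fromℕ<; toℕ<n; toℕ-injective)
  open import Data.Bool.Base using (true; false; if_then_else_)
  open import Data.Empty using (⊥; ⊥-elim)
  open import Data.Product.Base using (∃; _×_; _,_; proj₁; proj₂)
  open import Data.Sum.Base using (_⊎_; inj₁; inj₂)
  open import Data.Vec.Functional using (updateAt; insertAt; _∷_)
  open import Data.Vec.Functional.Properties using (updateAt-updates; updateAt-minimal; updateAt-commutes)
  open import Function.Bundles using (mk↔ₛ′)
  open import Function.Base using (const; _∘_)
  open import Relation.Binary.PropositionalEquality
  open import Relation.Nullary using (¬_; Dec; does; yes; no)
  open import Algebra.Properties.Semiring.Sum +-*-semiring
    using (sum; ∑-distrib-+; *-distribˡ-sum; sum-cong-≗)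
    renaming (∑-comm to sum-comm)
  open ≡-Reasoning
  import Data.Rational.Properties as ℚ
  open import Data.Rational as ℚ using (ℚ; 0ℚ; 1ℚ; toℚᵘ) renaming (_+_ to _⊕_; _*_ to _⊗_; -_ to ⊖_; _-_ to _⊝_)
  open import Data.Rational.Unnormalised as ℚᵘ using (ℚᵘ; mkℚᵘ; *≡*)
  import Data.Rational.Unnormalised.Properties as ℚᵘ
  open import Tactic.RingSolver.Core.AlmostCommutativeRing using (AlmostCommutativeRing; fromCommutativeRing)
  import Tactic.RingSolver as RingSolver
  open import Relation.Nullary.Decidable using (dec⇒maybe)

  -- Sums, vectors and matrices over ℤ

  -- Opaque, so that unification compares summands instead of unfolding the sums.
  opaque
    ∑ : ∀ {n} → (Fin n → ℤ) → ℤ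
    ∑ = sum

    ∑-[] : (f : Fin 0 → ℤ) → ∑ f ≡ 0ℤ
    ∑-[] f = refl

    ∑-∷ : ∀ {n} (f : Fin (suc n) → ℤ) → ∑ f ≡ f zero + ∑ (λ i → f (suc i))
    ∑-∷ f = refl

    ∑-cong : ∀ {n} {f g : Fin n → ℤ} → (∀ i → f i ≡ g i) → ∑ f ≡ ∑ g
    ∑-cong = sum-cong-≗

    ∑-comm : ∀ {m n} (f : Fin m → Fin n → ℤ) → ∑ (λ i → ∑ (λ j → f i j)) ≡ ∑ (λ j → ∑ (λ i → f i j))
    ∑-comm = sum-comm

    *-distribˡ-∑ : ∀ {n} a (f : Fin n → ℤ) → a * ∑ f ≡ ∑ (λ i → a * f i)
    *-distribˡ-∑ a f = *-distribˡ-sum a f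

    ∑-+ : ∀ {n} (f g : Fin n → ℤ) → ∑ (λ i → f i + g i) ≡ ∑ f + ∑ g
    ∑-+ = ∑-distrib-+

  ∑-zero : ∀ {n} (f : Fin n → ℤ) → (∀ i → f i ≡ 0ℤ) → ∑ f ≡ 0ℤ
  ∑-zero {zero}  f h = ∑-[] f
  ∑-zero {suc n} f h = trans (∑-∷ f) (cong₂ _+_ (h zero) (∑-zero (λ i → f (suc i)) (h ∘ suc)))

  ∑-linear : ∀ {n} a b (f g : Fin n → ℤ) → ∑ (λ i → a * f i + b * g i) ≡ a * ∑ f + b * ∑ g
  ∑-linear a b f g = trans (∑-+ (λ i → a * f i) (λ i → b * g i))
    (sym (cong₂ _+_ (*-distribˡ-∑ a f) (*-distribˡ-∑ b g)))

  ∑-minus : ∀ {n} (f g : Fin n → ℤ) → ∑ (λ i → f i - g i) ≡ ∑ f - ∑ g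
  ∑-minus f g = begin
    ∑ (λ i → f i - g i)   ≡⟨ ∑-cong (λ i → lem (f i) (g i)) ⟩
    ∑ (λ i → 1ℤ * f i + (- 1ℤ) * g i)    ≡⟨ ∑-linear 1ℤ (- 1ℤ) f g ⟩
    1ℤ * ∑ f + (- 1ℤ) * ∑ g   ≡⟨ lem (∑ f) (∑ g) ⟨
    ∑ f - ∑ g   ∎
    where
    lem : ∀ x y → x - y ≡ 1ℤ * x + (- 1ℤ) * y
    lem = solve-∀

  ∑-single : ∀ {n} (f : Fin n → ℤ) k → (∀ i → i ≢ k → f i ≡ 0ℤ) → ∑ f ≡ f k
  ∑-single f zero    h = trans (∑-∷ f) (trans (cong (λ x → f zero + x) (∑-zero (λ i → f (suc i)) (λ i → h (suc i) (λ ()))))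
    (+-identityʳ (f zero)))
  ∑-single f (suc k) h = trans (∑-∷ f) (trans (cong₂ _+_ (h zero (λ ()))
    (∑-single (λ i → f (suc i)) k (λ i i≢k → h (suc i) (i≢k ∘ suc-injective)))) (+-identityˡ (f (suc k))))

  ∑-∣ : ∀ {n p} (f : Fin n → ℤ) → (∀ i → p ∣ f i) → p ∣ ∑ f
  ∑-∣ {zero}  {p} f h = divides 0ℤ (∑-[] f)
  ∑-∣ {suc n} {p} f h = subst (p ∣_) (sym (∑-∷ f)) (∣m∣n⇒∣m+n (h zero) (∑-∣ (λ i → f (suc i)) (h ∘ suc)))

  Vec : ℕ → Set
  Vec n = Fin n → ℤ

  Mat : ℕ → ℕ → Set
  Mat m n = Fin m → Fin n → ℤ

  infix 4 _≐_
  _≐_ : ∀ {m n} → Mat m n → Mat m n → Set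
  A ≐ B = ∀ i j → A i j ≡ B i j

  infixl 7 _∙_ _·_ _⋆_ _▹_

  opaque
    _∙_ : ∀ {n} → Vec n → Vec n → ℤ
    u ∙ v = ∑ (λ i → u i * v i)

    ∙-∑ : ∀ {n} (u v : Vec n) → u ∙ v ≡ ∑ (λ i → u i * v i)
    ∙-∑ u v = refl

  _⋆_ : ∀ {m n} → Vec m → Mat m n → Vec n
  (v ⋆ M) j = v ∙ (λ i → M i j)

  _▹_ : ∀ {m n} → Mat m n → Vec n → Vec m
  (M ▹ v) i = M i ∙ v

  _·_ : ∀ {l m n} → Mat l m → Mat m n → Mat l n
  (A · B) i = A i ⋆ B

  infixl 8 _ᵀ
  _ᵀ : ∀ {m n} → Mat m n → Mat n m
  (A ᵀ) i j = A j i

  δ : ∀ {n} → Mat n n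
  δ i j = if does (i ≟ j) then 1ℤ else 0ℤ

  δ-refl : ∀ {n} (i : Fin n) → δ i i ≡ 1ℤ
  δ-refl i with i ≟ i
  ... | yes _ = refl
  ... | no ¬p = ⊥-elim (¬p refl)

  δ-≢ : ∀ {n} {i j : Fin n} → i ≢ j → δ i j ≡ 0ℤ
  δ-≢ {i = i} {j} i≢j with i ≟ j
  ... | yes p = ⊥-elim (i≢j p)
  ... | no _  = refl

  δ-sym : ∀ {n} (i j : Fin n) → δ i j ≡ δ j i
  δ-sym i j with i ≟ j
  ... | yes refl = sym (δ-refl i)
  ... | no i≢j   = sym (δ-≢ (i≢j ∘ sym))

  opaque
    unfolding _∙_

    ∙-cong : ∀ {n} {u u' v v' : Vec n} → (∀ i → u i ≡ u' i) → (∀ i → v i ≡ v' i) → u ∙ v ≡ u' ∙ v'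
    ∙-cong p q = ∑-cong (λ i → cong₂ _*_ (p i) (q i))

    ∙-comm : ∀ {n} (u v : Vec n) → u ∙ v ≡ v ∙ u
    ∙-comm u v = ∑-cong (λ i → *-comm (u i) (v i))

    ∙-δ : ∀ {n} (u : Vec n) k → u ∙ δ k ≡ u k
    ∙-δ u k = trans (∑-single (λ i → u i * δ k i) k (λ i i≢k → trans (cong (u i *_) (δ-≢ (i≢k ∘ sym))) (*-zeroʳ (u i))))
      (trans (cong (u k *_) (δ-refl k)) (*-identityʳ (u k)))

    ∙-linearˡ : ∀ {n} a b (u v w : Vec n) → (λ i → a * u i + b * v i) ∙ w ≡ a * (u ∙ w) + b * (v ∙ w)
    ∙-linearˡ a b u v w = trans (∑-cong (λ i → lem a b (u i) (v i) (w i))) (∑-linear a b (λ i → u i * w i) (λ i → v i * w i))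
      where
      lem : ∀ a b u v w → (a * u + b * v) * w ≡ a * (u * w) + b * (v * w)
      lem = solve-∀

    ∙-scaleˡ : ∀ {n} a (u w : Vec n) → (λ i → a * u i) ∙ w ≡ a * (u ∙ w)
    ∙-scaleˡ a u w = trans (∑-cong (λ i → *-assoc a (u i) (w i))) (sym (*-distribˡ-∑ a (λ i → u i * w i)))

    ∙-∑ʳ : ∀ {m n} (u : Vec n) (c : Vec m) (R : Mat m n) → u ∙ (c ⋆ R) ≡ c ∙ (λ k → u ∙ R k)
    ∙-∑ʳ u c R = begin
      ∑ (λ i → u i * ∑ (λ k → c k * R k i))     ≡⟨ ∑-cong (λ i → *-distribˡ-∑ (u i) (λ k → c k * R k i)) ⟩
      ∑ (λ i → ∑ (λ k → u i * (c k * R k i)))   ≡⟨ ∑-comm (λ i k → u i * (c k * R k i)) ⟩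
      ∑ (λ k → ∑ (λ i → u i * (c k * R k i)))   ≡⟨ ∑-cong (λ k → ∑-cong (λ i → lem (u i) (c k) (R k i))) ⟩
      ∑ (λ k → ∑ (λ i → c k * (u i * R k i)))   ≡⟨ ∑-cong (λ k → *-distribˡ-∑ (c k) (λ i → u i * R k i)) ⟨
      ∑ (λ k → c k * ∑ (λ i → u i * R k i))     ∎
      where
      lem : ∀ x y z → x * (y * z) ≡ y * (x * z)
      lem = solve-∀

    ∙-∣ : ∀ {n p} (u : Vec n) {v : Vec n} → (∀ i → p ∣ v i) → p ∣ u ∙ v
    ∙-∣ u {v} h = ∑-∣ (λ i → u i * v i) (λ i → ∣n⇒∣m*n (u i) (h i))

    ∙-∷ : ∀ {n} (u v : Vec (suc n)) → u ∙ v ≡ u zero * v zero + (λ i → u (suc i)) ∙ (λ i → v (suc i))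
    ∙-∷ u v = ∑-∷ (λ i → u i * v i)

    ∙-[] : (u v : Vec 0) → u ∙ v ≡ 0ℤ
    ∙-[] u v = ∑-[] (λ i → u i * v i)

  δ-∙ : ∀ {n} (u : Vec n) k → δ k ∙ u ≡ u k
  δ-∙ u k = trans (∙-comm (δ k) u) (∙-δ u k)

  ∙-linearʳ : ∀ {n} a b (u v w : Vec n) → w ∙ (λ i → a * u i + b * v i) ≡ a * (w ∙ u) + b * (w ∙ v)
  ∙-linearʳ a b u v w = trans (∙-comm w _) (trans (∙-linearˡ a b u v w) (cong₂ (λ x y → a * x + b * y) (∙-comm u w) (∙-comm v w)))

  ∙-scaleʳ : ∀ {n} a (u w : Vec n) → w ∙ (λ i → a * u i) ≡ a * (w ∙ u)
  ∙-scaleʳ a u w = trans (∙-comm w _) (trans (∙-scaleˡ a u w) (cong (a *_) (∙-comm u w)))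

  ⋆-▹ : ∀ {m n} (v : Vec m) (M : Mat m n) (x : Vec n) → (v ⋆ M) ∙ x ≡ v ∙ (M ▹ x)
  ⋆-▹ v M x = trans (∙-comm (v ⋆ M) x) (trans (∙-∑ʳ x v M) (∙-cong (λ _ → refl) (λ k → ∙-comm x (M k))))

  ·-assoc : ∀ {k l m n} (A : Mat k l) (B : Mat l m) (C : Mat m n) → (A · B) · C ≐ A · (B · C)
  ·-assoc A B C i j = ⋆-▹ (A i) B (λ k → C k j)

  ·-cong : ∀ {l m n} {A A' : Mat l m} {B B' : Mat m n} → A ≐ A' → B ≐ B' → A · B ≐ A' · B'
  ·-cong p q i j = ∙-cong (p i) (λ k → q k j)

  ·-ᵀ : ∀ {l m n} (A : Mat l m) (B : Mat m n) → (A · B) ᵀ ≐ B ᵀ · A ᵀ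
  ·-ᵀ A B i j = ∙-comm (A j) (λ k → B k i)

  ·-δ : ∀ {m n} (A : Mat m n) → A · δ ≐ A
  ·-δ A i j = trans (∙-cong (λ _ → refl) (λ k → δ-sym k j)) (∙-δ (A i) j)

  δ-· : ∀ {m n} (A : Mat m n) → δ · A ≐ A
  δ-· A i j = δ-∙ (λ k → A k j) i

  -- Replacing a row, and forms that are linear in each row.

  infixl 9 _[_]≔_
  _[_]≔_ : ∀ {m n} → Mat m n → Fin m → Vec n → Mat m n
  M [ i ]≔ r = updateAt M i (const r)

  []≔-row : ∀ {m n} (M : Mat m n) i r → (M [ i ]≔ r) i ≡ r
  []≔-row M i r = updateAt-updates i M

  []≔-other : ∀ {m n} (M : Mat m n) {i k} r → k ≢ i → (M [ i ]≔ r) k ≡ M k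
  []≔-other M {i} {k} r k≢i = updateAt-minimal k i M k≢i

  []≔-elim : ∀ {m n} (M : Mat m n) i r (P : Fin m → Vec n → Set) → P i r → (∀ k → k ≢ i → P k (M k)) → ∀ k → P k ((M [ i ]≔ r) k)
  []≔-elim M i r P pi po k with k ≟ i
  ... | yes refl = subst (P i) (sym ([]≔-row M i r)) pi
  ... | no k≢i   = subst (P k) (sym ([]≔-other M r k≢i)) (po k k≢i)

  []≔-map : ∀ {m n n'} (f : Vec n → Vec n') (M : Mat m n) i r → f ∘ (M [ i ]≔ r) ≐ (f ∘ M) [ i ]≔ f r
  []≔-map f M i r k j = []≔-elim M i r (λ k v → f v j ≡ ((f ∘ M) [ i ]≔ f r) k j)
    (sym (cong (λ v → v j) ([]≔-row (f ∘ M) i (f r))))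
    (λ k k≢i → sym (cong (λ v → v j) ([]≔-other (f ∘ M) (f r) k≢i))) k

  []≔-cong : ∀ {m n} {M N : Mat m n} {r s : Vec n} i → (∀ k → k ≢ i → ∀ j → M k j ≡ N k j) → (∀ j → r j ≡ s j) → M [ i ]≔ r ≐ N [ i ]≔ s
  []≔-cong {M = M} {N} {r} {s} i h e k j = []≔-elim M i r (λ k v → v j ≡ (N [ i ]≔ s) k j)
    (trans (e j) (sym (cong (λ v → v j) ([]≔-row N i s))))
    (λ k k≢i → trans (h k k≢i j) (sym (cong (λ v → v j) ([]≔-other N s k≢i)))) k

  []≔-self : ∀ {m n} (M : Mat m n) i → M [ i ]≔ M i ≐ M
  []≔-self M i k j = []≔-elim M i (M i) (λ k v → v j ≡ M k j) refl (λ _ _ → refl) k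

  -- Kept apart from `detℤ`, because the same facts are applied to forms derived from it: the
  -- determinant of `M · B`, and forms with a row fixed or a zero column inserted.
  record RowForm {m n} (F : Mat m n → ℤ) : Set where
    field
      F-cong   : ∀ {M N} → M ≐ N → F M ≡ F N
      F-linear : ∀ M i a b r s → F (M [ i ]≔ (λ j → a * r j + b * s j)) ≡ a * F (M [ i ]≔ r) + b * F (M [ i ]≔ s)

    F-zero : ∀ M i → F (M [ i ]≔ (λ _ → 0ℤ)) ≡ 0ℤ
    F-zero M i = F-linear M i 0ℤ 0ℤ (λ _ → 0ℤ) (λ _ → 0ℤ)

    F-∑ : ∀ {l} M i (c : Vec l) (R : Mat l n) → F (M [ i ]≔ (c ⋆ R)) ≡ c ∙ (λ k → F (M [ i ]≔ R k))
    F-∑ {zero}  M i c R = begin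
      F (M [ i ]≔ (c ⋆ R))   ≡⟨ F-cong ([]≔-cong i (λ _ _ _ → refl) (λ j → ∙-[] c (λ k → R k j))) ⟩
      F (M [ i ]≔ (λ _ → 0ℤ))      ≡⟨ F-zero M i ⟩
      0ℤ   ≡⟨ ∙-[] c (λ k → F (M [ i ]≔ R k)) ⟨
      c ∙ (λ k → F (M [ i ]≔ R k)) ∎
    F-∑ {suc l} M i c R = begin
      F (M [ i ]≔ (c ⋆ R))
        ≡⟨ F-cong ([]≔-cong i (λ _ _ _ → refl) (λ j → trans (∙-∷ c (λ k → R k j)) (lem (c zero * R zero j) _))) ⟩
      F (M [ i ]≔ (λ j → c zero * R zero j + 1ℤ * ((c ∘ suc) ⋆ (R ∘ suc)) j))
        ≡⟨ F-linear M i (c zero) 1ℤ (R zero) ((c ∘ suc) ⋆ (R ∘ suc)) ⟩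
      c zero * F (M [ i ]≔ R zero) + 1ℤ * F (M [ i ]≔ ((c ∘ suc) ⋆ (R ∘ suc)))
        ≡⟨ cong (λ x → c zero * F (M [ i ]≔ R zero) + x) (trans (*-identityˡ _) (F-∑ M i (c ∘ suc) (R ∘ suc))) ⟩
      c zero * F (M [ i ]≔ R zero) + (c ∘ suc) ∙ (λ k → F (M [ i ]≔ R (suc k)))
        ≡⟨ ∙-∷ c (λ k → F (M [ i ]≔ R k)) ⟨
      c ∙ (λ k → F (M [ i ]≔ R k)) ∎
      where
      lem : ∀ x y → x + y ≡ x + 1ℤ * y
      lem = solve-∀


  Vanishes : ∀ {m n} → (Mat m n → ℤ) → Fin m → Fin m → Set
  Vanishes F i j = ∀ M → (∀ k → M i k ≡ M j k) → F M ≡ 0ℤ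

  record Alternating {m n} (F : Mat m n → ℤ) : Set where
    field
      rowForm  : RowForm F
      F-equal  : ∀ {i j} → i ≢ j → Vanishes F i j

  []≔-comm : ∀ {m n} (M : Mat m n) {i j} r s → i ≢ j → M [ i ]≔ r [ j ]≔ s ≐ M [ j ]≔ s [ i ]≔ r
  []≔-comm M {i} {j} r s i≢j k l = cong (λ v → v l) (updateAt-commutes j i (i≢j ∘ sym) M k)

  -- Polarisation: `F` vanishes when the sum of the two rows stands in both places. Vanishing is
  -- assumed for this one pair only, so that the lemma is available while `detℤ` is still being
  -- shown to be alternating.
  swap : ∀ {m n} {F : Mat m n → ℤ} → RowForm F → ∀ {i j} → i ≢ j → Vanishes F i j →
         ∀ M → F (M [ i ]≔ M j [ j ]≔ M i) ≡ - F M
  swap {F = F} RF {i} {j} i≢j van M = solveFor _ _ (begin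
    F (P y x) + F M   ≡⟨ cong (λ t → F (P y x) + t) (RF .RowForm.F-cong M≐) ⟩
    F (P y x) + F (P x y)   ≡⟨ lem (F (P x x)) (F (P x y)) (F (P y x)) (F (P y y)) (diag x) (diag y) ⟩
    1ℤ * (1ℤ * F (P x x) + 1ℤ * F (P x y)) + 1ℤ * (1ℤ * F (P y x) + 1ℤ * F (P y y))
      ≡⟨ cong₂ (λ a b → 1ℤ * a + 1ℤ * b) (linʳ x) (linʳ y) ⟨
    1ℤ * F (P x z) + 1ℤ * F (P y z)   ≡⟨ linˡ ⟨
    F (P z z)   ≡⟨ diag z ⟩
    0ℤ   ∎)
    where
    x y z : Vec _
    x = M i
    y = M j
    z = λ l → 1ℤ * x l + 1ℤ * y l
    P : Vec _ → Vec _ → Mat _ _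
    P r s = M [ i ]≔ r [ j ]≔ s
    M≐ : M ≐ P x y
    M≐ k l = sym (trans ([]≔-cong {N = M} {s = y} j (λ k _ l → []≔-self M i k l) (λ _ → refl) k l) ([]≔-self M j k l))
    diag : ∀ r → F (P r r) ≡ 0ℤ
    diag r = van (P r r) (λ k → cong (λ v → v k) (trans ([]≔-other (M [ i ]≔ r) r i≢j)
               (trans ([]≔-row M i r) (sym ([]≔-row (M [ i ]≔ r) j r)))))
    linʳ : ∀ r → F (P r z) ≡ 1ℤ * F (P r x) + 1ℤ * F (P r y)
    linʳ r = RF .RowForm.F-linear (M [ i ]≔ r) j 1ℤ 1ℤ x y
    linˡ : F (P z z) ≡ 1ℤ * F (P x z) + 1ℤ * F (P y z)
    linˡ = trans (RF .RowForm.F-cong ([]≔-comm M z z i≢j)) (trans (RF .RowForm.F-linear (M [ j ]≔ z) i 1ℤ 1ℤ x y)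
             (cong₂ (λ a b → 1ℤ * a + 1ℤ * b) (RF .RowForm.F-cong (λ k l → sym ([]≔-comm M x z i≢j k l)))
                                              (RF .RowForm.F-cong (λ k l → sym ([]≔-comm M y z i≢j k l)))))
    lem : ∀ xx xy yx yy → xx ≡ 0ℤ → yy ≡ 0ℤ → yx + xy ≡ 1ℤ * (1ℤ * xx + 1ℤ * xy) + 1ℤ * (1ℤ * yx + 1ℤ * yy)
    lem xx xy yx yy refl refl = lem' xy yx
      where
      lem' : ∀ xy yx → yx + xy ≡ 1ℤ * (1ℤ * 0ℤ + 1ℤ * xy) + 1ℤ * (1ℤ * yx + 1ℤ * 0ℤ)
      lem' = solve-∀
    solveFor : ∀ a b → a + b ≡ 0ℤ → a ≡ - b
    solveFor a b e = trans (sym (+-identityʳ a)) (trans (cong (λ t → a + t) (sym (+-inverseʳ b)))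
                       (trans (sym (+-assoc a b (- b))) (trans (cong (_- b) e) (+-identityˡ (- b)))))

  ∷-[]≔ : ∀ {m n} (r : Vec n) (B : Mat m n) i s → (r ∷ (B [ i ]≔ s)) ≐ (r ∷ B) [ suc i ]≔ s
  ∷-[]≔ r B i s zero    j = refl
  ∷-[]≔ r B i s (suc a) j = refl

  ∷-cong : ∀ {m n} {r s : Vec n} {B C : Mat m n} → (∀ j → r j ≡ s j) → B ≐ C → (r ∷ B) ≐ (s ∷ C)
  ∷-cong p q zero    j = p j
  ∷-cong p q (suc a) j = q a j

  ∷-η : ∀ {m n} (M : Mat (suc m) n) → (M zero ∷ (M ∘ suc)) ≐ M
  ∷-η M zero    j = refl
  ∷-η M (suc a) j = refl

  ∷-rowForm : ∀ {m n} {F : Mat (suc m) n → ℤ} → RowForm F → ∀ r → RowForm (λ B → F (r ∷ B))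
  ∷-rowForm RF r = record
    { F-cong = λ p → RF .RowForm.F-cong (∷-cong (λ _ → refl) p)
    ; F-linear = λ B i a b s t → trans (RF .RowForm.F-cong (∷-[]≔ r B i _)) (trans (RF .RowForm.F-linear (r ∷ B) (suc i) a b s t)
        (sym (cong₂ (λ x y → a * x + b * y) (RF .RowForm.F-cong (∷-[]≔ r B i s)) (RF .RowForm.F-cong (∷-[]≔ r B i t))))) }

  -- The induction freezes the first row and treats the rest as a form in fewer rows. With `e` a
  -- further row above the matrix, this is simultaneous elimination in all rows below it.
  absorb : ∀ {m n} (H : Mat m n → ℤ) (e : Vec n) → RowForm H → (∀ M i → H (M [ i ]≔ e) ≡ 0ℤ) →
           ∀ M (c : Vec m) → H (λ a j → M a j + c a * e j) ≡ H M
  absorb {zero}  H e RF kill M c = RF .RowForm.F-cong (λ ())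
  absorb {suc m} H e RF kill M c = begin
    H M⁺   ≡⟨ RF .RowForm.F-cong (λ { zero j → lem (M zero j) (c zero * e j) ; (suc a) j → refl }) ⟩
    H (M⁺ [ zero ]≔ (λ j → 1ℤ * M zero j + c zero * e j)) ≡⟨ RF .RowForm.F-linear M⁺ zero 1ℤ (c zero) (M zero) e ⟩
    1ℤ * H (M⁺ [ zero ]≔ M zero) + c zero * H (M⁺ [ zero ]≔ e) ≡⟨ cong₂ _+_ (*-identityˡ (H (M⁺ [ zero ]≔ M zero))) (trans (cong (c zero *_) (kill M⁺ zero)) (*-zeroʳ (c zero))) ⟩
    H (M⁺ [ zero ]≔ M zero) + 0ℤ   ≡⟨ +-identityʳ (H (M⁺ [ zero ]≔ M zero)) ⟩
    H (M⁺ [ zero ]≔ M zero)   ≡⟨ RF .RowForm.F-cong (λ { zero j → refl ; (suc a) j → refl }) ⟩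
    H (M zero ∷ (λ a j → M (suc a) j + c (suc a) * e j)) ≡⟨ absorb (λ B → H (M zero ∷ B)) e (∷-rowForm RF (M zero)) kill' (M ∘ suc) (c ∘ suc) ⟩
    H (M zero ∷ (M ∘ suc))   ≡⟨ RF .RowForm.F-cong (∷-η M) ⟩
    H M   ∎
    where
    M⁺ : Mat _ _
    M⁺ a j = M a j + c a * e j
    lem : ∀ x y → x + y ≡ 1ℤ * x + y
    lem = solve-∀
    kill' : ∀ B i → H (M zero ∷ (B [ i ]≔ e)) ≡ 0ℤ
    kill' B i = trans (RF .RowForm.F-cong (∷-[]≔ (M zero) B i e)) (kill (M zero ∷ B) (suc i))

  -- Determinants

  sgn : ∀ {n} → Fin n → ℤ
  sgn zero    = 1ℤ
  sgn (suc j) = - sgn j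

  sub : ∀ {m n} → Mat (suc m) (suc n) → Fin (suc m) → Fin (suc n) → Mat m n
  sub M i j a b = M (punchIn i a) (punchIn j b)

  opaque
    detℤ : ∀ {n} → Mat n n → ℤ
    detℤ {zero}  M = 1ℤ
    detℤ {suc n} M = ∑ (λ j → sgn j * (M zero j * detℤ (sub M zero j)))

    detℤ-[] : (M : Mat 0 0) → detℤ M ≡ 1ℤ
    detℤ-[] M = refl

    detℤ-row : ∀ {n} (M : Mat (suc n) (suc n)) → detℤ M ≡ ∑ (λ j → sgn j * (M zero j * detℤ (sub M zero j)))
    detℤ-row M = refl

  detℤ-cong : ∀ {n} {M N : Mat n n} → M ≐ N → detℤ M ≡ detℤ N
  detℤ-cong {zero}  {M} {N} p = trans (detℤ-[] M) (sym (detℤ-[] N))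
  detℤ-cong {suc n} {M} {N} p = begin
    detℤ M   ≡⟨ detℤ-row M ⟩
    ∑ (λ j → sgn j * (M zero j * detℤ (sub M zero j)))   ≡⟨ ∑-cong (λ j → cong (sgn j *_) (cong₂ _*_ (p zero j) (detℤ-cong (λ a b → p (suc a) (punchIn j b))))) ⟩
    ∑ (λ j → sgn j * (N zero j * detℤ (sub N zero j)))   ≡⟨ detℤ-row N ⟨
    detℤ N   ∎

  -- Expanding the first-row minors along their first columns and the first-column minors along their
  -- first rows yields the same double sum.
  detℤ-column : ∀ {n} (M : Mat (suc n) (suc n)) → detℤ M ≡ ∑ (λ i → sgn i * (M i zero * detℤ (sub M i zero)))
  detℤ-column {zero} M = trans (detℤ-row M) (∑-cong (λ { zero → refl }))
  detℤ-column {suc n} M = begin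
    detℤ M
      ≡⟨ trans (detℤ-row M) (∑-∷ (λ j → sgn j * (M zero j * detℤ (sub M zero j)))) ⟩
    t + ∑ (λ j → - sgn j * (x j * detℤ (sub M zero (suc j))))
      ≡⟨ cong (λ s → t + s) (∑-cong (λ j → cong (λ d → - sgn j * (x j * d)) (detℤ-column (sub M zero (suc j))))) ⟩
    t + ∑ (λ j → - sgn j * (x j * ∑ (λ i → sgn i * (y i * D i j))))
      ≡⟨ cong (λ s → t + s) (double x y D) ⟩
    t + ∑ (λ i → - sgn i * (y i * ∑ (λ j → sgn j * (x j * D i j))))
      ≡⟨ cong (λ s → t + s) (∑-cong (λ i → cong (λ d → - sgn i * (y i * d)) (detℤ-row (sub M (suc i) zero)))) ⟨
    t + ∑ (λ i → - sgn i * (y i * detℤ (sub M (suc i) zero)))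
      ≡⟨ ∑-∷ (λ i → sgn i * (M i zero * detℤ (sub M i zero))) ⟨
    ∑ (λ i → sgn i * (M i zero * detℤ (sub M i zero))) ∎
    where
    t : ℤ
    t = 1ℤ * (M zero zero * detℤ (sub M zero zero))
    x y : Vec (suc n)
    x j = M zero (suc j)
    y i = M (suc i) zero
    D : Mat (suc n) (suc n)
    D i j = detℤ (λ a b → M (suc (punchIn i a)) (suc (punchIn j b)))
    lem : ∀ s x t y d → - s * (x * (t * (y * d))) ≡ - t * (y * (s * (x * d)))
    lem = solve-∀
    pull : ∀ {n} s x (f : Vec n) → - s * (x * ∑ f) ≡ ∑ (λ i → - s * (x * f i))
    pull s x f = trans (cong (- s *_) (*-distribˡ-∑ x f)) (*-distribˡ-∑ (- s) (λ i → x * f i))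
    double : ∀ {m n} (x : Vec m) (y : Vec n) (D : Mat n m) →
      ∑ (λ j → - sgn j * (x j * ∑ (λ i → sgn i * (y i * D i j)))) ≡ ∑ (λ i → - sgn i * (y i * ∑ (λ j → sgn j * (x j * D i j))))
    double x y D = begin
      ∑ (λ j → - sgn j * (x j * ∑ (λ i → sgn i * (y i * D i j))))   ≡⟨ ∑-cong (λ j → pull (sgn j) (x j) (λ i → sgn i * (y i * D i j))) ⟩
      ∑ (λ j → ∑ (λ i → - sgn j * (x j * (sgn i * (y i * D i j))))) ≡⟨ ∑-comm (λ j i → - sgn j * (x j * (sgn i * (y i * D i j)))) ⟩
      ∑ (λ i → ∑ (λ j → - sgn j * (x j * (sgn i * (y i * D i j))))) ≡⟨ ∑-cong (λ i → ∑-cong (λ j → lem (sgn j) (x j) (sgn i) (y i) (D i j))) ⟩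
      ∑ (λ i → ∑ (λ j → - sgn i * (y i * (sgn j * (x j * D i j))))) ≡⟨ ∑-cong (λ i → pull (sgn i) (y i) (λ j → sgn j * (x j * D i j))) ⟨
      ∑ (λ i → - sgn i * (y i * ∑ (λ j → sgn j * (x j * D i j))))   ∎

  detℤ-ᵀ : ∀ {n} (M : Mat n n) → detℤ (M ᵀ) ≡ detℤ M
  detℤ-ᵀ {zero}  M = trans (detℤ-[] (M ᵀ)) (sym (detℤ-[] M))
  detℤ-ᵀ {suc n} M = begin
    detℤ (M ᵀ)   ≡⟨ detℤ-row (M ᵀ) ⟩
    ∑ (λ j → sgn j * (M j zero * detℤ ((sub M j zero) ᵀ)))   ≡⟨ ∑-cong (λ j → cong (λ d → sgn j * (M j zero * d)) (detℤ-ᵀ (sub M j zero))) ⟩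
    ∑ (λ j → sgn j * (M j zero * detℤ (sub M j zero)))   ≡⟨ detℤ-column M ⟨
    detℤ M   ∎

  detℤ-linear : ∀ {n} (M : Mat n n) i a b r s →
    detℤ (M [ i ]≔ (λ j → a * r j + b * s j)) ≡ a * detℤ (M [ i ]≔ r) + b * detℤ (M [ i ]≔ s)
  detℤ-linear {suc n} M zero a b r s = begin
    detℤ (M [ zero ]≔ (λ j → a * r j + b * s j))
      ≡⟨ detℤ-row (M [ zero ]≔ (λ j → a * r j + b * s j)) ⟩
    ∑ (λ j → sgn j * ((a * r j + b * s j) * detℤ (sub M zero j)))
      ≡⟨ ∑-cong (λ j → lem (sgn j) a (r j) b (s j) (detℤ (sub M zero j))) ⟩
    ∑ (λ j → a * (sgn j * (r j * detℤ (sub M zero j))) + b * (sgn j * (s j * detℤ (sub M zero j))))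
      ≡⟨ ∑-linear a b (λ j → sgn j * (r j * detℤ (sub M zero j))) (λ j → sgn j * (s j * detℤ (sub M zero j))) ⟩
    a * ∑ (λ j → sgn j * (r j * detℤ (sub M zero j))) + b * ∑ (λ j → sgn j * (s j * detℤ (sub M zero j)))
      ≡⟨ cong₂ (λ x y → a * x + b * y) (detℤ-row (M [ zero ]≔ r)) (detℤ-row (M [ zero ]≔ s)) ⟨
    a * detℤ (M [ zero ]≔ r) + b * detℤ (M [ zero ]≔ s) ∎
    where
    lem : ∀ t a r b s d → t * ((a * r + b * s) * d) ≡ a * (t * (r * d)) + b * (t * (s * d))
    lem = solve-∀
  detℤ-linear {suc n} M (suc i) a b r s = begin
    detℤ (M [ suc i ]≔ (λ j → a * r j + b * s j))
      ≡⟨ expand (λ j → a * r j + b * s j) ⟩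
    ∑ (λ j → sgn j * (M zero j * D j (λ k → a * r k + b * s k)))
      ≡⟨ ∑-cong (λ j → trans (cong (λ d → sgn j * (M zero j * d)) (detℤ-linear (sub M zero j) i a b (r ∘ punchIn j) (s ∘ punchIn j)))
                             (lem (sgn j) (M zero j) a (D j r) b (D j s))) ⟩
    ∑ (λ j → a * (sgn j * (M zero j * D j r)) + b * (sgn j * (M zero j * D j s)))
      ≡⟨ ∑-linear a b (λ j → sgn j * (M zero j * D j r)) (λ j → sgn j * (M zero j * D j s)) ⟩
    a * ∑ (λ j → sgn j * (M zero j * D j r)) + b * ∑ (λ j → sgn j * (M zero j * D j s))
      ≡⟨ cong₂ (λ x y → a * x + b * y) (expand r) (expand s) ⟨
    a * detℤ (M [ suc i ]≔ r) + b * detℤ (M [ suc i ]≔ s) ∎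
    where
    D : Fin (suc n) → Vec (suc n) → ℤ
    D j v = detℤ (sub M zero j [ i ]≔ (v ∘ punchIn j))
    expand : ∀ v → detℤ (M [ suc i ]≔ v) ≡ ∑ (λ j → sgn j * (M zero j * D j v))
    expand v = trans (detℤ-row (M [ suc i ]≔ v)) (∑-cong (λ j → cong (λ d → sgn j * (M zero j * d))
                 (detℤ-cong ([]≔-map (λ w → w ∘ punchIn j) (M ∘ suc) i v))))
    lem : ∀ t m a x b y → t * (m * (a * x + b * y)) ≡ a * (t * (m * x)) + b * (t * (m * y))
    lem = solve-∀

  detℤ-rowForm : ∀ {n} → RowForm (detℤ {n})
  detℤ-rowForm = record { F-cong = detℤ-cong ; F-linear = detℤ-linear }

  -- In the expansion along the first column, the terms of the two equal rows cancel: their minors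
  -- agree and their signs differ. Every other minor still has the two equal rows at its top.
  detℤ-equal₀₁ : ∀ {n} → Vanishes (detℤ {suc (suc n)}) zero (suc zero)
  detℤ-equal₀₁ {n} M eq = begin
    detℤ M
      ≡⟨ detℤ-column M ⟩
    ∑ (λ i → sgn i * (M i zero * detℤ (sub M i zero)))
      ≡⟨ trans (∑-∷ (λ i → sgn i * (M i zero * detℤ (sub M i zero)))) (cong (λ s → t + s) (∑-∷ (λ i → sgn (suc i) * (M (suc i) zero * detℤ (sub M (suc i) zero))))) ⟩
    t + (- 1ℤ * (M (suc zero) zero * detℤ (sub M (suc zero) zero)) + ∑ (λ i → sgn (suc (suc i)) * (M (suc (suc i)) zero * detℤ (sub M (suc (suc i)) zero))))
      ≡⟨ cong (λ s → t + s) (cong₂ _+_ (cong (- 1ℤ *_) (sym (cong₂ _*_ (eq zero) (detℤ-cong same)))) (∑-zero _ (others M eq))) ⟩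
    t + (- 1ℤ * (M zero zero * detℤ (sub M zero zero)) + 0ℤ)
      ≡⟨ lem (M zero zero * detℤ (sub M zero zero)) ⟩
    0ℤ ∎
    where
    t : ℤ
    t = 1ℤ * (M zero zero * detℤ (sub M zero zero))
    same : sub M zero zero ≐ sub M (suc zero) zero
    same zero    b = sym (eq (suc b))
    same (suc a) b = refl
    lem : ∀ x → 1ℤ * x + (- 1ℤ * x + 0ℤ) ≡ 0ℤ
    lem = solve-∀
    others : ∀ {n} (M : Mat (suc (suc n)) (suc (suc n))) → (∀ k → M zero k ≡ M (suc zero) k) →
      ∀ i → sgn (suc (suc i)) * (M (suc (suc i)) zero * detℤ (sub M (suc (suc i)) zero)) ≡ 0ℤ
    others {suc n} M eq i = trans (cong (λ d → sgn (suc (suc i)) * (M (suc (suc i)) zero * d)) (detℤ-equal₀₁ (sub M (suc (suc i)) zero) (λ k → eq (suc k))))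
      (lem' (sgn (suc (suc i))) (M (suc (suc i)) zero))
      where
      lem' : ∀ s m → s * (m * 0ℤ) ≡ 0ℤ
      lem' = solve-∀

  detℤ-equal-suc : ∀ {n} → (∀ {i j : Fin n} → i ≢ j → Vanishes detℤ i j) →
    ∀ {i j : Fin n} → i ≢ j → Vanishes (detℤ {suc n}) (suc i) (suc j)
  detℤ-equal-suc IH i≢j M eq = trans (detℤ-row M) (∑-zero _ (λ l →
    trans (cong (λ d → sgn l * (M zero l * d)) (IH i≢j (sub M zero l) (λ k → eq (punchIn l k)))) (lem (sgn l) (M zero l))))
    where
    lem : ∀ s m → s * (m * 0ℤ) ≡ 0ℤ
    lem = solve-∀

  -- Rows 1 and j + 2 both avoid row 0, so exchanging them is covered by the inductive case and
  -- leaves equal rows 0 and 1.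
  detℤ-equal-zero : ∀ {n} → (∀ {i j : Fin n} → i ≢ j → Vanishes detℤ i j) →
    ∀ (j : Fin n) → Vanishes (detℤ {suc n}) zero (suc j)
  detℤ-equal-zero IH zero M eq = detℤ-equal₀₁ M eq
  detℤ-equal-zero {suc (suc n)} IH (suc j) M eq = begin
    detℤ M   ≡⟨ neg-involutive (detℤ M) ⟨
    - - detℤ M   ≡⟨ cong -_ (swap detℤ-rowForm {suc zero} {suc (suc j)} (λ ()) (detℤ-equal-suc IH {zero} {suc j} (λ ())) M) ⟨
    - detℤ N   ≡⟨ cong -_ (detℤ-equal₀₁ N eq) ⟩
    0ℤ   ∎
    where
    N : Mat _ _
    N = M [ suc zero ]≔ M (suc (suc j)) [ suc (suc j) ]≔ M (suc zero)

  detℤ-equal : ∀ {n} {i j : Fin n} → i ≢ j → Vanishes detℤ i j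
  detℤ-equal {suc n} {zero}  {zero}  i≢j M eq = ⊥-elim (i≢j refl)
  detℤ-equal {suc n} {zero}  {suc j} i≢j M eq = detℤ-equal-zero detℤ-equal j M eq
  detℤ-equal {suc n} {suc i} {zero}  i≢j M eq = detℤ-equal-zero detℤ-equal i M (λ k → sym (eq k))
  detℤ-equal {suc n} {suc i} {suc j} i≢j M eq = detℤ-equal-suc detℤ-equal (i≢j ∘ cong suc) M eq

  -- By linearity in row `i` only the multiple of the old row `i` survives. Cramer's rule and most
  -- later divisibilities of det W rest on this.
  detℤ-replace : ∀ {n} (M : Mat n n) i (c : Vec n) → detℤ (M [ i ]≔ (c ⋆ M)) ≡ c i * detℤ M
  detℤ-replace M i c = begin
    detℤ (M [ i ]≔ (c ⋆ M))   ≡⟨ RowForm.F-∑ detℤ-rowForm M i c M ⟩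
    c ∙ (λ k → detℤ (M [ i ]≔ M k))   ≡⟨ ∙-∑ c (λ k → detℤ (M [ i ]≔ M k)) ⟩
    ∑ (λ k → c k * detℤ (M [ i ]≔ M k)) ≡⟨ ∑-single (λ k → c k * detℤ (M [ i ]≔ M k)) i (λ k k≢i → trans (cong (c k *_) (repeated k k≢i)) (*-zeroʳ (c k))) ⟩
    c i * detℤ (M [ i ]≔ M i)   ≡⟨ cong (c i *_) (detℤ-cong ([]≔-self M i)) ⟩
    c i * detℤ M   ∎
    where
    repeated : ∀ k → k ≢ i → detℤ (M [ i ]≔ M k) ≡ 0ℤ
    repeated k k≢i = detℤ-equal {i = i} {k} (k≢i ∘ sym) (M [ i ]≔ M k)
      (λ l → cong (λ v → v l) (trans ([]≔-row M i (M k)) (sym ([]≔-other M (M k) k≢i))))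

  -- Cofactors are determinants with a unit row: linearity in that row yields the adjugate identity
  -- without signs or minors.
  adjugate : ∀ {n} → Mat n n → Mat n n
  adjugate M k i = detℤ (M [ i ]≔ δ k)

  ·-adjugate : ∀ {n} (M : Mat n n) → M · adjugate M ≐ (λ i j → detℤ M * δ i j)
  ·-adjugate M i j = begin
    M i ∙ (λ k → detℤ (M [ j ]≔ δ k))  ≡⟨ RowForm.F-∑ detℤ-rowForm M j (M i) δ ⟨
    detℤ (M [ j ]≔ (M i ⋆ δ))   ≡⟨ detℤ-cong ([]≔-cong j (λ _ _ _ → refl) (λ k → trans (·-δ M i k) (sym (δ-· M i k)))) ⟩
    detℤ (M [ j ]≔ (δ i ⋆ M))   ≡⟨ detℤ-replace M j (δ i) ⟩
    δ i j * detℤ M   ≡⟨ *-comm (δ i j) (detℤ M) ⟩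
    detℤ M * δ i j   ∎

  adjugateˡ : ∀ {n} → Mat n n → Mat n n
  adjugateˡ M = adjugate (M ᵀ) ᵀ

  adjugateˡ-· : ∀ {n} (M : Mat n n) → adjugateˡ M · M ≐ (λ i j → detℤ M * δ i j)
  adjugateˡ-· M i j = begin
    (adjugateˡ M · M) i j   ≡⟨ ∙-comm (λ k → adjugate (M ᵀ) k i) (λ k → M k j) ⟩
    (M ᵀ · adjugate (M ᵀ)) j i   ≡⟨ ·-adjugate (M ᵀ) j i ⟩
    detℤ (M ᵀ) * δ j i   ≡⟨ cong₂ _*_ (detℤ-ᵀ M) (δ-sym j i) ⟩
    detℤ M * δ i j   ∎

  detℤ-δ : ∀ {n} → detℤ (δ {n}) ≡ 1ℤ
  detℤ-δ {zero}  = detℤ-[] δ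
  detℤ-δ {suc n} = begin
    detℤ δ   ≡⟨ detℤ-row δ ⟩
    ∑ (λ j → sgn j * (δ zero j * detℤ (sub δ zero j)))   ≡⟨ ∑-single (λ j → sgn j * (δ zero j * detℤ (sub δ zero j))) zero off ⟩
    1ℤ * (1ℤ * detℤ (δ {n}))   ≡⟨ cong (λ d → 1ℤ * (1ℤ * d)) (detℤ-δ {n}) ⟩
    1ℤ   ∎
    where
    off : ∀ j → j ≢ zero → sgn j * (δ zero j * detℤ (sub δ zero j)) ≡ 0ℤ
    off zero    j≢0 = ⊥-elim (j≢0 refl)
    off (suc j) j≢0 = *-zeroʳ (sgn (suc j))

  -- Uniqueness of alternating forms and multiplicativity of the determinant.

  insert₀ : ∀ {n} → Fin (suc n) → Vec n → Vec (suc n)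
  insert₀ j r = insertAt r j 0ℤ

  insert₀-cong : ∀ {n} (j : Fin (suc n)) {r s : Vec n} → (∀ k → r k ≡ s k) → ∀ k → insert₀ j r k ≡ insert₀ j s k
  insert₀-cong         zero    p zero    = refl
  insert₀-cong         zero    p (suc k) = p k
  insert₀-cong {suc n} (suc j) p zero    = p zero
  insert₀-cong {suc n} (suc j) p (suc k) = insert₀-cong j (p ∘ suc) k

  insert₀-linear : ∀ {n} (j : Fin (suc n)) a b (r s : Vec n) k →
    insert₀ j (λ l → a * r l + b * s l) k ≡ a * insert₀ j r k + b * insert₀ j s k
  insert₀-linear         zero    a b r s zero    = sym (cong₂ _+_ (*-zeroʳ a) (*-zeroʳ b))
  insert₀-linear         zero    a b r s (suc k) = refl
  insert₀-linear {suc n} (suc j) a b r s zero    = refl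
  insert₀-linear {suc n} (suc j) a b r s (suc k) = insert₀-linear j a b (r ∘ suc) (s ∘ suc) k

  insert₀-split : ∀ {n} (j : Fin (suc n)) (v : Vec (suc n)) k → v k ≡ insert₀ j (v ∘ punchIn j) k + v j * δ j k
  insert₀-split         zero    v zero    = sym (trans (+-identityˡ (v zero * 1ℤ)) (*-identityʳ (v zero)))
  insert₀-split         zero    v (suc k) = sym (trans (cong (λ t → v (suc k) + t) (*-zeroʳ (v zero))) (+-identityʳ (v (suc k))))
  insert₀-split {suc n} (suc j) v zero    = sym (trans (cong (λ t → v zero + t) (*-zeroʳ (v (suc j)))) (+-identityʳ (v zero)))
  insert₀-split {suc n} (suc j) v (suc k) = insert₀-split j (v ∘ suc) k

  module _ {n} {F : Mat (suc n) (suc n) → ℤ} (AF : Alternating F) where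
    open Alternating AF
    open RowForm rowForm

    -- The cofactor of the entry (0, j) for an arbitrary alternating form: below a unit first row,
    -- column `j` can be cleared and only the minor matters.
    deleted : Fin (suc n) → Mat n n → ℤ
    deleted j B = F (δ j ∷ (λ a → insert₀ j (B a)))

    deleted-alternating : ∀ j → Alternating (deleted j)
    deleted-alternating j = record
      { rowForm = record
        { F-cong = λ p → F-cong (∷-cong (λ _ → refl) (λ a → insert₀-cong j (p a)))
        ; F-linear = λ B i a b r s → trans (update B i (λ l → a * r l + b * s l)) (trans (F-cong (∷-cong (λ _ → refl) ([]≔-cong i (λ _ _ _ → refl) (insert₀-linear j a b r s))))
            (trans (RowForm.F-linear (∷-rowForm rowForm (δ j)) (λ a → insert₀ j (B a)) i a b (insert₀ j r) (insert₀ j s))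
            (sym (cong₂ (λ x y → a * x + b * y) (update B i r) (update B i s))))) }
      ; F-equal = λ {i} {k} i≢k M eq → F-equal {suc i} {suc k} (i≢k ∘ suc-injective) _ (insert₀-cong j eq) }
      where
      update : ∀ B i r → deleted j (B [ i ]≔ r) ≡ F (δ j ∷ ((λ a → insert₀ j (B a)) [ i ]≔ insert₀ j r))
      update B i r = F-cong (∷-cong (λ _ → refl) ([]≔-map (insert₀ j) B i r))

    expand-row : ∀ M → F M ≡ ∑ (λ j → M zero j * deleted j (sub M zero j))
    expand-row M = begin
      F M
        ≡⟨ F-cong ([]≔-self M zero) ⟨
      F (M [ zero ]≔ M zero)
        ≡⟨ F-cong ([]≔-cong zero (λ _ _ _ → refl) (λ k → sym (·-δ M zero k))) ⟩
      F (M [ zero ]≔ (M zero ⋆ δ))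
        ≡⟨ F-∑ M zero (M zero) δ ⟩
      M zero ∙ (λ j → F (M [ zero ]≔ δ j))
        ≡⟨ ∙-∑ (M zero) (λ j → F (M [ zero ]≔ δ j)) ⟩
      ∑ (λ j → M zero j * F (M [ zero ]≔ δ j))
        ≡⟨ ∑-cong (λ j → cong (M zero j *_) (clear j)) ⟩
      ∑ (λ j → M zero j * deleted j (sub M zero j)) ∎
      where
      clear : ∀ j → F (M [ zero ]≔ δ j) ≡ deleted j (sub M zero j)
      clear j = begin
        F (M [ zero ]≔ δ j)
          ≡⟨ F-cong (λ { zero k → refl ; (suc a) k → insert₀-split j (M (suc a)) k }) ⟩
        F (δ j ∷ (λ a k → insert₀ j (sub M zero j a) k + M (suc a) j * δ j k))
          ≡⟨ absorb (λ B → F (δ j ∷ B)) (δ j) (∷-rowForm rowForm (δ j)) kill (λ a → insert₀ j (sub M zero j a)) (λ a → M (suc a) j) ⟩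
        deleted j (sub M zero j) ∎
        where
        kill : ∀ B i → F (δ j ∷ (B [ i ]≔ δ j)) ≡ 0ℤ
        kill B i = F-equal {zero} {suc i} (λ ()) _ (λ k → sym (cong (λ v → v k) ([]≔-row B i (δ j))))

  -- Exchanging the first two rows reduces column j + 1 to column j of a form one size smaller, at
  -- the price of one sign.
  deleted-δ : ∀ {n} {F : Mat (suc n) (suc n) → ℤ} (AF : Alternating F) j → deleted AF j δ ≡ sgn j * F δ
  deleted-δ {n} {F} AF zero = trans (RowForm.F-cong (Alternating.rowForm AF) (λ
    { zero k → refl ; (suc a) zero → refl ; (suc a) (suc k) → refl })) (sym (*-identityˡ (F δ)))
  deleted-δ {suc n} {F} AF (suc j) = begin
    deleted AF (suc j) δ   ≡⟨ neg-involutive (deleted AF (suc j) δ) ⟨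
    - - deleted AF (suc j) δ   ≡⟨ cong -_ (swap rowForm {zero} {suc zero} (λ ()) (F-equal (λ ())) P) ⟨
    - F (P [ zero ]≔ P (suc zero) [ suc zero ]≔ P zero) ≡⟨ cong -_ (F-cong same) ⟩
    - deleted AF zero (δ j ∷ (λ a → insert₀ j (δ a))) ≡⟨ cong -_ (deleted-δ (deleted-alternating AF zero) j) ⟩
    - (sgn j * deleted AF zero δ)     ≡⟨ cong (λ t → - (sgn j * t)) (deleted-δ AF zero) ⟩
    - (sgn j * (1ℤ * F δ))   ≡⟨ lem (sgn j) (F δ) ⟩
    - sgn j * F δ   ∎
    where
    open Alternating AF
    open RowForm rowForm
    P : Mat _ _
    P = δ (suc j) ∷ (λ a → insert₀ (suc j) (δ a))
    zeros : ∀ {n} (i : Fin (suc n)) k → insert₀ i (λ _ → 0ℤ) k ≡ 0ℤ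
    zeros         zero    zero    = refl
    zeros         zero    (suc k) = refl
    zeros {suc n} (suc i) zero    = refl
    zeros {suc n} (suc i) (suc k) = zeros i k
    same : P [ zero ]≔ P (suc zero) [ suc zero ]≔ P zero ≐ δ zero ∷ (λ a → insert₀ zero ((δ j ∷ (λ a → insert₀ j (δ a))) a))
    same zero          zero    = refl
    same zero          (suc k) = zeros j k
    same (suc zero)    zero    = refl
    same (suc zero)    (suc k) = refl
    same (suc (suc a)) zero    = refl
    same (suc (suc a)) (suc k) = refl
    lem : ∀ s x → - (s * (1ℤ * x)) ≡ - s * x
    lem = solve-∀

  alternating-unique : ∀ {n} {F : Mat n n → ℤ} → Alternating F → ∀ M → F M ≡ detℤ M * F δ
  alternating-unique {zero} {F} AF M = trans (RowForm.F-cong (Alternating.rowForm AF) (λ ()))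
    (sym (trans (cong (_* F δ) (detℤ-[] M)) (*-identityˡ (F δ))))
  alternating-unique {suc n} {F} AF M = begin
    F M   ≡⟨ expand-row AF M ⟩
    ∑ (λ j → M zero j * deleted AF j (sub M zero j))   ≡⟨ ∑-cong (λ j → cong (M zero j *_) (alternating-unique (deleted-alternating AF j) (sub M zero j))) ⟩
    ∑ (λ j → M zero j * (D j * deleted AF j δ))   ≡⟨ ∑-cong (λ j → cong (λ t → M zero j * (D j * t)) (deleted-δ AF j)) ⟩
    ∑ (λ j → M zero j * (D j * (sgn j * F δ)))   ≡⟨ ∑-cong (λ j → lem (M zero j) (D j) (sgn j) (F δ)) ⟩
    ∑ (λ j → F δ * (sgn j * (M zero j * D j)))   ≡⟨ *-distribˡ-∑ (F δ) (λ j → sgn j * (M zero j * D j)) ⟨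
    F δ * ∑ (λ j → sgn j * (M zero j * D j))   ≡⟨ cong (F δ *_) (detℤ-row M) ⟨
    F δ * detℤ M   ≡⟨ *-comm (F δ) (detℤ M) ⟩
    detℤ M * F δ   ∎
    where
    D : Fin (suc n) → ℤ
    D j = detℤ (sub M zero j)
    lem : ∀ m d s f → m * (d * (s * f)) ≡ f * (s * (m * d))
    lem = solve-∀

  detℤ-· : ∀ {n} (A B : Mat n n) → detℤ (A · B) ≡ detℤ A * detℤ B
  detℤ-· A B = trans (alternating-unique AF A) (cong (detℤ A *_) (detℤ-cong (δ-· B)))
    where
    update : ∀ M i r → (M [ i ]≔ r) · B ≐ (M · B) [ i ]≔ (r ⋆ B)
    update M i r = []≔-map (_⋆ B) M i r
    AF : Alternating (λ M → detℤ (M · B))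
    AF = record
      { rowForm = record
        { F-cong = λ p → detℤ-cong (·-cong p (λ _ _ → refl))
        ; F-linear = λ M i a b r s → trans (detℤ-cong (update M i _)) (trans (detℤ-cong ([]≔-cong i (λ _ _ _ → refl) (λ j → ∙-linearˡ a b r s (λ k → B k j))))
            (trans (detℤ-linear (M · B) i a b (r ⋆ B) (s ⋆ B))
            (sym (cong₂ (λ x y → a * x + b * y) (detℤ-cong (update M i r)) (detℤ-cong (update M i s)))))) }
      ; F-equal = λ i≢j M eq → detℤ-equal i≢j (M · B) (λ k → ∙-cong eq (λ _ → refl)) }

  -- Linear algebra modulo a prime

  ∣-respʳ : ∀ {k x y} → x ≡ y → k ∣ x → k ∣ y
  ∣-respʳ e = subst (_ ∣_) e

  ∣-0 : ∀ {k} → k ∣ 0ℤ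
  ∣-0 = divides 0ℤ refl

  ∣-*-pres : ∀ {a b c d} → a ∣ c → b ∣ d → a * b ∣ c * d
  ∣-*-pres {a} {b} (divides q refl) (divides r refl) = divides (q * r) (lem q a r b)
    where
    lem : ∀ q a r b → q * a * (r * b) ≡ q * r * (a * b)
    lem = solve-∀

  ∣-add : ∀ {k} a x b y → k ∣ x → k ∣ y → k ∣ a * x + b * y
  ∣-add a x b y p q = ∣m∣n⇒∣m+n (∣n⇒∣m*n a p) (∣n⇒∣m*n b q)

  detℤ-mod : ∀ {n m} {M N : Mat n n} → (∀ i j → m ∣ M i j - N i j) → m ∣ detℤ M - detℤ N
  detℤ-mod {zero}  {m} {M} {N} h = ∣-respʳ (sym (cong₂ _-_ (detℤ-[] M) (detℤ-[] N))) ∣-0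
  detℤ-mod {suc n} {m} {M} {N} h = ∣-respʳ (sym eq) (∑-∣ (λ j → f M j - f N j) (λ j → ∣-respʳ (lem (sgn j) (M zero j) (N zero j) (D M j) (D N j))
      (∣n⇒∣m*n (sgn j) (∣-add (D M j) (M zero j - N zero j) (N zero j) (D M j - D N j) (h zero j) (detℤ-mod (λ a b → h (suc a) (punchIn j b)))))))
    where
    D : Mat (suc n) (suc n) → Fin (suc n) → ℤ
    D M j = detℤ (sub M zero j)
    f : Mat (suc n) (suc n) → Fin (suc n) → ℤ
    f M j = sgn j * (M zero j * D M j)
    eq : detℤ M - detℤ N ≡ ∑ (λ j → f M j - f N j)
    eq = trans (cong₂ _-_ (detℤ-row M) (detℤ-row N)) (sym (∑-minus (f M) (f N)))
    lem : ∀ s m n d e → s * (d * (m - n) + n * (d - e)) ≡ s * (m * d) - s * (n * e)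
    lem = solve-∀

  ∏ : ∀ {n} → Vec n → ℤ
  ∏ {zero}  q = 1ℤ
  ∏ {suc n} q = q zero * ∏ (λ i → q (suc i))

  detℤ-rows-∣ : ∀ {n} (q : Vec n) (M : Mat n n) → (∀ i j → q i ∣ M i j) → ∏ q ∣ detℤ M
  detℤ-rows-∣ {zero}  q M h = ∣-reflexive (sym (detℤ-[] M))
  detℤ-rows-∣ {suc n} q M h = ∣-respʳ (sym (detℤ-row M)) (∑-∣ (λ j → sgn j * (M zero j * detℤ (sub M zero j)))
    (λ j → ∣n⇒∣m*n (sgn j) (∣-*-pres (h zero j) (detℤ-rows-∣ (q ∘ suc) (sub M zero j) (λ a b → h (suc a) (punchIn j b))))))

  detℤ-scale : ∀ {n} (M : Mat n n) i a r → detℤ (M [ i ]≔ (λ j → a * r j)) ≡ a * detℤ (M [ i ]≔ r)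
  detℤ-scale M i a r = trans (detℤ-cong ([]≔-cong i (λ _ _ _ → refl) (λ j → sym (+-identityʳ (a * r j)))))
    (trans (detℤ-linear M i a 0ℤ r r) (+-identityʳ (a * detℤ (M [ i ]≔ r))))

  -- This is how factors of det W are gained: a row may be replaced by v W / q, and det W acquires q
  -- up to the factor `v i`.
  row-quotient : ∀ {n} (W : Mat n n) i v q (z : Vec n) → (∀ j → (v ⋆ W) j ≡ q * z j) → v i * detℤ W ≡ q * detℤ (W [ i ]≔ z)
  row-quotient W i v q z h = begin
    v i * detℤ W   ≡⟨ detℤ-replace W i v ⟨
    detℤ (W [ i ]≔ (v ⋆ W))   ≡⟨ detℤ-cong ([]≔-cong i (λ _ _ _ → refl) h) ⟩
    detℤ (W [ i ]≔ (λ j → q * z j))   ≡⟨ detℤ-scale W i q z ⟩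
    q * detℤ (W [ i ]≔ z)   ∎

  factor : ∀ {n q} (u : Vec n) → (∀ j → q ∣ u j) → ∃ λ (z : Vec n) → ∀ j → u j ≡ q * z j
  factor {q = q} u h = (λ j → _∣_.quotient (h j)) , λ j → trans (_∣_.equality (h j)) (*-comm (_∣_.quotient (h j)) q)

  left-kernel-det : ∀ {n} (W : Mat n n) i v q → (∀ j → q ∣ (v ⋆ W) j) → q ∣ v i * detℤ W
  left-kernel-det W i v q h with factor (v ⋆ W) h
  ... | z , e = divides (detℤ (W [ i ]≔ z)) (trans (row-quotient W i v q z e) (*-comm q (detℤ (W [ i ]≔ z))))

  right-kernel-det : ∀ {n} (W : Mat n n) j x q → (∀ i → q ∣ (W ▹ x) i) → q ∣ x j * detℤ W
  right-kernel-det W j x q h = ∣-respʳ (cong (x j *_) (detℤ-ᵀ W))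
    (left-kernel-det (W ᵀ) j x q (λ i → ∣-respʳ (∙-comm (W i) x) (h i)))

  module ModPrime (p : ℕ) (pp : Prime p) where

    P : ℤ
    P = + p

    P-euclid : ∀ x y → P ∣ x * y → P ∣ x ⊎ P ∣ y
    P-euclid x y h with euclidsLemma (abs x) (abs y) pp (subst (p ℕ.∣_) (abs-* x y) (∣⇒∣ᵤ h))
    ... | inj₁ a = inj₁ (∣ᵤ⇒∣ a)
    ... | inj₂ b = inj₂ (∣ᵤ⇒∣ b)

    P-cancel : ∀ {x y} → ¬ P ∣ x → P ∣ x * y → P ∣ y
    P-cancel {x} {y} ¬x h with P-euclid x y h
    ... | inj₁ a = ⊥-elim (¬x a)
    ... | inj₂ b = b

    P∤1 : ¬ P ∣ 1ℤ
    P∤1 h = ℕ.nonTrivial⇒≢1 {{prime⇒nonTrivial pp}} (ℕ.∣1⇒≡1 (∣⇒∣ᵤ h))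

    instance
      P-nonZero : ℤ.NonZero P
      P-nonZero = prime⇒nonZero pp

    P^-cancel : ∀ k {x y} → ¬ P ∣ x → P ^ k ∣ x * y → P ^ k ∣ y
    P^-cancel zero    {x} {y} ¬x h = divides y (sym (*-identityʳ y))
    P^-cancel (suc k) {x} {y} ¬x h with P-cancel ¬x (∣-trans (∣m⇒∣m*n (P ^ k) (∣-refl {P})) h)
    ... | divides y' refl = ∣-respʳ (*-comm P y') (*-monoʳ-∣ P (P^-cancel k ¬x (*-cancelˡ-∣ P (∣-respʳ (lem x y' P) h))))
      where
      lem : ∀ x y p → x * (y * p) ≡ p * (x * y)
      lem = solve-∀

    P-inverse : ∀ {a} → ¬ P ∣ a → ∃ λ t → P ∣ t * a - 1ℤ
    P-inverse {a} ¬a with coprime-Bézout {abs a} {p} coprime | m∣∣m∣ {a}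
      where
      coprime : Coprime (abs a) p
      coprime {d} (d∣a , d∣p) with prime⇒irreducible pp d∣p
      ... | inj₁ d≡1  = d≡1
      ... | inj₂ refl = ⊥-elim (¬a (∣ᵤ⇒∣ d∣a))
    ... | GCD.Bézout.+- x y eq | divides q e = + x * q , divides (+ y) (begin
      + x * q * a - 1ℤ   ≡⟨ cong (_- 1ℤ) (*-assoc (+ x) q a) ⟩
      + x * (q * a) - 1ℤ   ≡⟨ cong (λ t → + x * t - 1ℤ) e ⟨
      + x * + abs a - 1ℤ   ≡⟨ cong (_- 1ℤ) (trans (sym (pos-* x (abs a))) (trans (cong +_ (sym eq)) (trans (pos-+ 1 (y ℕ.* p)) (cong (λ t → 1ℤ + t) (pos-* y p))))) ⟩
      1ℤ + + y * P - 1ℤ   ≡⟨ lem (+ y * P) ⟩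
      + y * P   ∎)
      where
      lem : ∀ t → 1ℤ + t - 1ℤ ≡ t
      lem = solve-∀
    ... | GCD.Bézout.-+ x y eq | divides q e = - (+ x) * q , divides (- (+ y)) (begin
      - (+ x) * q * a - 1ℤ   ≡⟨ cong (_- 1ℤ) (*-assoc (- (+ x)) q a) ⟩
      - (+ x) * (q * a) - 1ℤ   ≡⟨ cong (λ t → - (+ x) * t - 1ℤ) e ⟨
      - (+ x) * + abs a - 1ℤ   ≡⟨ lem (+ x) (+ abs a) ⟩
      - (1ℤ + + x * + abs a)   ≡⟨ cong -_ (trans (cong (λ t → 1ℤ + t) (sym (pos-* x (abs a)))) (trans (sym (pos-+ 1 (x ℕ.* abs a))) (trans (cong +_ eq) (pos-* y p)))) ⟩
      - (+ y * P)   ≡⟨ neg-distribˡ-* (+ y) P ⟩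
      - (+ y) * P   ∎)
      where
      lem : ∀ x t → - x * t - 1ℤ ≡ - (1ℤ + x * t)
      lem = solve-∀

    all-or-not : ∀ {n} (u : Vec n) → (∀ i → P ∣ u i) ⊎ (∃ λ i → ¬ P ∣ u i)
    all-or-not {n} u with all? (λ i → P ∣? u i)
    ... | yes h = inj₁ h
    ... | no ¬h = inj₂ (¬∀⟶∃¬ n (λ i → P ∣ u i) (λ i → P ∣? u i) ¬h)

    -- The Fredholm alternative modulo p.

    Solution : ∀ {m n} → Mat m n → Vec m → Set
    Solution {n = n} M b = ∃ λ (x : Vec n) → ∀ i → P ∣ M i ∙ x - b i

    Obstruction : ∀ {m n} → Mat m n → Vec m → Set
    Obstruction {m} M b = ∃ λ (y : Vec m) → (∀ j → P ∣ (y ⋆ M) j) × P ∣ y ∙ b - 1ℤ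

    -- Elimination of one column at a time. An invertible entry `M i zero` clears its column in all
    -- rows, row `i` included, and either outcome for the remaining columns is lifted back.
    fredholm : ∀ {m n} (M : Mat m n) (b : Vec m) → Solution M b ⊎ Obstruction M b
    fredholm {m} {zero} M b with all-or-not b
    ... | inj₁ h = inj₁ ((λ ()) , λ i → ∣m∣n⇒∣m-n (∣-respʳ (sym (∙-[] (M i) (λ ()))) ∣-0) (h i))
    ... | inj₂ (i , ¬bi) with P-inverse ¬bi
    ...   | t , h = inj₂ ((λ k → t * δ i k) , (λ ()) , ∣-respʳ (cong (_- 1ℤ) (sym (trans (∙-scaleˡ t (δ i) b) (cong (t *_) (δ-∙ b i))))) h)
    fredholm {m} {suc n} M b with all-or-not (λ i → M i zero)
    ... | inj₁ h with fredholm (λ i j → M i (suc j)) b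
    ...   | inj₁ (x , e) = inj₁ ((0ℤ ∷ x) , λ i → ∣-respʳ (cong (_- b i) (sym (trans (∙-∷ (M i) (0ℤ ∷ x)) (trans (cong (_+ ((λ j → M i (suc j)) ∙ x)) (*-zeroʳ (M i zero))) (+-identityˡ ((λ j → M i (suc j)) ∙ x)))))) (e i))
    ...   | inj₂ (y , k , e) = inj₂ (y , (λ { zero → ∙-∣ y h ; (suc j) → k j }) , e)
    fredholm {m} {suc n} M b | inj₂ (i , ¬Mi) = pivot (P-inverse ¬Mi)
      where
      col₀ : Vec m
      col₀ k = M k zero
      pivot : (∃ λ t → P ∣ t * M i zero - 1ℤ) → Solution M b ⊎ Obstruction M b
      pivot (t , ht) with fredholm (λ k j → M k (suc j) - M k zero * (t * M i (suc j))) (λ k → b k - M k zero * (t * b i))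
      ... | inj₁ (x , e) = inj₁ (x⁺ , λ k → ∣-respʳ (eq k) (e k))
        where
        r : Mat m n
        r k j = M k (suc j)
        x⁺ : Vec (suc n)
        -- The first unknown is solved from the pivot row `i`.
        x⁺ = t * (b i - r i ∙ x) ∷ x
        lem : ∀ c m t y z w → (1ℤ * y + - (m * t) * w) - (z - m * (t * c)) ≡ m * (t * (c - w)) + y - z
        lem = solve-∀
        lem' : ∀ y m t w → y - m * (t * w) ≡ 1ℤ * y + - (m * t) * w
        lem' = solve-∀
        eq : ∀ k → (λ j → M k (suc j) - M k zero * (t * M i (suc j))) ∙ x - (b k - M k zero * (t * b i)) ≡ M k ∙ x⁺ - b k
        eq k = begin
          (λ j → M k (suc j) - M k zero * (t * M i (suc j))) ∙ x - (b k - M k zero * (t * b i))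
            ≡⟨ cong (_- (b k - M k zero * (t * b i))) (trans (∙-cong (λ j → lem' (M k (suc j)) (M k zero) t (M i (suc j))) (λ _ → refl)) (∙-linearˡ 1ℤ (- (M k zero * t)) (r k) (r i) x)) ⟩
          1ℤ * (r k ∙ x) + - (M k zero * t) * (r i ∙ x) - (b k - M k zero * (t * b i))
            ≡⟨ lem (b i) (M k zero) t (r k ∙ x) (b k) (r i ∙ x) ⟩
          M k zero * (t * (b i - r i ∙ x)) + r k ∙ x - b k
            ≡⟨ cong (_- b k) (∙-∷ (M k) x⁺) ⟨
          M k ∙ x⁺ - b k ∎
      ... | inj₂ (y , k , e) = inj₂ (y⁺ , k⁺ , ∣-respʳ (cong (_- 1ℤ) (trans (reduced b (b i)) (sym (paired b)))) e)
        where
        S : ℤ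
        S = y ∙ col₀
        y⁺ : Vec m
        -- The correction at coordinate `i` makes the combination vanish on the pivot column; on the
        -- other columns and on `b` it undoes the elimination.
        y⁺ l = 1ℤ * y l + - (S * t) * δ i l
        paired : ∀ c → y⁺ ∙ c ≡ y ∙ c - S * (t * c i)
        paired c = trans (∙-linearˡ 1ℤ (- (S * t)) y (δ i) c) (trans (cong (λ s → 1ℤ * (y ∙ c) + - (S * t) * s) (δ-∙ c i)) (lem (y ∙ c) S t (c i)))
          where
          lem : ∀ y s t c → 1ℤ * y + - (s * t) * c ≡ y - s * (t * c)
          lem = solve-∀
        reduced : ∀ (c : Vec m) d → y ∙ (λ l → c l - M l zero * (t * d)) ≡ y ∙ c - S * (t * d)
        reduced c d = trans (∙-cong (λ _ → refl) (λ l → lem (c l) (M l zero) (t * d))) (trans (∙-linearʳ 1ℤ (- (t * d)) c col₀ y) (lem' (y ∙ c) S (t * d)))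
          where
          lem : ∀ c m s → c - m * s ≡ 1ℤ * c + - s * m
          lem = solve-∀
          lem' : ∀ c m s → 1ℤ * c + - s * m ≡ c - m * s
          lem' = solve-∀
        k⁺ : ∀ j → P ∣ (y⁺ ⋆ M) j
        k⁺ zero = ∣-respʳ (trans (lem S (t * M i zero)) (sym (paired col₀))) (∣n⇒∣m*n (- S) ht)
          where
          lem : ∀ s t → - s * (t - 1ℤ) ≡ s - s * t
          lem = solve-∀
        k⁺ (suc j) = ∣-respʳ (trans (reduced (λ l → M l (suc j)) (M i (suc j))) (sym (paired (λ l → M l (suc j))))) (k j)

    choose : ∀ {n} {A : Fin n → Set} {B : Set} → (∀ i → A i ⊎ B) → (∀ i → A i) ⊎ B
    choose {zero}  f = inj₁ (λ ())
    choose {suc n} f with f zero | choose (λ i → f (suc i))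
    ... | inj₂ b | _      = inj₂ b
    ... | inj₁ a | inj₂ b = inj₂ b
    ... | inj₁ a | inj₁ g = inj₁ λ { zero → a ; (suc i) → g i }

    -- If `M ᵀ` reached every unit vector, the solutions would form a left inverse of `M` modulo P,
    -- while the left kernel vector forces P to divide `detℤ M`. An obstruction for `δ j` is itself
    -- a right kernel vector, nonzero at `j`.
    right-kernel : ∀ {n} (M : Mat n n) v i → ¬ P ∣ v i → (∀ j → P ∣ (v ⋆ M) j) →
      ∃ λ (x : Vec n) → (∀ i → P ∣ (M ▹ x) i) × ∃ λ j → ¬ P ∣ x j
    right-kernel {n} M v i ¬vi h with choose {A = λ j → Solution (M ᵀ) (δ j)} solve
      where
      solve : ∀ j → Solution (M ᵀ) (δ j) ⊎ (∃ λ (x : Vec n) → (∀ i → P ∣ (M ▹ x) i) × ∃ λ j → ¬ P ∣ x j)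
      solve j with fredholm (M ᵀ) (δ j)
      ... | inj₁ s = inj₁ s
      ... | inj₂ (x , k , e) = inj₂ (x , (λ l → ∣-respʳ (∙-comm x (M l)) (k l)) , j , λ xj →
              P∤1 (∣-respʳ (lem (x j)) (∣m∣n⇒∣m-n xj (∣-respʳ (cong (_- 1ℤ) (∙-δ x j)) e))))
        where
        lem : ∀ x → x - (x - 1ℤ) ≡ 1ℤ
        lem = solve-∀
    ... | inj₂ r = r
    ... | inj₁ s = ⊥-elim (P∤1 (∣-respʳ lem₁ (∣m∣n⇒∣m-n (∣n⇒∣m*n (detℤ B) P∣det) (∣-respʳ (cong₂ _-_ (detℤ-· B M) detℤ-δ) unit))))
      where
      B : Mat n n
      B j = proj₁ (s j)
      unit : P ∣ detℤ (B · M) - detℤ (δ {n})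
      unit = detℤ-mod (λ j l → ∣-respʳ (cong (_- δ j l) (∙-comm (λ k → M k l) (B j))) (proj₂ (s j) l))
      P∣det : P ∣ detℤ M
      P∣det = P-cancel ¬vi (left-kernel-det M i v P h)
      lem₁ : detℤ B * detℤ M - (detℤ B * detℤ M - 1ℤ) ≡ 1ℤ
      lem₁ = lem (detℤ B * detℤ M)
        where
        lem : ∀ x → x - (x - 1ℤ) ≡ 1ℤ
        lem = solve-∀

    -- Independent kernel vectors and powers of p dividing the determinant.

    Independent : ∀ {k n} → Mat k n → Set
    Independent {k} V = ∀ (g : Vec k) → (∀ j → P ∣ (g ⋆ V) j) → ∀ r → P ∣ g r

    independent-nonzero : ∀ {k n} (V : Mat (suc k) n) → Independent V → ∃ λ i → ¬ P ∣ V zero i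
    independent-nonzero V ind with all-or-not (V zero)
    ... | inj₂ r = r
    ... | inj₁ h = ⊥-elim (P∤1 (ind (δ zero) (λ j → ∣-respʳ (sym (δ-∙ (λ r → V r j) zero)) (h j)) zero))

    cleared : ∀ {k n} → Mat (suc k) n → Fin n → Mat k n
    cleared V i r j = V zero i * V (suc r) j + - V (suc r) i * V zero j

    cleared-kernel : ∀ {k n} (V : Mat (suc k) n) (W : Mat n n) i z → (∀ r j → P ∣ (V r ⋆ W) j) →
      ∀ r j → P ∣ (cleared V i r ⋆ (W [ i ]≔ z)) j
    cleared-kernel V W i z h r j = ∣-respʳ eq (∣-add (V zero i) ((V (suc r) ⋆ W) j) (- V (suc r) i) ((V zero ⋆ W) j) (h (suc r) j) (h zero j))
      where
      u : Vec _
      u = cleared V i r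
      uᵢ : u i ≡ 0ℤ
      uᵢ = lem (V zero i) (V (suc r) i)
        where
        lem : ∀ x y → x * y + - y * x ≡ 0ℤ
        lem = solve-∀
      same : ∀ l → u l * W l j ≡ u l * (W [ i ]≔ z) l j
      same l = []≔-elim W i z (λ l w → u l * W l j ≡ u l * w j) (trans (cong (_* W i j) uᵢ) (sym (cong (_* z j) uᵢ))) (λ _ _ → refl) l
      eq : V zero i * ((V (suc r) ⋆ W) j) + - V (suc r) i * ((V zero ⋆ W) j) ≡ (u ⋆ (W [ i ]≔ z)) j
      eq = begin
        V zero i * ((V (suc r) ⋆ W) j) + - V (suc r) i * ((V zero ⋆ W) j)
          ≡⟨ ∙-linearˡ (V zero i) (- V (suc r) i) (V (suc r)) (V zero) (λ l → W l j) ⟨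
        (u ⋆ W) j   ≡⟨ ∙-∑ u (λ l → W l j) ⟩
        ∑ (λ l → u l * W l j)   ≡⟨ ∑-cong same ⟩
        ∑ (λ l → u l * (W [ i ]≔ z) l j)   ≡⟨ ∙-∑ u (λ l → (W [ i ]≔ z) l j) ⟨
        (u ⋆ (W [ i ]≔ z)) j   ∎

    cleared-independent : ∀ {k n} (V : Mat (suc k) n) i → ¬ P ∣ V zero i → Independent V → Independent (cleared V i)
    cleared-independent {k} V i ¬vi ind g hg r = P-cancel ¬vi (ind g⁺ (λ j → ∣-respʳ (sym (eq j)) (hg j)) (suc r))
      where
      v = V zero
      g⁺ : Vec (suc k)
      g⁺ = - (g ∙ (λ r → V (suc r) i)) ∷ (λ r → v i * g r)
      lem : ∀ g x v y → - g * v + x * y ≡ x * y + - v * g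
      lem = solve-∀
      lem' : ∀ a x y → a + - x * y ≡ a + - y * x
      lem' = solve-∀
      eq : ∀ j → (g⁺ ⋆ V) j ≡ (g ⋆ cleared V i) j
      eq j = begin
        g⁺ ∙ (λ r → V r j)
          ≡⟨ ∙-∷ g⁺ (λ r → V r j) ⟩
        - (g ∙ (λ r → V (suc r) i)) * v j + (λ r → v i * g r) ∙ (λ r → V (suc r) j)
          ≡⟨ cong (λ t → - (g ∙ (λ r → V (suc r) i)) * v j + t) (∙-scaleˡ (v i) g (λ r → V (suc r) j)) ⟩
        - (g ∙ (λ r → V (suc r) i)) * v j + v i * (g ∙ (λ r → V (suc r) j))
          ≡⟨ lem (g ∙ (λ r → V (suc r) i)) (v i) (v j) (g ∙ (λ r → V (suc r) j)) ⟩
        v i * (g ∙ (λ r → V (suc r) j)) + - v j * (g ∙ (λ r → V (suc r) i))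
          ≡⟨ ∙-linearʳ (v i) (- v j) (λ r → V (suc r) j) (λ r → V (suc r) i) g ⟨
        g ∙ (λ r → v i * V (suc r) j + - v j * V (suc r) i)
          ≡⟨ ∙-cong (λ _ → refl) (λ r → lem' (v i * V (suc r) j) (v j) (V (suc r) i)) ⟩
        (g ⋆ cleared V i) j ∎

    P∣⇐P^ : ∀ a {x} → P ^ suc a ∣ x → P ∣ x
    P∣⇐P^ a = ∣-trans (∣m⇒∣m*n (P ^ a) (∣-refl {P}))

    -- Each kernel vector v allows one row of W to be replaced by v W divided by a power of p;
    -- clearing that coordinate from the other vectors keeps them in the kernel.
    kernel-power₁ : ∀ {k n} (V : Mat k n) (W : Mat n n) → Independent V → (∀ r j → P ∣ (V r ⋆ W) j) → P ^ k ∣ detℤ W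
    kernel-power₁ {zero}  V W ind h = divides (detℤ W) (sym (*-identityʳ (detℤ W)))
    kernel-power₁ {suc k} V W ind h with independent-nonzero V ind | factor (V zero ⋆ W) (h zero)
    ... | i , ¬vi | z , e = P^-cancel (suc k) ¬vi (∣-respʳ (sym (row-quotient W i (V zero) P z e))
            (*-monoʳ-∣ P (kernel-power₁ (cleared V i) (W [ i ]≔ z) (cleared-independent V i ¬vi ind) (cleared-kernel V W i z h))))

    -- The first vector may carry a higher power of p. This serves the case where 4 divides N: a
    -- single column of V then contributes two factors 2 to det W.
    kernel-power : ∀ {k n} a (V : Mat (suc k) n) (W : Mat n n) → Independent V →
      (∀ j → P ^ suc a ∣ (V zero ⋆ W) j) → (∀ r j → P ∣ (V (suc r) ⋆ W) j) → P ^ (suc a ℕ.+ k) ∣ detℤ W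
    kernel-power {k} a V W ind h₀ h with independent-nonzero V ind | factor (V zero ⋆ W) h₀
    ... | i , ¬vi | z , e = P^-cancel (suc a ℕ.+ k) ¬vi (∣-respʳ (sym (row-quotient W i (V zero) (P ^ suc a) z e))
            (subst (_∣ P ^ suc a * detℤ (W [ i ]≔ z)) (sym (^-distribˡ-+-* P (suc a) k)) (*-monoʳ-∣ (P ^ suc a)
              (kernel-power₁ (cleared V i) (W [ i ]≔ z) (cleared-independent V i ¬vi ind)
                (cleared-kernel V W i z (λ { zero j → P∣⇐P^ a (h₀ j) ; (suc r) j → h r j }))))))

    -- Two independent left kernel vectors would put p² into det W. One-dimensionality of the kernel
    -- is expressed by vanishing 2 × 2 minors.
    proportional : ∀ {n} (W : Mat n n) → ¬ P ^ 2 ∣ detℤ W → ∀ {v u i} → ¬ P ∣ v i →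
      (∀ j → P ∣ (v ⋆ W) j) → (∀ j → P ∣ (u ⋆ W) j) → ∀ j → P ∣ v i * u j - u i * v j
    proportional {n} W ¬P² {v} {u} {i} ¬vi hv hu j with P ∣? (v i * u j - u i * v j)
    ... | yes d = d
    ... | no ¬d = ⊥-elim (¬P² (kernel-power₁ V W ind (λ { zero → hv ; (suc zero) → hu })))
      where
      V : Mat 2 n
      V = v ∷ (λ _ → u)
      ind : Independent V
      ind g h = λ { zero → P-cancel ¬vi (∣-respʳ (lem₂ (g zero) (v i) (g (suc zero)) (u i)) (∣m∣n⇒∣m-n (comb i) (∣n⇒∣m*n (u i) g₁)))
                  ; (suc zero) → g₁ }
        where
        comb : ∀ l → P ∣ g zero * v l + g (suc zero) * u l
        comb l = ∣-respʳ (trans (∙-∷ g (λ r → V r l)) (cong (λ t → g zero * v l + t) (trans (∙-∷ (g ∘ suc) (λ r → V (suc r) l)) (trans (cong (λ t → g (suc zero) * u l + t) (∙-[] _ _)) (+-identityʳ _))))) (h l)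
        lem₁ : ∀ g₀ g₁ vi vj ui uj → vi * (g₀ * vj + g₁ * uj) - vj * (g₀ * vi + g₁ * ui) ≡ (vi * uj - ui * vj) * g₁
        lem₁ = solve-∀
        lem₂ : ∀ g₀ v g₁ u → g₀ * v + g₁ * u - u * g₁ ≡ v * g₀
        lem₂ = solve-∀
        g₁ : P ∣ g (suc zero)
        g₁ = P-cancel ¬d (∣-respʳ (lem₁ (g zero) (g (suc zero)) (v i) (v j) (u i) (u j))
               (∣m∣n⇒∣m-n (∣n⇒∣m*n (v i) (comb j)) (∣n⇒∣m*n (v j) (comb i))))

  -- Walk counts from characteristic polynomials

  *-≢0 : ∀ {x y} → x ≢ 0ℤ → y ≢ 0ℤ → x * y ≢ 0ℤ
  *-≢0 {x} x≢0 y≢0 e with i*j≡0⇒i≡0∨j≡0 x e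
  ... | inj₁ p = x≢0 p
  ... | inj₂ q = y≢0 q

  ^-≢0 : ∀ {x} k → x ≢ 0ℤ → x ^ k ≢ 0ℤ
  ^-≢0 zero    x≢0 ()
  ^-≢0 (suc k) x≢0 = *-≢0 x≢0 (^-≢0 k x≢0)

  cancel-* : ∀ {k x y} → k ≢ 0ℤ → k * x ≡ k * y → x ≡ y
  cancel-* {k} {x} {y} k≢0 = *-cancelˡ-≡ k x y {{ℤ.≢-nonZero k≢0}}

  cancel-*-∣ : ∀ {k x y} → k ≢ 0ℤ → k * x ∣ k * y → x ∣ y
  cancel-*-∣ {k} k≢0 = *-cancelˡ-∣ k {{ℤ.≢-nonZero k≢0}}

  cancel-+ : ∀ k {x y} → k + x ≡ k + y → x ≡ y
  cancel-+ k {x} {y} e = trans (lem k x) (trans (cong (λ t → - k + t) e) (sym (lem k y)))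
    where
    lem : ∀ k x → x ≡ - k + (k + x)
    lem = solve-∀

  𝟙 : ∀ {n} → Vec n
  𝟙 _ = 1ℤ

  pow : ∀ {n} → Mat n n → ℕ → Vec n → Vec n
  pow A zero    v = v
  pow A (suc k) v = A ▹ pow A k v

  ▹-cong : ∀ {m n} (A : Mat m n) {u v : Vec n} → (∀ i → u i ≡ v i) → ∀ i → (A ▹ u) i ≡ (A ▹ v) i
  ▹-cong A p i = ∙-cong (λ _ → refl) p

  pow-cong : ∀ {n} (A : Mat n n) k {u v : Vec n} → (∀ i → u i ≡ v i) → ∀ i → pow A k u i ≡ pow A k v i
  pow-cong A zero    p = p
  pow-cong A (suc k) p = ▹-cong A (pow-cong A k p)

  pow-▹ : ∀ {n} (A : Mat n n) k v i → pow A k (A ▹ v) i ≡ (A ▹ pow A k v) i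
  pow-▹ A zero    v i = refl
  pow-▹ A (suc k) v i = ▹-cong A (pow-▹ A k v) i

  pow-scale : ∀ {n} (A : Mat n n) k a v i → pow A k (λ j → a * v j) i ≡ a * pow A k v i
  pow-scale A zero    a v i = refl
  pow-scale A (suc k) a v i = trans (▹-cong A (pow-scale A k a v) i) (∙-scaleʳ a (pow A k v) (A i))

  walks : ∀ {n} → Mat n n → ℕ → ℤ
  walks A k = 𝟙 ∙ pow A k 𝟙

  module Bordered {n} (M : Mat n n) where

    border : Vec (suc n) → Mat (suc n) (suc n)
    border t = t ∷ (λ i → 1ℤ ∷ M i)

    det-border : Vec (suc n) → ℤ
    det-border t = detℤ (border t)

    -- This bordered determinant equals 𝟙ᵀ adj(M) 𝟙; the entries -1 compensate the sign of the
    -- bordered expansion.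
    cofactor-sum : ℤ
    cofactor-sum = det-border (0ℤ ∷ (λ _ → - 1ℤ))

    det-border-linear : ∀ a b r s → det-border (λ j → a * r j + b * s j) ≡ a * det-border r + b * det-border s
    det-border-linear a b r s = trans (detℤ-cong (eta (λ j → a * r j + b * s j)))
      (trans (detℤ-linear (border r) zero a b r s) (sym (cong₂ (λ x y → a * x + b * y) (detℤ-cong (eta r)) (detℤ-cong (eta s)))))
      where
      eta : ∀ t → border t ≐ (border r) [ zero ]≔ t
      eta t zero    j = refl
      eta t (suc i) j = refl

    det-border-corner : det-border (δ zero) ≡ detℤ M
    det-border-corner = begin
      detℤ (border (δ zero))     ≡⟨ detℤ-row (border (δ zero)) ⟩
      ∑ term   ≡⟨ ∑-single term zero (λ { zero 0≢0 → ⊥-elim (0≢0 refl) ; (suc j) _ → *-zeroʳ (sgn (suc j)) }) ⟩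
      1ℤ * (1ℤ * detℤ M)   ≡⟨ trans (*-identityˡ (1ℤ * detℤ M)) (*-identityˡ (detℤ M)) ⟩
      detℤ M   ∎
      where
      term : Vec (suc n)
      term j = sgn j * (δ zero j * detℤ (sub (border (δ zero)) zero j))

    -- Bordering M + bJ by the row (1, -b, ..., -b) over a zero column does not change its
    -- determinant. Adding that row to all others removes `b` and puts ones into the border column.
    rank-one-update : ∀ b → detℤ (λ i j → M i j + b) ≡ detℤ M + b * cofactor-sum
    rank-one-update b = begin
      detℤ (λ i j → M i j + b)
        ≡⟨ expand ⟨
      detℤ (t ∷ (λ i → 0ℤ ∷ (λ j → M i j + b)))
        ≡⟨ detℤ-cong (∷-cong (λ _ → refl) (λ { i zero → refl ; i (suc j) → lem (M i j) b })) ⟩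
      detℤ (t ∷ (λ i j → (1ℤ ∷ M i) j + - 1ℤ * t j))
        ≡⟨ absorb (λ B → detℤ (t ∷ B)) t (∷-rowForm detℤ-rowForm t) kill (λ i → 1ℤ ∷ M i) (λ _ → - 1ℤ) ⟩
      det-border t
        ≡⟨ detℤ-cong (∷-cong (λ { zero → lem₁ b ; (suc j) → lem₂ b }) (λ _ _ → refl)) ⟩
      det-border (λ j → 1ℤ * δ zero j + b * (0ℤ ∷ (λ _ → - 1ℤ)) j)
        ≡⟨ det-border-linear 1ℤ b (δ zero) (0ℤ ∷ (λ _ → - 1ℤ)) ⟩
      1ℤ * det-border (δ zero) + b * cofactor-sum
        ≡⟨ cong (_+ (b * cofactor-sum)) (trans (*-identityˡ (det-border (δ zero))) det-border-corner) ⟩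
      detℤ M + b * cofactor-sum ∎
      where
      t : Vec (suc n)
      t = 1ℤ ∷ (λ _ → - b)
      lem : ∀ m b → m + b ≡ m + - 1ℤ * - b
      lem = solve-∀
      lem₁ : ∀ b → 1ℤ ≡ 1ℤ * 1ℤ + b * 0ℤ
      lem₁ = solve-∀
      lem₂ : ∀ b → - b ≡ 1ℤ * 0ℤ + b * - 1ℤ
      lem₂ = solve-∀
      kill : ∀ (B : Mat n (suc n)) i → detℤ (t ∷ (B [ i ]≔ t)) ≡ 0ℤ
      kill B i = detℤ-equal {i = zero} {suc i} (λ ()) (t ∷ (B [ i ]≔ t)) (λ k → sym (cong (λ v → v k) ([]≔-row B i t)))
      N : Mat (suc n) (suc n)
      N = t ∷ (λ i → 0ℤ ∷ (λ j → M i j + b))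
      term : Vec (suc n)
      term i = sgn i * (N i zero * detℤ (sub N i zero))
      expand : detℤ N ≡ detℤ (λ i j → M i j + b)
      expand = trans (detℤ-column N) (trans (∑-single term zero (λ { zero 0≢0 → ⊥-elim (0≢0 refl) ; (suc i) _ → *-zeroʳ (sgn (suc i)) }))
        (trans (*-identityˡ (1ℤ * detℤ (λ i j → M i j + b))) (*-identityˡ (detℤ (λ i j → M i j + b)))))

    -- Here `y` solves y M = 𝟙ᵀ modulo `q`, so `y ∙ 𝟙` stands in for 𝟙ᵀM⁻¹𝟙 without an inverse:
    -- adding the combination `y` of the lower rows clears the top row modulo `q`, except for the
    -- corner.
    cofactor-sum-mod : ∀ q (y z : Vec n) → (∀ j → (y ⋆ M) j ≡ 1ℤ - q * z j) → q ∣ cofactor-sum - (y ∙ 𝟙) * detℤ M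
    cofactor-sum-mod q y z h = divides (det-border (0ℤ ∷ (λ j → - z j))) (begin
      cofactor-sum - (y ∙ 𝟙) * detℤ M
        ≡⟨ cong (_- ((y ∙ 𝟙) * detℤ M)) (begin
          det-border r   ≡⟨ *-identityˡ (det-border r) ⟨
          1ℤ * det-border r   ≡⟨ detℤ-replace (border r) zero (1ℤ ∷ y) ⟨
          detℤ (border r [ zero ]≔ ((1ℤ ∷ y) ⋆ border r))   ≡⟨ detℤ-cong (λ { zero j → top j ; (suc i) j → refl }) ⟩
          det-border (λ j → (y ∙ 𝟙) * δ zero j + q * (0ℤ ∷ (λ j → - z j)) j)
            ≡⟨ det-border-linear (y ∙ 𝟙) q (δ zero) (0ℤ ∷ (λ j → - z j)) ⟩
          (y ∙ 𝟙) * det-border (δ zero) + q * det-border (0ℤ ∷ (λ j → - z j))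
            ≡⟨ cong (λ t → (y ∙ 𝟙) * t + q * det-border (0ℤ ∷ (λ j → - z j))) det-border-corner ⟩
          (y ∙ 𝟙) * detℤ M + q * det-border (0ℤ ∷ (λ j → - z j)) ∎) ⟩
      (y ∙ 𝟙) * detℤ M + q * det-border (0ℤ ∷ (λ j → - z j)) - (y ∙ 𝟙) * detℤ M
        ≡⟨ lem ((y ∙ 𝟙) * detℤ M) q (det-border (0ℤ ∷ (λ j → - z j))) ⟩
      det-border (0ℤ ∷ (λ j → - z j)) * q ∎)
      where
      r : Vec (suc n)
      r = 0ℤ ∷ (λ _ → - 1ℤ)
      lem : ∀ x q e → x + q * e - x ≡ e * q
      lem = solve-∀
      lem₀ : ∀ y → 1ℤ * 0ℤ + y ≡ y * 1ℤ + 0ℤ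
      lem₀ = solve-∀
      lem₁ : ∀ y q z → 1ℤ * - 1ℤ + (1ℤ - q * z) ≡ y * 0ℤ + q * - z
      lem₁ = solve-∀
      top : ∀ j → ((1ℤ ∷ y) ⋆ border r) j ≡ (y ∙ 𝟙) * δ zero j + q * (0ℤ ∷ (λ j → - z j)) j
      top zero    = trans (∙-∷ (1ℤ ∷ y) (λ i → border r i zero)) (trans (lem₀ (y ∙ 𝟙)) (cong (λ t → (y ∙ 𝟙) * 1ℤ + t) (sym (*-zeroʳ q))))
      top (suc j) = trans (∙-∷ (1ℤ ∷ y) (λ i → border r i (suc j))) (trans (cong (λ t → 1ℤ * - 1ℤ + t) (h j)) (lem₁ (y ∙ 𝟙) q (z j)))

  module Resolvent {n} (A : Mat n n) (s : ℤ) where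

    resolvent : Mat n n
    resolvent i j = δ i j - s * A i j

    row : ℕ → Vec n
    row zero    = 𝟙
    row (suc k) = row k ⋆ A

    row-∙ : ∀ k v → row k ∙ v ≡ 𝟙 ∙ pow A k v
    row-∙ zero    v = refl
    row-∙ (suc k) v = trans (⋆-▹ (row k) A v) (trans (row-∙ k (A ▹ v)) (∙-cong (λ _ → refl) (pow-▹ A k v)))

    -- The truncated Neumann series of 𝟙ᵀ(I - sA)⁻¹; `series-sum` is the same truncation of the walk
    -- generating function at `s`.
    series : ℕ → Vec n
    series zero    j = row zero j
    series (suc k) j = 1ℤ * series k j + s ^ suc k * row (suc k) j

    series-sum : ℕ → ℤ
    series-sum zero    = walks A zero
    series-sum (suc k) = series-sum k + s ^ suc k * walks A (suc k)

    series-∙ : ∀ k → series k ∙ 𝟙 ≡ series-sum k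
    series-∙ zero    = refl
    series-∙ (suc k) = trans (∙-linearˡ 1ℤ (s ^ suc k) (series k) (row (suc k)) 𝟙)
      (cong₂ (λ x y → x + s ^ suc k * y) (trans (*-identityˡ (series k ∙ 𝟙)) (series-∙ k)) (row-∙ (suc k) 𝟙))

    ⋆-resolvent : ∀ v j → (v ⋆ resolvent) j ≡ v j - s * (v ⋆ A) j
    ⋆-resolvent v j = trans (∙-cong (λ _ → refl) (λ i → lem (δ i j) s (A i j)))
      (trans (∙-linearʳ 1ℤ (- s) (λ i → δ i j) (λ i → A i j) v) (trans (cong (λ t → 1ℤ * t + - s * (v ⋆ A) j) (·-δ (λ (_ : Fin 1) → v) zero j)) (lem' (v j) s ((v ⋆ A) j))))
      where
      lem : ∀ x s a → x - s * a ≡ 1ℤ * x + - s * a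
      lem = solve-∀
      lem' : ∀ x s a → 1ℤ * x + - s * a ≡ x - s * a
      lem' = solve-∀

    series-⋆ : ∀ k j → (series k ⋆ resolvent) j ≡ 1ℤ - s ^ suc k * row (suc k) j
    series-⋆ zero j = trans (⋆-resolvent 𝟙 j) (cong (λ t → 1ℤ - t * (𝟙 ⋆ A) j) (sym (*-identityʳ s)))
    series-⋆ (suc k) j = begin
      (series (suc k) ⋆ resolvent) j
        ≡⟨ ∙-linearˡ 1ℤ (s ^ suc k) (series k) (row (suc k)) (λ i → resolvent i j) ⟩
      1ℤ * (series k ⋆ resolvent) j + s ^ suc k * (row (suc k) ⋆ resolvent) j
        ≡⟨ cong₂ (λ x y → 1ℤ * x + s ^ suc k * y) (series-⋆ k j) (⋆-resolvent (row (suc k)) j) ⟩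
      1ℤ * (1ℤ - s ^ suc k * row (suc k) j) + s ^ suc k * (row (suc k) j - s * row (suc (suc k)) j)
        ≡⟨ lem s (s ^ suc k) (row (suc k) j) (row (suc (suc k)) j) ⟩
      1ℤ - s ^ suc (suc k) * row (suc (suc k)) j ∎
      where
      lem : ∀ s t r q → 1ℤ * (1ℤ - t * r) + t * (r - s * q) ≡ 1ℤ - s * t * q
      lem = solve-∀

    open Bordered resolvent public

    expansion : ∀ k → s ^ suc k ∣ cofactor-sum - series-sum k * detℤ resolvent
    expansion k = ∣-respʳ (cong (λ t → cofactor-sum - t * detℤ resolvent) (series-∙ k))
      (cofactor-sum-mod (s ^ suc k) (series k) (row (suc k)) (series-⋆ k))

    -- Makes the determinant a unit modulo `s`, hence cancellable when two expansions are compared.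
    det-resolvent-mod : s ∣ detℤ resolvent - 1ℤ
    det-resolvent-mod = ∣-respʳ (cong (λ t → detℤ resolvent - t) (detℤ-δ {n}))
      (detℤ-mod (λ i j → divides (- A i j) (lem (δ i j) s (A i j))))
      where
      lem : ∀ x s a → x - s * a - x ≡ - a * s
      lem = solve-∀

  small-multiple : ∀ x → + suc (abs x) ∣ x → x ≡ 0ℤ
  small-multiple x h with abs x in eq
  ... | zero  = ∣i∣≡0⇒i≡0 eq
  ... | suc k = ⊥-elim (ℕ.1+n≰n (subst (λ t → suc (suc k) ℕ.≤ t) eq (ℕ.∣⇒≤ {{subst ℕ.NonZero (sym eq) _}} (∣⇒∣ᵤ h))))

  module EqualWalks {n} (A A' : Mat n n) (b : ℤ) (b≢0 : b ≢ 0ℤ)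
    (det≡  : ∀ s → s ≢ 0ℤ → detℤ (Resolvent.resolvent A s) ≡ detℤ (Resolvent.resolvent A' s))
    (det⁺≡ : ∀ s → s ≢ 0ℤ → detℤ (λ i j → Resolvent.resolvent A s i j + s * b) ≡ detℤ (λ i j → Resolvent.resolvent A' s i j + s * b))
    where

    private
      module R = Resolvent A
      module R' = Resolvent A'

    cofactor-sum≡ : ∀ s → s ≢ 0ℤ → R.cofactor-sum s ≡ R'.cofactor-sum s
    cofactor-sum≡ s s≢0 = cancel-* (*-≢0 s≢0 b≢0) (cancel-+ (detℤ (R.resolvent s)) (begin
      detℤ (R.resolvent s) + s * b * R.cofactor-sum s      ≡⟨ R.rank-one-update s (s * b) ⟨
      detℤ (λ i j → R.resolvent s i j + s * b)   ≡⟨ det⁺≡ s s≢0 ⟩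
      detℤ (λ i j → R'.resolvent s i j + s * b)   ≡⟨ R'.rank-one-update s (s * b) ⟩
      detℤ (R'.resolvent s) + s * b * R'.cofactor-sum s    ≡⟨ cong (_+ (s * b * R'.cofactor-sum s)) (det≡ s s≢0) ⟨
      detℤ (R.resolvent s) + s * b * R'.cofactor-sum s     ∎))

    series-sum≡ : ∀ s k → (∀ {l} → l ℕ.< suc k → walks A l ≡ walks A' l) → R.series-sum s k ≡ R'.series-sum s k
    series-sum≡ s zero    h = h ℕ.≤-refl
    series-sum≡ s (suc k) h = cong₂ (λ x y → x + s ^ suc k * y) (series-sum≡ s k (λ l<k → h (ℕ.m≤n⇒m≤1+n l<k))) (h ℕ.≤-refl)

    leading : ∀ s k → (∀ {l} → l ℕ.< k → walks A l ≡ walks A' l) →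
      R.series-sum s k - R'.series-sum s k ≡ s ^ k * (walks A k - walks A' k)
    leading s zero    h = sym (*-identityˡ _)
    leading s (suc k) h = trans (cong (λ t → R.series-sum s (suc k) - (t + s ^ suc k * walks A' (suc k))) (sym (series-sum≡ s k h)))
      (lem (R.series-sum s k) (s ^ suc k) (walks A (suc k)) (walks A' (suc k)))
      where
      lem : ∀ x t a b → x + t * a - (x + t * b) ≡ t * (a - b)
      lem = solve-∀

    -- If all shorter walk counts agree, the truncations at k differ by s^k x, with x the difference
    -- of the counts at k. Cofactor sum and determinant are common to both expansions, so s divides
    -- x times the determinant, hence x.
    walks≡ : ∀ k → walks A k ≡ walks A' k
    walks≡ = <-rec _ step
      where
      step : ∀ k → (∀ {l} → l ℕ.< k → walks A l ≡ walks A' l) → walks A k ≡ walks A' k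
      step k IH = i-j≡0⇒i≡j (walks A k) (walks A' k) (small-multiple x s∣x)
        where
        x s D : ℤ
        x = walks A k - walks A' k
        -- Larger than |x|, so that divisibility by `s` forces x = 0: one integer point replaces the
        -- comparison of coefficients.
        s = + suc (abs x)
        D = detℤ (R.resolvent s)
        lem₁ : ∀ f S S' D → f - S' * D - (f - S * D) ≡ (S - S') * D
        lem₁ = solve-∀
        s∣Dx : s ∣ x * D
        s∣Dx = cancel-*-∣ (^-≢0 k (λ ())) (subst₂ _∣_ (*-comm s (s ^ k)) (trans (cong (_* D) (leading s k IH)) (*-assoc (s ^ k) x D))
          (∣-respʳ (lem₁ (R.cofactor-sum s) (R.series-sum s k) (R'.series-sum s k) D) (∣m∣n⇒∣m-n
            (∣-respʳ (cong₂ (λ f d → f - R'.series-sum s k * d) (sym (cofactor-sum≡ s (λ ()))) (sym (det≡ s (λ ())))) (R'.expansion s k)) (R.expansion s k))))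
        lem₂ : ∀ x D → x * D - x * (D - 1ℤ) ≡ x
        lem₂ = solve-∀
        s∣x : s ∣ x
        s∣x = ∣-respʳ (lem₂ x D) (∣m∣n⇒∣m-n s∣Dx (∣n⇒∣m*n x (R.det-resolvent-mod s)))

  -- The matrix V

  ≐-sym : ∀ {m n} {A B : Mat m n} → A ≐ B → B ≐ A
  ≐-sym p i j = sym (p i j)

  infixr 2 _⟫_
  _⟫_ : ∀ {m n} {A B C : Mat m n} → A ≐ B → B ≐ C → A ≐ C
  (p ⟫ q) i j = trans (p i j) (q i j)

  ≐-refl : ∀ {m n} {A : Mat m n} → A ≐ A
  ≐-refl i j = refl

  infixl 7 _•_
  _•_ : ∀ {m n} → ℤ → Mat m n → Mat m n
  (a • A) i j = a * A i j

  •-·ˡ : ∀ {l m n} a (A : Mat l m) (B : Mat m n) → (a • A) · B ≐ a • (A · B)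
  •-·ˡ a A B i j = ∙-scaleˡ a (A i) (λ k → B k j)

  •-·ʳ : ∀ {l m n} a (A : Mat l m) (B : Mat m n) → A · (a • B) ≐ a • (A · B)
  •-·ʳ a A B i j = ∙-scaleʳ a (λ k → B k j) (A i)

  •-cong : ∀ {m n} a {A B : Mat m n} → A ≐ B → a • A ≐ a • B
  •-cong a p i j = cong (a *_) (p i j)

  •-cancel : ∀ {m n a} {A B : Mat m n} → a ≢ 0ℤ → a • A ≐ a • B → A ≐ B
  •-cancel a≢0 p i j = cancel-* a≢0 (p i j)

  •-• : ∀ {m n} a b (A : Mat m n) → a • (b • A) ≐ (a * b) • A
  •-• a b A i j = sym (*-assoc a b (A i j))

  detℤ-•δ : ∀ n a → detℤ (a • δ {n}) ≡ a ^ n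
  detℤ-•δ zero    a = detℤ-[] (a • δ)
  detℤ-•δ (suc n) a = begin
    detℤ (a • δ)   ≡⟨ detℤ-row (a • δ) ⟩
    ∑ term   ≡⟨ ∑-single term zero off ⟩
    1ℤ * (a * 1ℤ * detℤ (a • δ {n}))    ≡⟨ cong (λ t → 1ℤ * (a * 1ℤ * t)) (detℤ-•δ n a) ⟩
    1ℤ * (a * 1ℤ * a ^ n)   ≡⟨ lem a (a ^ n) ⟩
    a * a ^ n   ∎
    where
    term : Vec (suc n)
    term j = sgn j * ((a • δ) zero j * detℤ (sub (a • δ) zero j))
    off : ∀ j → j ≢ zero → term j ≡ 0ℤ
    off zero    j≢0 = ⊥-elim (j≢0 refl)
    off (suc j) j≢0 = trans (cong (λ t → sgn (suc j) * (t * detℤ (sub (a • δ) zero (suc j)))) (*-zeroʳ a)) (*-zeroʳ (sgn (suc j)))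
    lem : ∀ a x → 1ℤ * (a * 1ℤ * x) ≡ a * x
    lem = solve-∀

  -- The determinant `e` of `A` is nonzero, since times that of `B` it is a power of `a`. The left
  -- adjugate `C` gives `e • B ≐ a • C`; multiply by `A` on the right and cancel `e`.
  scalar-inverse-comm : ∀ {n a} (A B : Mat n n) → a ≢ 0ℤ → A · B ≐ a • δ → B · A ≐ a • δ
  scalar-inverse-comm {n} {a} A B a≢0 AB = •-cancel e≢0
    (  ≐-sym (•-·ˡ e B A)
    ⟫ ·-cong eB≐aC ≐-refl
    ⟫ •-·ˡ a C A
    ⟫ •-cong a (adjugateˡ-· A)
    ⟫ (λ i j → lem a e (δ i j)))
    where
    e : ℤ
    e = detℤ A
    C : Mat n n
    C = adjugateˡ A
    e≢0 : e ≢ 0ℤ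
    e≢0 e≡0 = ^-≢0 n a≢0 (trans (sym (detℤ-•δ n a)) (trans (sym (detℤ-cong AB)) (trans (detℤ-· A B) (cong (_* detℤ B) e≡0))))
    eB≐aC : e • B ≐ a • C
    eB≐aC = •-cong e (≐-sym (δ-· B)) ⟫ ≐-sym (•-·ˡ e δ B) ⟫ ·-cong (≐-sym (adjugateˡ-· A)) ≐-refl ⟫ ·-assoc C A B ⟫ ·-cong (≐-refl {A = C}) AB
      ⟫ •-·ʳ a C δ ⟫ •-cong a (·-δ C)
    lem : ∀ a e x → a * (e * x) ≡ e * (a * x)
    lem = solve-∀

  -- Symmetric matrices, walk matrices and rational similarity.

  Symmetric : ∀ {n} → Mat n n → Set
  Symmetric A = ∀ i j → A i j ≡ A j i

  ⋆-symmetric : ∀ {n} {A : Mat n n} → Symmetric A → ∀ u j → (u ⋆ A) j ≡ (A ▹ u) j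
  ⋆-symmetric {A = A} A-sym u j = trans (∙-comm u (λ i → A i j)) (∙-cong (λ i → A-sym i j) (λ _ → refl))

  self-adjoint : ∀ {n} {A : Mat n n} → Symmetric A → ∀ u v → u ∙ (A ▹ v) ≡ (A ▹ u) ∙ v
  self-adjoint {A = A} A-sym u v = trans (sym (⋆-▹ u A v)) (∙-cong (⋆-symmetric A-sym u) (λ _ → refl))

  pow-adjoint : ∀ {n} {A : Mat n n} → Symmetric A → ∀ k u v → u ∙ pow A k v ≡ pow A k u ∙ v
  pow-adjoint {A = A} A-sym zero    u v = refl
  pow-adjoint {A = A} A-sym (suc k) u v = trans (self-adjoint A-sym u (pow A k v))
    (trans (pow-adjoint A-sym k (A ▹ u) v) (∙-cong (pow-▹ A k u) (λ _ → refl)))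

  pow-+ : ∀ {n} (A : Mat n n) k l v i → pow A k (pow A l v) i ≡ pow A (k ℕ.+ l) v i
  pow-+ A zero    l v i = refl
  pow-+ A (suc k) l v i = ▹-cong A (pow-+ A k l v) i

  pow-∙-pow : ∀ {n} {A : Mat n n} → Symmetric A → ∀ k l u v → pow A k u ∙ pow A l v ≡ u ∙ pow A (k ℕ.+ l) v
  pow-∙-pow {A = A} A-sym k l u v = trans (sym (pow-adjoint A-sym k u (pow A l v))) (∙-cong (λ _ → refl) (pow-+ A k l v))

  -- What is retained of the matrix `Ac`: symmetric, integral, with row sums `c * d`. Continuing the
  -- sequence `w` with `d` performs the division by `c` in advance; `ε` and `γ` record that a factor
  -- `c` is lost only between `w 0` and `w 1`.
  record Degreed (n : ℕ) (c : ℤ) : Set where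
    field
      A     : Mat n n
      d     : Vec n
      A-sym : Symmetric A
      A-𝟙   : ∀ i → (A ▹ 𝟙) i ≡ c * d i

    w : ℕ → Vec n
    w zero    = 𝟙
    w (suc k) = pow A k d

    W : Mat n n
    W i k = w (toℕ k) i

    ε : ℕ → ℤ
    ε zero    = 1ℤ
    ε (suc k) = c

    γ : ℕ → ℤ
    γ zero    = c
    γ (suc k) = 1ℤ

    pow-𝟙 : ∀ k i → pow A k 𝟙 i ≡ ε k * w k i
    pow-𝟙 zero    i = refl
    pow-𝟙 (suc k) i = trans (sym (pow-▹ A k 𝟙 i)) (trans (pow-cong A k A-𝟙 i) (pow-scale A k c d i))

    A-w : ∀ k i → (A ▹ w k) i ≡ γ k * w (suc k) i
    A-w zero    i = A-𝟙 i
    A-w (suc k) i = sym (*-identityˡ ((A ▹ w (suc k)) i))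

    -- For nonzero `c` the factors `ε` can be cancelled, so walk counts determine the Gram entries
    -- of the divided columns too.
    gram-walks : ∀ l i j → ε i * ε j * (w i ∙ pow A l (w j)) ≡ walks A (i ℕ.+ (l ℕ.+ j))
    gram-walks l i j = begin
      ε i * ε j * (w i ∙ pow A l (w j))   ≡⟨ *-assoc (ε i) (ε j) (w i ∙ pow A l (w j)) ⟩
      ε i * (ε j * (w i ∙ pow A l (w j)))   ≡⟨ cong (ε i *_) (∙-scaleʳ (ε j) (pow A l (w j)) (w i)) ⟨
      ε i * (w i ∙ (λ m → ε j * pow A l (w j) m))   ≡⟨ ∙-scaleˡ (ε i) (w i) (λ m → ε j * pow A l (w j) m) ⟨
      (λ m → ε i * w i m) ∙ (λ m → ε j * pow A l (w j) m)   ≡⟨ ∙-cong (pow-𝟙 i) (λ m → trans (pow-cong A l (pow-𝟙 j) m) (pow-scale A l (ε j) (w j) m)) ⟨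
      pow A i 𝟙 ∙ pow A l (pow A j 𝟙)   ≡⟨ ∙-cong (λ _ → refl) (pow-+ A l j 𝟙) ⟩
      pow A i 𝟙 ∙ pow A (l ℕ.+ j) 𝟙   ≡⟨ pow-∙-pow A-sym i (l ℕ.+ j) 𝟙 𝟙 ⟩
      walks A (i ℕ.+ (l ℕ.+ j))   ∎

  open Degreed public

  -- For nonzero `N`, Q = V / N is a rational orthogonal matrix with QᵀA(G)Q = A(H) and 𝟙ᵀQ = 𝟙ᵀ.
  -- Numerator and denominator are kept apart and need not be in lowest terms.
  record Similar {n c} (G H : Degreed n c) (N : ℤ) (V : Mat n n) : Set where
    field
      orth : V ᵀ · V ≐ (N * N) • δ
      comm : A G · V ≐ V · A H
      ones : ∀ j → (𝟙 ⋆ V) j ≡ N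

  module Similarity {n c} {G H : Degreed n c} (c≢0 : c ≢ 0ℤ) where

    ε-≢0 : ∀ k → ε G k ≢ 0ℤ
    ε-≢0 zero    ()
    ε-≢0 (suc k) = c≢0

    ε-same : ∀ k → ε G k ≡ ε H k
    ε-same zero    = refl
    ε-same (suc k) = refl

    module Construct (walks≡ : ∀ k → walks (A G) k ≡ walks (A H) k) (W≢0 : detℤ (W G) ≢ 0ℤ) where

      gram : ∀ l i j → w G i ∙ pow (A G) l (w G j) ≡ w H i ∙ pow (A H) l (w H j)
      gram l i j = cancel-* (*-≢0 (ε-≢0 i) (ε-≢0 j)) (trans (gram-walks G l i j) (trans (walks≡ (i ℕ.+ (l ℕ.+ j)))
        (trans (sym (gram-walks H l i j)) (cong (_* (w H i ∙ pow (A H) l (w H j))) (sym (cong₂ _*_ (ε-same i) (ε-same j)))))))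

      D : ℤ
      D = detℤ (W G)

      -- Over ℚ, Y / D is W(H) W(G)⁻¹. By the equality of the Gram matrices it is orthogonal, and
      -- its transpose is the matrix that intertwines `A G` with `A H`.
      X Y V : Mat n n
      X = adjugate (W G)
      Y = W H · X
      V = Y ᵀ

      WX : W G · X ≐ D • δ
      WX = ·-adjugate (W G)

      XW : X · W G ≐ D • δ
      XW = scalar-inverse-comm (W G) X W≢0 WX

      D² : D * D ≢ 0ℤ
      D² = *-≢0 W≢0 W≢0

      ᵀ-cong : ∀ {l m} {A B : Mat l m} → A ≐ B → A ᵀ ≐ B ᵀ
      ᵀ-cong p i j = p j i

      -- Equality of Gram matrices passes from W to `Y`, because `W G · X` is scalar. It is applied
      -- to the pair of identity matrices and to the pair `A G`, `A H`.
      sandwich : ∀ {M M' : Mat n n} → W H ᵀ · (M' · W H) ≐ W G ᵀ · (M · W G) → Y ᵀ · (M' · Y) ≐ (D * D) • M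
      sandwich {M} {M'} e =
           ·-cong (·-ᵀ (W H) X) (≐-sym (·-assoc M' (W H) X))
        ⟫ ·-assoc (X ᵀ) (W H ᵀ) ((M' · W H) · X)
        ⟫ ·-cong (≐-refl {A = X ᵀ}) (≐-sym (·-assoc (W H ᵀ) (M' · W H) X) ⟫ ·-cong e ≐-refl ⟫ ·-assoc (W G ᵀ) (M · W G) X
              ⟫ ·-cong (≐-refl {A = W G ᵀ}) (·-assoc M (W G) X ⟫ ·-cong (≐-refl {A = M}) WX ⟫ •-·ʳ D M δ ⟫ •-cong D (·-δ M)))
        ⟫ ≐-sym (·-assoc (X ᵀ) (W G ᵀ) (D • M))
        ⟫ ·-cong (≐-sym (·-ᵀ (W G) X) ⟫ ᵀ-cong WX ⟫ λ i j → cong (D *_) (δ-sym j i)) ≐-refl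
        ⟫ •-·ˡ D δ (D • M)
        ⟫ •-cong D (δ-· (D • M))
        ⟫ •-• D D M

      YᵀY : Y ᵀ · Y ≐ (D * D) • δ
      YᵀY = ·-cong (≐-refl {A = Y ᵀ}) (≐-sym (δ-· Y)) ⟫ sandwich {δ} {δ}
        (·-cong (≐-refl {A = W H ᵀ}) (δ-· (W H)) ⟫ (λ i j → sym (gram 0 (toℕ i) (toℕ j))) ⟫ ·-cong (≐-refl {A = W G ᵀ}) (≐-sym (δ-· (W G))))

      YᵀAY : Y ᵀ · (A H · Y) ≐ (D * D) • A G
      YᵀAY = sandwich {A G} {A H} (λ i j → sym (gram 1 (toℕ i) (toℕ j)))

      YYᵀ : Y · Y ᵀ ≐ (D * D) • δ
      YYᵀ = scalar-inverse-comm (Y ᵀ) Y D² YᵀY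

      comm′ : A G · V ≐ V · A H
      comm′ = •-cancel D² (≐-sym (•-·ˡ (D * D) (A G) V) ⟫ ·-cong (≐-sym YᵀAY) ≐-refl ⟫ ·-assoc (Y ᵀ) (A H · Y) V
        ⟫ ·-cong (≐-refl {A = Y ᵀ}) (·-assoc (A H) Y V ⟫ ·-cong (≐-refl {A = A H}) YYᵀ ⟫ •-·ʳ (D * D) (A H) δ ⟫ •-cong (D * D) (·-δ (A H)))
        ⟫ •-·ʳ (D * D) (Y ᵀ) (A H))

      YW : Y · W G ≐ D • W H
      YW = ·-assoc (W H) X (W G) ⟫ ·-cong (≐-refl {A = W H}) XW ⟫ •-·ʳ D (W H) δ ⟫ •-cong D (·-δ (W H))

    ones′ : ∀ {D} {Y : Mat n n} → (Y · W G ≐ D • W H) → ∀ j → (𝟙 ⋆ Y ᵀ) j ≡ D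
    ones′ {D} {Y} YW j = trans (∙-comm 𝟙 (Y j)) (trans (first-column YW) (*-identityʳ D))
      where
      first-column : (Y · W G ≐ D • W H) → Y j ∙ 𝟙 ≡ D * 1ℤ
      first-column = go j
        where
        go : ∀ {n} {Y : Mat n n} {G H : Degreed n c} (j : Fin n) → (Y · W G ≐ D • W H) → Y j ∙ 𝟙 ≡ D * 1ℤ
        go {suc n} j YW = YW j zero

    construct : (∀ k → walks (A G) k ≡ walks (A H) k) → detℤ (W G) ≢ 0ℤ → ∃ λ V → Similar G H (detℤ (W G)) V
    construct walks≡ W≢0 = V , record { orth = YYᵀ ; comm = comm′ ; ones = ones′ YW }
      where open Construct walks≡ W≢0

    module Consequences {N V} (S : Similar G H N V) where
      open Similar S

      ⋆-comm : ∀ u j → ((A G ▹ u) ⋆ V) j ≡ (A H ▹ (u ⋆ V)) j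
      ⋆-comm u j = begin
        ((A G ▹ u) ⋆ V) j   ≡⟨ ∙-cong (λ i → sym (⋆-symmetric (A-sym G) u i)) (λ _ → refl) ⟩
        ((u ⋆ A G) ⋆ V) j   ≡⟨ ⋆-▹ u (A G) (λ i → V i j) ⟩
        u ∙ (λ i → (A G · V) i j) ≡⟨ ∙-cong (λ _ → refl) (λ i → comm i j) ⟩
        u ∙ (λ i → (V · A H) i j) ≡⟨ ⋆-▹ u V (λ i → A H i j) ⟨
        ((u ⋆ V) ⋆ A H) j   ≡⟨ ⋆-symmetric (A-sym H) (u ⋆ V) j ⟩
        (A H ▹ (u ⋆ V)) j   ∎

      -- Only the passage from 𝟙 to `d` meets a factor `c`, which is cancelled. As a consequence the
      -- columns of `V` are left kernel vectors of `W G` modulo every divisor of `N`.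
      w-⋆ : ∀ k j → (w G k ⋆ V) j ≡ N * w H k j
      w-⋆ zero j = trans (ones j) (sym (*-identityʳ N))
      w-⋆ (suc zero) j = cancel-* c≢0 (begin
        c * (d G ⋆ V) j   ≡⟨ ∙-scaleˡ c (d G) (λ i → V i j) ⟨
        ((λ i → c * d G i) ⋆ V) j   ≡⟨ ∙-cong (λ i → sym (A-𝟙 G i)) (λ _ → refl) ⟩
        ((A G ▹ 𝟙) ⋆ V) j   ≡⟨ ⋆-comm 𝟙 j ⟩
        (A H ▹ (𝟙 ⋆ V)) j   ≡⟨ ▹-cong (A H) (λ i → trans (ones i) (sym (*-identityʳ N))) j ⟩
        (A H ▹ (λ i → N * 𝟙 {n} i)) j      ≡⟨ ∙-scaleʳ N 𝟙 (A H j) ⟩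
        N * (A H ▹ 𝟙) j   ≡⟨ cong (N *_) (A-𝟙 H j) ⟩
        N * (c * d H j)   ≡⟨ lem N c (d H j) ⟩
        c * (N * d H j)   ∎)
        where
        lem : ∀ a b x → a * (b * x) ≡ b * (a * x)
        lem = solve-∀
      w-⋆ (suc (suc k)) j = trans (⋆-comm (w G (suc k)) j) (trans (▹-cong (A H) (w-⋆ (suc k)) j) (∙-scaleʳ N (w H (suc k)) (A H j)))

      column : Fin n → Vec n
      column j i = V i j

      column-⋆-W : ∀ j k → (column j ⋆ W G) k ≡ N * w H (toℕ k) j
      column-⋆-W j k = trans (∙-comm (column j) (w G (toℕ k))) (w-⋆ (toℕ k) j)

      A-▹-V : ∀ x i → (A G ▹ (V ▹ x)) i ≡ (V ▹ (A H ▹ x)) i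
      A-▹-V x i = trans (sym (⋆-▹ (A G i) V x)) (trans (∙-cong (λ j → comm i j) (λ _ → refl)) (⋆-▹ (V i) (A H) x))

      pow-▹-V : ∀ l x i → pow (A G) l (V ▹ x) i ≡ (V ▹ pow (A H) l x) i
      pow-▹-V zero    x i = refl
      pow-▹-V (suc l) x i = trans (▹-cong (A G) (pow-▹-V l x) i) (A-▹-V (pow (A H) l x) i)

      V-▹-δ : ∀ j i → (V ▹ δ j) i ≡ column j i
      V-▹-δ j i = ∙-δ (V i) j

      column-∙ : ∀ j x → column j ∙ (V ▹ x) ≡ N * N * x j
      column-∙ j x = begin
        column j ∙ (V ▹ x)   ≡⟨ ⋆-▹ (column j) V x ⟨
        (V ᵀ · V) j ∙ x   ≡⟨ ∙-cong (orth j) (λ _ → refl) ⟩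
        (λ i → N * N * δ j i) ∙ x    ≡⟨ ∙-scaleˡ (N * N) (δ j) x ⟩
        N * N * (δ j ∙ x)   ≡⟨ cong (N * N *_) (δ-∙ x j) ⟩
        N * N * x j   ∎

      -- The diagonal of VᵀA(G)ˡV = N²A(H)ˡ. Divisibility by N² is one order more than the kernel
      -- condition provides, and the arguments for odd primes and for 2 both depend on it.
      column-form : ∀ l j → column j ∙ pow (A G) l (column j) ≡ N * N * pow (A H) l (δ j) j
      column-form l j = trans (∙-cong (λ _ → refl) (λ i → trans (pow-cong (A G) l (λ i → sym (V-▹-δ j i)) i) (pow-▹-V l (δ j) i)))
        (column-∙ j (pow (A H) l (δ j)))

  -- Odd primes

  -- The coefficients of (x - μ) q(x) + a, except that the k-th shift is weighted by γ k.
  shifted : ∀ {m} → (ℕ → ℤ) → ℤ → ℤ → Vec m → Vec (suc m)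
  shifted {zero}  γ μ a q zero    = a
  shifted {suc m} γ μ a q zero    = a - μ * q zero
  shifted {suc m} γ μ a q (suc k) = shifted (γ ∘ suc) μ (γ 0 * q zero) (q ∘ suc) k

  shifted-∙ : ∀ {m} γ μ a (q : Vec m) (f : ℕ → ℤ) →
    shifted γ μ a q ∙ (f ∘ toℕ) ≡ a * f 0 + q ∙ (λ k → γ (toℕ k) * f (suc (toℕ k)) - μ * f (toℕ k))
  shifted-∙ {zero} γ μ a q f = trans (∙-∷ (shifted γ μ a q) (f ∘ toℕ)) (cong (λ t → a * f 0 + t) (trans (∙-[] _ _) (sym (∙-[] q _))))
  shifted-∙ {suc m} γ μ a q f = begin
    shifted γ μ a q ∙ (f ∘ toℕ)
      ≡⟨ ∙-∷ (shifted γ μ a q) (f ∘ toℕ) ⟩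
    (a - μ * q zero) * f 0 + shifted (γ ∘ suc) μ (γ 0 * q zero) (q ∘ suc) ∙ (f ∘ suc ∘ toℕ)
      ≡⟨ cong (λ t → (a - μ * q zero) * f 0 + t) (shifted-∙ (γ ∘ suc) μ (γ 0 * q zero) (q ∘ suc) (f ∘ suc)) ⟩
    (a - μ * q zero) * f 0 + (γ 0 * q zero * f 1 + rest)
      ≡⟨ lem a μ (q zero) (f 0) (γ 0) (f 1) rest ⟩
    a * f 0 + (q zero * (γ 0 * f 1 - μ * f 0) + rest)
      ≡⟨ cong (λ t → a * f 0 + t) (∙-∷ q (λ k → γ (toℕ k) * f (suc (toℕ k)) - μ * f (toℕ k))) ⟨
    a * f 0 + q ∙ (λ k → γ (toℕ k) * f (suc (toℕ k)) - μ * f (toℕ k)) ∎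
    where
    rest : ℤ
    rest = (q ∘ suc) ∙ (λ k → γ (suc (toℕ k)) * f (suc (suc (toℕ k))) - μ * f (suc (toℕ k)))
    lem : ∀ a μ q f₀ γ f₁ r → (a - μ * q) * f₀ + (γ * q * f₁ + r) ≡ a * f₀ + (q * (γ * f₁ - μ * f₀) + r)
    lem = solve-∀

  module OddStep {m} {c : ℤ} {G H : Degreed (suc m) c} (c≢0 : c ≢ 0ℤ) {N V} (S : Similar G H N V)
    (p : ℕ) (pp : Prime p) where

    open ModPrime p pp
    open Similarity {G = G} {H} c≢0
    open Consequences S

    private
      n : ℕ
      n = suc m
      B : Mat n n
      B = A G

    -- The tail comes before the head: it yields P ∣ γ 0 q₀, hence P ∣ q₀ as γ 0 is a unit, and then
    -- the head gives `a`. In the application γ 0 is `c`.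
    shifted-injective : ∀ {m} γ μ a (q : Vec m) → (∀ k → ¬ P ∣ γ k) → (∀ k → P ∣ shifted γ μ a q k) → P ∣ a × (∀ k → P ∣ q k)
    shifted-injective {zero}  γ μ a q ¬γ h = h zero , λ ()
    shifted-injective {suc m} γ μ a q ¬γ h with shifted-injective (γ ∘ suc) μ (γ 0 * q zero) (q ∘ suc) (¬γ ∘ suc) (h ∘ suc)
    ... | hγq , hq = ∣-respʳ (lem a μ (q zero)) (∣m∣n⇒∣m+n (h zero) (∣n⇒∣m*n μ q₀)) , λ { zero → q₀ ; (suc k) → hq k }
      where
      q₀ : P ∣ q zero
      q₀ = P-cancel (¬γ 0) hγq
      lem : ∀ a μ q → a - μ * q + μ * q ≡ a
      lem = solve-∀

    module _ (¬P∣c : ¬ P ∣ c) (P∣N : P ∣ N) (¬P² : ¬ P ^ 2 ∣ detℤ (W G)) (j₀ : Fin n) (i₀ : Fin n) (¬vi : ¬ P ∣ V i₀ j₀) where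

      private
        v : Vec n
        v = column j₀

      ¬γ : ∀ k → ¬ P ∣ γ G k
      ¬γ zero    = ¬P∣c
      ¬γ (suc k) = P∤1

      v-w : ∀ k → P ∣ v ∙ w G k
      v-w k = ∣-respʳ (trans (sym (w-⋆ k j₀)) (∙-comm (w G k) v)) (∣m⇒∣m*n (w H k j₀) P∣N)

      P²∣N² : P * P ∣ N * N
      P²∣N² = ∣-*-pres P∣N P∣N

      Bv-w : ∀ k → P ∣ (B ▹ v) ∙ w G k
      Bv-w k = ∣-respʳ (trans (trans (sym (∙-scaleʳ (γ G k) (w G (suc k)) v)) (∙-cong (λ _ → refl) (λ i → sym (A-w G k i)))) (self-adjoint (A-sym G) v (w G k)))
        (∣n⇒∣m*n (γ G k) (v-w (suc k)))

      opaque
        inverse : ∃ λ t → P ∣ t * v i₀ - 1ℤ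
        inverse = P-inverse ¬vi

      t μ : ℤ
      t = proj₁ inverse
      μ = t * (B ▹ v) i₀

      -- The vector A v again lies in the left kernel of W, so modulo P it is a multiple of `v`; the
      -- factor is read off at `i₀`, where `t` inverts `v i₀`.
      eigen : ∀ i → P ∣ (B ▹ v) i - μ * v i
      eigen i = ∣-respʳ (lem t (v i₀) ((B ▹ v) i) ((B ▹ v) i₀) (v i))
        (∣m∣n⇒∣m-n (∣n⇒∣m*n t (proportional (W G) ¬P² {v} {B ▹ v} ¬vi (v-w ∘ toℕ) (Bv-w ∘ toℕ) i)) (∣m⇒∣m*n ((B ▹ v) i) (proj₂ inverse)))
        where
        lem : ∀ t v₀ b b₀ v → t * (v₀ * b - b₀ * v) - (t * v₀ - 1ℤ) * b ≡ b - t * b₀ * v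
        lem = solve-∀

      opaque
        β : Vec n
        β = proj₁ (factor (λ i → (B ▹ v) i - μ * v i) eigen)

        Pβ : ∀ i → (B ▹ v) i - μ * v i ≡ P * β i
        Pβ = proj₂ (factor (λ i → (B ▹ v) i - μ * v i) eigen)

      minus : ∀ (x y u : Vec n) a → (λ i → x i - a * y i) ∙ u ≡ x ∙ u - a * (y ∙ u)
      minus x y u a = trans (∙-cong (λ i → lem (x i) a (y i)) (λ _ → refl)) (trans (∙-linearˡ 1ℤ (- a) x y u) (lem' (x ∙ u) a (y ∙ u)))
        where
        lem : ∀ x a y → x - a * y ≡ 1ℤ * x + - a * y
        lem = solve-∀
        lem' : ∀ x a y → 1ℤ * x + - a * y ≡ x - a * y
        lem' = solve-∀

      -- P (v ∙ β) = vᵀAv - μ vᵀv, where both forms are divisible by N² and hence by P².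
      v-β : P ∣ v ∙ β
      v-β = *-cancelˡ-∣ P (∣-respʳ (begin
        v ∙ (B ▹ v) - μ * (v ∙ v)   ≡⟨ cong (_- (μ * (v ∙ v))) (∙-comm v (B ▹ v)) ⟩
        (B ▹ v) ∙ v - μ * (v ∙ v)   ≡⟨ minus (B ▹ v) v v μ ⟨
        (λ i → (B ▹ v) i - μ * v i) ∙ v  ≡⟨ ∙-cong Pβ (λ _ → refl) ⟩
        (λ i → P * β i) ∙ v   ≡⟨ ∙-scaleˡ P β v ⟩
        P * (β ∙ v)   ≡⟨ cong (P *_) (∙-comm β v) ⟩
        P * (v ∙ β)   ∎)
        (∣m∣n⇒∣m-n (∣-respʳ (sym (column-form 1 j₀)) (∣m⇒∣m*n _ P²∣N²)) (∣n⇒∣m*n μ (∣-respʳ (sym (column-form 0 j₀)) (∣m⇒∣m*n _ P²∣N²)))))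

      M : Mat n (suc n)
      M i = 1ℤ ∷ (λ j → B i j - μ * δ i j)

      M-∙ : ∀ i s y → M i ∙ (s ∷ y) ≡ s + ((B ▹ y) i - μ * y i)
      M-∙ i s y = trans (∙-∷ (M i) (s ∷ y)) (cong₂ _+_ (*-identityˡ s) (trans (minus (B i) (δ i) y μ) (cong (λ u → (B ▹ y) i - μ * u) (δ-∙ y i))))

      -- Modulo P, an obstruction is a μ-eigenvector orthogonal to 𝟙, therefore to every `w k`, and
      -- so a multiple of `v`, which is orthogonal to `β`. The column 𝟙 of `M` is there to provide
      -- the orthogonality that starts this chain.
      unobstructed : ¬ Obstruction M β
      unobstructed (u , k , e) = P∤1 (∣-respʳ (lem (u ∙ β)) (∣m∣n⇒∣m-n uβ e))
        where
        lem : ∀ x → x - (x - 1ℤ) ≡ 1ℤ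
        lem = solve-∀
        u-eigen : ∀ j → P ∣ (B ▹ u) j - μ * u j
        u-eigen j = ∣-respʳ (begin
          u ∙ (λ i → B i j - μ * δ i j)   ≡⟨ ∙-comm u (λ i → B i j - μ * δ i j) ⟩
          (λ i → B i j - μ * δ i j) ∙ u   ≡⟨ minus (λ i → B i j) (λ i → δ i j) u μ ⟩
          (λ i → B i j) ∙ u - μ * ((λ i → δ i j) ∙ u) ≡⟨ cong₂ (λ x y → x - μ * y) (∙-cong (λ i → A-sym G i j) (λ _ → refl)) (trans (∙-cong (λ i → δ-sym i j) (λ _ → refl)) (δ-∙ u j)) ⟩
          (B ▹ u) j - μ * u j   ∎) (k (suc j))
        u-w : ∀ l → P ∣ u ∙ w G l
        u-w zero    = k zero
        u-w (suc l) = P-cancel (¬γ l) (∣-respʳ (begin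
          (B ▹ u) ∙ w G l   ≡⟨ self-adjoint (A-sym G) u (w G l) ⟨
          u ∙ (B ▹ w G l)   ≡⟨ ∙-cong (λ _ → refl) (A-w G l) ⟩
          u ∙ (λ i → γ G l * w G (suc l) i)   ≡⟨ ∙-scaleʳ (γ G l) (w G (suc l)) u ⟩
          γ G l * (u ∙ w G (suc l))   ∎)
          (∣-respʳ (lem' ((B ▹ u) ∙ w G l) (μ * (u ∙ w G l))) (∣m∣n⇒∣m+n
            (∣-respʳ (trans (∙-comm (w G l) (λ i → (B ▹ u) i - μ * u i)) (minus (B ▹ u) u (w G l) μ)) (∙-∣ (w G l) u-eigen)) (∣n⇒∣m*n μ (u-w l)))))
          where
          lem' : ∀ x y → x - y + y ≡ x
          lem' = solve-∀
        uβ : P ∣ u ∙ β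
        uβ = P-cancel ¬vi (∣-respʳ (lem' (v i₀ * (u ∙ β)) (- u i₀) (v ∙ β)) (∣m∣n⇒∣m-n
          (∣-respʳ (trans (∙-comm β (λ l → v i₀ * u l + - u i₀ * v l)) (∙-linearˡ (v i₀) (- u i₀) u v β)) (∙-∣ β (λ l → ∣-respʳ (lem″ (v i₀ * u l) (u i₀) (v l)) (proportional (W G) ¬P² {v} {u} ¬vi (v-w ∘ toℕ) (u-w ∘ toℕ) l))))
          (∣n⇒∣m*n (- u i₀) v-β)))
          where
          lem' : ∀ x y z → x + y * z - y * z ≡ x
          lem' = solve-∀
          lem″ : ∀ x y z → x - y * z ≡ x + - y * z
          lem″ = solve-∀

      opaque
        solution : Solution M β
        solution with fredholm M β
        ... | inj₁ x = x
        ... | inj₂ o = ⊥-elim (unobstructed o)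

      s : ℤ
      s = proj₁ solution zero

      y : Vec n
      y i = proj₁ solution (suc i)

      opaque
        z : Vec n
        z = proj₁ (factor (λ i → M i ∙ proj₁ solution - β i) (proj₂ solution))

        z-spec : ∀ i → s + ((B ▹ y) i - μ * y i) - β i ≡ P * z i
        z-spec i = trans (cong (_- β i) (sym (trans (∙-cong (λ _ → refl) (λ { zero → refl ; (suc j) → refl })) (M-∙ i s y))))
          (proj₂ (factor (λ i → M i ∙ proj₁ solution - β i) (proj₂ solution)) i)

      v′ : Vec n
      v′ i = 1ℤ * v i + - P * y i

      v′-eigen : ∀ i → (B ▹ v′) i - μ * v′ i ≡ P * s * 1ℤ + - (P * P) * z i
      v′-eigen i = begin
        (B ▹ v′) i - μ * v′ i
          ≡⟨ cong (_- (μ * v′ i)) (∙-linearʳ 1ℤ (- P) v y (B i)) ⟩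
        1ℤ * (B ▹ v) i + - P * (B ▹ y) i - μ * (1ℤ * v i + - P * y i)
          ≡⟨ lem₁ ((B ▹ v) i) P ((B ▹ y) i) μ (v i) (y i) ⟩
        (B ▹ v) i - μ * v i - P * ((B ▹ y) i - μ * y i)
          ≡⟨ cong (_- (P * ((B ▹ y) i - μ * y i))) (Pβ i) ⟩
        P * β i - P * ((B ▹ y) i - μ * y i)
          ≡⟨ lem₂ P (β i) ((B ▹ y) i - μ * y i) s ⟩
        P * s * 1ℤ - P * (s + ((B ▹ y) i - μ * y i) - β i)
          ≡⟨ cong (λ q → P * s * 1ℤ - P * q) (z-spec i) ⟩
        P * s * 1ℤ - P * (P * z i)
          ≡⟨ lem₃ (P * s * 1ℤ) P (z i) ⟩
        P * s * 1ℤ + - (P * P) * z i ∎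
        where
        lem₁ : ∀ bv P by μ v y → 1ℤ * bv + - P * by - μ * (1ℤ * v + - P * y) ≡ bv - μ * v - P * (by - μ * y)
        lem₁ = solve-∀
        lem₂ : ∀ P β r s → P * β - P * r ≡ P * s * 1ℤ - P * (s + r - β)
        lem₂ = solve-∀
        lem₃ : ∀ x P z → x - P * (P * z) ≡ x + - (P * P) * z
        lem₃ = solve-∀

      opaque
        v′-w : ∀ k → P ∣ v′ ∙ w G k
        v′-w k = ∣-respʳ (sym (trans (∙-linearˡ 1ℤ (- P) v y (w G k)) (lem (v ∙ w G k) P (y ∙ w G k))))
          (∣m∣n⇒∣m-n (v-w k) (∣m⇒∣m*n (y ∙ w G k) (∣-refl {P})))
          where
          lem : ∀ a P b → 1ℤ * a + - P * b ≡ a - P * b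
          lem = solve-∀

      ρ : ℕ → ℤ
      ρ k = _∣_.quotient (v′-w k)

      ρ-spec : ∀ k → v′ ∙ w G k ≡ P * ρ k
      ρ-spec k = trans (_∣_.equality (v′-w k)) (*-comm (ρ k) P)

      -- The equation for `v′` paired with `w k` and divided by P: modulo P the quotient row obeys a
      -- first-order recurrence with inhomogeneous term s (𝟙 ∙ w k).
      ρ-step : ∀ k → γ G k * ρ (suc k) - μ * ρ k ≡ s * (𝟙 ∙ w G k) - P * (z ∙ w G k)
      ρ-step k = *-cancelˡ-≡ P _ _ (begin
        P * (γ G k * ρ (suc k) - μ * ρ k)
          ≡⟨ lem₁ P (γ G k) (ρ (suc k)) μ (ρ k) ⟩
        γ G k * (P * ρ (suc k)) - μ * (P * ρ k)
          ≡⟨ cong₂ (λ a b → γ G k * a - μ * b) (ρ-spec (suc k)) (ρ-spec k) ⟨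
        γ G k * (v′ ∙ w G (suc k)) - μ * (v′ ∙ w G k)
          ≡⟨ cong (_- (μ * (v′ ∙ w G k))) (trans (sym (∙-scaleʳ (γ G k) (w G (suc k)) v′)) (trans (∙-cong (λ _ → refl) (λ i → sym (A-w G k i))) (self-adjoint (A-sym G) v′ (w G k)))) ⟩
        (B ▹ v′) ∙ w G k - μ * (v′ ∙ w G k)
          ≡⟨ minus (B ▹ v′) v′ (w G k) μ ⟨
        (λ i → (B ▹ v′) i - μ * v′ i) ∙ w G k
          ≡⟨ ∙-cong v′-eigen (λ _ → refl) ⟩
        (λ i → P * s * 1ℤ + - (P * P) * z i) ∙ w G k
          ≡⟨ ∙-linearˡ (P * s) (- (P * P)) 𝟙 z (w G k) ⟩
        P * s * (𝟙 ∙ w G k) + - (P * P) * (z ∙ w G k)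
          ≡⟨ lem₂ P s (𝟙 ∙ w G k) (z ∙ w G k) ⟩
        P * (s * (𝟙 ∙ w G k) - P * (z ∙ w G k)) ∎)
        where
        lem₁ : ∀ P g r μ q → P * (g * r - μ * q) ≡ g * (P * r) - μ * (P * q)
        lem₁ = solve-∀
        lem₂ : ∀ P s a b → P * s * a + - (P * P) * b ≡ P * (s * a - P * b)
        lem₂ = solve-∀

      -- v is orthogonal to every column of this square matrix.
      K : Mat n n
      K i = v i ∷ (λ k → w G (toℕ k) i)

      opaque
        K-kernel : ∃ λ (x : Vec n) → (∀ i → P ∣ (K ▹ x) i) × ∃ λ j → ¬ P ∣ x j
        K-kernel = right-kernel K v i₀ ¬vi λ
          { zero → ∣-respʳ (sym (column-form 0 j₀)) (∣m⇒∣m*n _ (∣m⇒∣m*n N P∣N)) ; (suc k) → v-w (toℕ k) }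

      τ : ℤ
      τ = proj₁ K-kernel zero

      q : Vec m
      q k = proj₁ K-kernel (suc k)

      U : Vec n
      U i = q ∙ (λ k → w G (toℕ k) i)

      U≡ : ∀ i → P ∣ τ * v i + U i
      U≡ i = ∣-respʳ (trans (∙-∷ (K i) (proj₁ K-kernel)) (cong₂ _+_ (*-comm (v i) τ) (∙-comm (λ k → w G (toℕ k) i) q))) (proj₁ (proj₂ K-kernel) i)

      ∙-U : ∀ u → u ∙ U ≡ q ∙ (λ k → u ∙ w G (toℕ k))
      ∙-U u = ∙-∑ʳ u q (λ k → w G (toℕ k))

      -- Modulo P the vector `U` is -τ v, so it inherits the orthogonality relations of `v` although
      -- it is a combination of columns of W.
      U-zero : ∀ u → P ∣ u ∙ v → P ∣ u ∙ U
      U-zero u h = ∣-respʳ (lem (u ∙ U) (τ * (u ∙ v))) (∣m∣n⇒∣m-n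
        (∣-respʳ (trans (∙-linearʳ τ 1ℤ v U u) (cong (λ t → τ * (u ∙ v) + t) (*-identityˡ (u ∙ U)))) (∙-∣ u (λ i → ∣-respʳ (cong (λ t → τ * v i + t) (sym (*-identityˡ (U i)))) (U≡ i)))) (∣n⇒∣m*n τ h))
        where
        lem : ∀ x y → y + x - y ≡ x
        lem = solve-∀

      -- Since `U` is q(A)𝟙 up to the weights and (A - μ)U vanishes modulo P, the coefficients of (x
      -- - μ) q(x) form a right kernel vector of W. Its special shape lets `ρ-step` evaluate its
      -- product with `ρ`.
      g : Vec n
      g = shifted (γ G) μ 0ℤ q

      g-∙ : ∀ f → g ∙ (f ∘ toℕ) ≡ q ∙ (λ k → γ G (toℕ k) * f (suc (toℕ k)) - μ * f (toℕ k))
      g-∙ f = trans (shifted-∙ (γ G) μ 0ℤ q f) (+-identityˡ _)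

      opaque
        g-nonzero : ∃ λ k → ¬ P ∣ g k
        g-nonzero with all-or-not g
        ... | inj₂ r = r
        ... | inj₁ h = ⊥-elim (absurd (proj₂ (proj₂ K-kernel)))
          where
          hq : ∀ k → P ∣ q k
          hq = proj₂ (shifted-injective (γ G) μ 0ℤ q ¬γ h)
          hτ : P ∣ τ
          hτ = P-cancel ¬vi (∣-respʳ (lem τ (v i₀) (U i₀)) (∣m∣n⇒∣m-n (U≡ i₀) (∣-respʳ (∙-comm (λ k → w G (toℕ k) i₀) q) (∙-∣ (λ k → w G (toℕ k) i₀) hq))))
            where
            lem : ∀ t v u → t * v + u - u ≡ v * t
            lem = solve-∀
          absurd : (∃ λ j → ¬ P ∣ proj₁ K-kernel j) → ⊥
          absurd (zero  , ¬x) = ¬x hτ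
          absurd (suc k , ¬x) = ¬x (hq k)

      W-g : ∀ i → P ∣ W G i ∙ g
      W-g i = ∣-respʳ (begin
        u ∙ U
          ≡⟨ ∙-U u ⟩
        q ∙ (λ k → u ∙ w G (toℕ k))
          ≡⟨ ∙-cong (λ _ → refl) (λ k → trans (minus (B i) (δ i) (w G (toℕ k)) μ) (cong₂ (λ a b → a - μ * b) (A-w G (toℕ k) i) (δ-∙ (w G (toℕ k)) i))) ⟩
        q ∙ (λ k → γ G (toℕ k) * w G (suc (toℕ k)) i - μ * w G (toℕ k) i)
          ≡⟨ g-∙ (λ k → w G k i) ⟨
        g ∙ W G i
          ≡⟨ ∙-comm g (W G i) ⟩
        W G i ∙ g ∎)
        (U-zero u (∣-respʳ (sym (trans (minus (B i) (δ i) v μ) (cong (λ a → (B ▹ v) i - μ * a) (δ-∙ v i)))) (eigen i)))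
        where
        u : Vec n
        u j = B i j - μ * δ i j

      -- By the recurrence the product is s (𝟙 ∙ U) modulo P, and 𝟙 is orthogonal to `v`, hence to
      -- `U`.
      ρ-g : P ∣ (ρ ∘ toℕ) ∙ g
      ρ-g = ∣-respʳ (trans (sym eq) (∙-comm g (ρ ∘ toℕ))) (∣m∣n⇒∣m-n (∣n⇒∣m*n s (U-zero 𝟙 (∣-respʳ (∙-comm v 𝟙) (v-w 0)))) (∣m⇒∣m*n (z ∙ U) (∣-refl {P})))
        where
        lem : ∀ s a P b → s * a - P * b ≡ s * a + - P * b
        lem = solve-∀
        eq : g ∙ (ρ ∘ toℕ) ≡ s * (𝟙 ∙ U) - P * (z ∙ U)
        eq = begin
          g ∙ (ρ ∘ toℕ)
            ≡⟨ g-∙ ρ ⟩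
          q ∙ (λ k → γ G (toℕ k) * ρ (suc (toℕ k)) - μ * ρ (toℕ k))
            ≡⟨ ∙-cong (λ _ → refl) (λ k → trans (ρ-step (toℕ k)) (lem s (𝟙 ∙ w G (toℕ k)) P (z ∙ w G (toℕ k)))) ⟩
          q ∙ (λ k → s * (𝟙 ∙ w G (toℕ k)) + - P * (z ∙ w G (toℕ k)))
            ≡⟨ ∙-linearʳ s (- P) (λ k → 𝟙 ∙ w G (toℕ k)) (λ k → z ∙ w G (toℕ k)) q ⟩
          s * (q ∙ (λ k → 𝟙 ∙ w G (toℕ k))) + - P * (q ∙ (λ k → z ∙ w G (toℕ k)))
            ≡⟨ cong₂ (λ a b → s * a + - P * b) (∙-U 𝟙) (∙-U z) ⟨
          s * (𝟙 ∙ U) + - P * (z ∙ U)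
            ≡⟨ lem s (𝟙 ∙ U) P (z ∙ U) ⟨
          s * (𝟙 ∙ U) - P * (z ∙ U) ∎

      column-absurd : ⊥
      column-absurd = ¬P² (P^-cancel 2 ¬v′ (∣-respʳ (sym (row-quotient (W G) i₀ v′ P (ρ ∘ toℕ) (λ k → ρ-spec (toℕ k))))
        (*-monoʳ-∣ P (subst (_∣ detℤ W₁) (sym (*-identityʳ P)) P∣W₁))))
        where
        W₁ : Mat n n
        W₁ = W G [ i₀ ]≔ (ρ ∘ toℕ)
        P∣W₁ : P ∣ detℤ W₁
        P∣W₁ = P-cancel (proj₂ g-nonzero) (right-kernel-det W₁ (proj₁ g-nonzero) g P
          ([]≔-elim (W G) i₀ (ρ ∘ toℕ) (λ _ r → P ∣ r ∙ g) ρ-g (λ i _ → W-g i)))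
        ¬v′ : ¬ P ∣ v′ i₀
        ¬v′ h = ¬vi (∣-respʳ (lem (v i₀) P (y i₀)) (∣m∣n⇒∣m+n h (∣m⇒∣m*n (y i₀) (∣-refl {P}))))
          where
          lem : ∀ v P y → 1ℤ * v + - P * y + P * y ≡ v
          lem = solve-∀

    odd-step : ¬ P ∣ c → P ∣ N → ¬ P ^ 2 ∣ detℤ (W G) → ∀ i j → P ∣ V i j
    odd-step ¬P∣c P∣N ¬P² i j with P ∣? V i j
    ... | yes h = h
    ... | no ¬h = ⊥-elim (column-absurd ¬P∣c P∣N ¬P² j i ¬h)

  -- The prime 2

  2ℤ : ℤ
  2ℤ = + 2

  total : ∀ {n} → Mat n n → ℤ
  total S = ∑ (λ i → ∑ (S i))

  -- Off-diagonal entries occur in equal pairs, which gains a factor 2 over their common divisor.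
  symmetric-total : ∀ {n} q (S : Mat n n) → Symmetric S → (∀ i j → i ≢ j → q ∣ S i j) →
    2ℤ * q ∣ total S - ∑ (λ i → S i i)
  symmetric-total {zero} q S S-sym h = ∣-respʳ (sym (cong₂ _-_ (∑-[] (λ i → ∑ (S i))) (∑-[] (λ i → S i i)))) ∣-0
  symmetric-total {suc n} q S S-sym h = ∣-respʳ (sym eq)
    (∣m∣n⇒∣m+n (symmetric-total q S′ (λ i j → S-sym (suc i) (suc j)) (λ i j i≢j → h (suc i) (suc j) (i≢j ∘ suc-injective)))
               (*-monoʳ-∣ 2ℤ (∑-∣ r (λ j → h zero (suc j) (λ ())))))
    where
    S′ : Mat n n
    S′ i j = S (suc i) (suc j)
    r : Vec n
    r j = S zero (suc j)
    lem : ∀ s r t u → s + r + (r + t) - (s + u) ≡ t - u + 2ℤ * r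
    lem = solve-∀
    eq : total S - ∑ (λ i → S i i) ≡ total S′ - ∑ (λ i → S′ i i) + 2ℤ * ∑ r
    eq = begin
      total S - ∑ (λ i → S i i)
        ≡⟨ cong₂ _-_ (trans (∑-∷ (λ i → ∑ (S i))) (cong₂ _+_ (∑-∷ (S zero)) (trans (∑-cong (λ i → trans (∑-∷ (S (suc i))) (cong (_+ ∑ (S′ i)) (S-sym (suc i) zero)))) (∑-+ r (λ i → ∑ (S′ i)))))) (∑-∷ (λ i → S i i)) ⟩
      S zero zero + ∑ r + (∑ r + total S′) - (S zero zero + ∑ (λ i → S′ i i))
        ≡⟨ lem (S zero zero) (∑ r) (total S′) (∑ (λ i → S′ i i)) ⟩
      total S′ - ∑ (λ i → S′ i i) + 2ℤ * ∑ r ∎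

  parity : ∀ x → 2ℤ ∣ x ⊎ 2ℤ ∣ x - 1ℤ
  parity x with x ℤ.% 2ℤ in e | ℤ.n%d<d x 2ℤ
  ... | 0           | _ = inj₁ (divides (x ℤ./ 2ℤ) (trans (ℤ.a≡a%n+[a/n]*n x 2ℤ) (trans (cong (λ t → + t + (x ℤ./ 2ℤ) * 2ℤ) e) (+-identityˡ ((x ℤ./ 2ℤ) * 2ℤ)))))
  ... | 1           | _ = inj₂ (divides (x ℤ./ 2ℤ) (trans (cong (_- 1ℤ) (trans (ℤ.a≡a%n+[a/n]*n x 2ℤ) (cong (λ t → + t + (x ℤ./ 2ℤ) * 2ℤ) e))) (lem ((x ℤ./ 2ℤ) * 2ℤ))))
    where
    lem : ∀ t → 1ℤ + t - 1ℤ ≡ t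
    lem = solve-∀
  ... | suc (suc r) | ℕ.s≤s (ℕ.s≤s ())

  2∣x²-x : ∀ x → 2ℤ ∣ x * x - x
  2∣x²-x x = ∣-respʳ (lem x) (product (parity x))
    where
    lem : ∀ x → x * (x - 1ℤ) ≡ x * x - x
    lem = solve-∀
    product : 2ℤ ∣ x ⊎ 2ℤ ∣ x - 1ℤ → 2ℤ ∣ x * (x - 1ℤ)
    product (inj₁ h) = ∣m⇒∣m*n (x - 1ℤ) h
    product (inj₂ h) = ∣n⇒∣m*n x h

  halve : ∀ k → ∃ λ j → k ≡ j ℕ.+ j ⊎ k ≡ suc (j ℕ.+ j)
  halve zero = 0 , inj₁ refl
  halve (suc k) with halve k
  ... | j , inj₁ e = j , inj₂ (cong suc e)
  ... | j , inj₂ e = suc j , inj₁ (cong suc (trans e (sym (ℕ.+-suc j j))))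

  𝟙∙𝟙 : ∀ n → 𝟙 {n} ∙ 𝟙 ≡ + n
  𝟙∙𝟙 zero    = ∙-[] 𝟙 𝟙
  𝟙∙𝟙 (suc n) = trans (∙-∷ {n} 𝟙 𝟙) (cong (λ t → 1ℤ + t) (𝟙∙𝟙 n))

  module EvenGram {n c} (G : Degreed n c) (a : ℤ) (A-diag : ∀ i → A G i i ≡ a * d G i) (d-even : 2ℤ ∣ 𝟙 ∙ d G) where

    square-parity : ∀ (x : Vec n) → 2ℤ ∣ x ∙ x - 𝟙 ∙ x
    square-parity x = ∣-respʳ (trans (∑-minus (λ i → x i * x i) x) (cong₂ _-_ (sym (∙-∑ x x)) (sym (trans (∙-∑ 𝟙 x) (∑-cong (λ i → *-identityˡ (x i)))))))
      (∑-∣ (λ i → x i * x i - x i) (λ i → 2∣x²-x (x i)))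

    -- Modulo 2 the off-diagonal terms cancel in pairs, the diagonal entries of `A G` are
    -- `a * d G i`, and x² ≡ x.
    form-parity : ∀ (x : Vec n) → 2ℤ ∣ x ∙ (A G ▹ x) - a * (d G ∙ x)
    form-parity x = ∣-respʳ eq (∣m∣n⇒∣m+n (symmetric-total 1ℤ S S-sym (λ i j _ → divides (S i j) (sym (*-identityʳ (S i j)))))
      (∑-∣ (λ i → a * d G i * (x i * x i - x i)) (λ i → ∣n⇒∣m*n (a * d G i) (2∣x²-x (x i)))))
      where
      S : Mat n n
      S i j = x i * (A G i j * x j)
      lem : ∀ x y b → x * (b * y) ≡ y * (b * x)
      lem = solve-∀
      S-sym : Symmetric S
      S-sym i j = trans (lem (x i) (x j) (A G i j)) (cong (λ t → x j * (t * x i)) (A-sym G i j))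
      lem₂ : ∀ a d x → a * d * (x * x - x) ≡ x * (a * d * x) - a * (d * x)
      lem₂ = solve-∀
      lem₃ : ∀ t s u → t - s + (s - u) ≡ t - u
      lem₃ = solve-∀
      eq : total S - ∑ (λ i → S i i) + ∑ (λ i → a * d G i * (x i * x i - x i)) ≡ x ∙ (A G ▹ x) - a * (d G ∙ x)
      eq = begin
        total S - ∑ (λ i → S i i) + ∑ (λ i → a * d G i * (x i * x i - x i))
          ≡⟨ cong (λ t → total S - ∑ (λ i → S i i) + t) (trans (∑-cong (λ i → trans (lem₂ a (d G i) (x i)) (cong (λ t → x i * (t * x i) - a * (d G i * x i)) (sym (A-diag i)))))
               (∑-minus (λ i → S i i) (λ i → a * (d G i * x i)))) ⟩
        total S - ∑ (λ i → S i i) + (∑ (λ i → S i i) - ∑ (λ i → a * (d G i * x i)))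
          ≡⟨ lem₃ (total S) (∑ (λ i → S i i)) (∑ (λ i → a * (d G i * x i))) ⟩
        total S - ∑ (λ i → a * (d G i * x i))
          ≡⟨ cong₂ _-_ (trans (∑-cong (λ i → trans (sym (*-distribˡ-∑ (x i) (λ j → A G i j * x j))) (cong (x i *_) (sym (∙-∑ (A G i) x))))) (sym (∙-∑ x (A G ▹ x))))
               (trans (sym (*-distribˡ-∑ a (λ i → d G i * x i))) (cong (a *_) (sym (∙-∑ (d G) x)))) ⟩
        x ∙ (A G ▹ x) - a * (d G ∙ x) ∎

    dd : ℕ → ℤ
    dd k = d G ∙ pow (A G) k (d G)

    𝟙-pow-suc : ∀ k → 𝟙 ∙ pow (A G) (suc k) (d G) ≡ c * dd k
    𝟙-pow-suc k = trans (self-adjoint (A-sym G) 𝟙 (pow (A G) k (d G))) (trans (∙-cong (A-𝟙 G) (λ _ → refl)) (∙-scaleˡ c (d G) (pow (A G) k (d G))))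

    from-difference : ∀ {k x y} → k ∣ x - y → k ∣ y → k ∣ x
    from-difference {k} {x} {y} h e = ∣-respʳ (lem x y) (∣m∣n⇒∣m+n h e)
      where
      lem : ∀ x y → x - y + y ≡ x
      lem = solve-∀

    -- For k = 2j the value is the square of Aʲd, with the parity of 𝟙 ∙ Aʲd; for k = 2j + 1 it is
    -- the form of A at Aʲd, with the parity of a (d ∙ Aʲd). Both are multiples of an earlier value,
    -- or of the even 𝟙 ∙ d if k = 0.
    dd-even : ∀ k → 2ℤ ∣ dd k
    dd-even = <-rec _ step
      where
      step : ∀ k → (∀ {l} → l ℕ.< k → 2ℤ ∣ dd l) → 2ℤ ∣ dd k
      step k IH with halve k
      ... | j , inj₁ refl = ∣-respʳ (pow-∙-pow (A-sym G) j j (d G) (d G)) (from-difference (square-parity (pow (A G) j (d G))) (mean j IH))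
        where
        mean : ∀ j → (∀ {l} → l ℕ.< j ℕ.+ j → 2ℤ ∣ dd l) → 2ℤ ∣ 𝟙 ∙ pow (A G) j (d G)
        mean zero    _  = d-even
        mean (suc j) IH = ∣-respʳ (sym (𝟙-pow-suc j)) (∣n⇒∣m*n c (IH (ℕ.s≤s (ℕ.m≤m+n j (suc j)))))
      ... | j , inj₂ refl = ∣-respʳ (trans (pow-∙-pow (A-sym G) j (suc j) (d G) (d G)) (cong dd (ℕ.+-suc j j)))
        (from-difference (form-parity (pow (A G) j (d G))) (∣n⇒∣m*n a (IH (ℕ.s≤s (ℕ.m≤m+n j j)))))

    𝟙-even : ∀ k → 2ℤ ∣ 𝟙 ∙ pow (A G) k (d G)
    𝟙-even zero    = d-even
    𝟙-even (suc k) = ∣-respʳ (sym (𝟙-pow-suc k)) (∣n⇒∣m*n c (dd-even k))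

    pow-w : ∀ l k i → pow (A G) l (w G (suc k)) i ≡ w G (suc (l ℕ.+ k)) i
    pow-w l k i = pow-+ (A G) l k (d G) i

    gram-even : ∀ l i j → i ≢ 0 ⊎ j ≢ 0 → 2ℤ ∣ w G i ∙ pow (A G) l (w G j)
    gram-even l zero    zero    (inj₁ h) = ⊥-elim (h refl)
    gram-even l zero    zero    (inj₂ h) = ⊥-elim (h refl)
    gram-even l zero    (suc j) _ = ∣-respʳ (∙-cong (λ _ → refl) (λ i → sym (pow-w l j i))) (𝟙-even (l ℕ.+ j))
    gram-even l (suc i) zero    _ = ∣-respʳ (trans (∙-cong (λ _ → refl) (λ m → sym (pow-w l i m))) (trans (pow-adjoint (A-sym G) l 𝟙 (w G (suc i))) (∙-comm (pow (A G) l 𝟙) (w G (suc i)))))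
      (𝟙-even (l ℕ.+ i))
    gram-even l (suc i) (suc j) _ = ∣-respʳ (sym (trans (∙-cong (λ _ → refl) (pow-w l j)) (pow-∙-pow (A-sym G) i (l ℕ.+ j) (d G) (d G)))) (dd-even (i ℕ.+ (l ℕ.+ j)))

  double-injective : ∀ m k → m ℕ.+ m ≡ k ℕ.+ k → m ≡ k
  double-injective zero    zero    e = refl
  double-injective (suc m) (suc k) e = cong suc (double-injective m k
    (ℕ.suc-injective (trans (sym (ℕ.+-suc m m)) (trans (ℕ.suc-injective e) (ℕ.+-suc k k)))))

  pow-⋆ : ∀ {m n} (B : Mat n n) l (g : Vec m) (X : Mat m n) i → pow B l (g ⋆ X) i ≡ (g ⋆ (λ b → pow B l (X b))) i
  pow-⋆ B zero    g X i = refl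
  pow-⋆ B (suc l) g X i = trans (▹-cong B (pow-⋆ B l g X) i) (∙-∑ʳ (B i) g (λ b → pow B l (X b)))

  ∏-bump : ∀ {m} (x y : ℤ) (b : Fin m) → ∏ (updateAt (λ _ → x) b (λ _ → x * y)) ≡ y * x ^ m
  ∏-bump {suc m} x y zero = trans (cong (λ t → x * y * t) (constant m)) (lem x y (x ^ m))
    where
    constant : ∀ m → ∏ {m} (λ _ → x) ≡ x ^ m
    constant zero    = refl
    constant (suc m) = cong (x *_) (constant m)
    lem : ∀ x y z → x * y * z ≡ y * (x * z)
    lem = solve-∀
  ∏-bump {suc m} x y (suc b) = trans (cong (x *_) (∏-bump x y b)) (lem x y (x ^ m))
    where
    lem : ∀ x y z → x * (y * z) ≡ y * (x * z)
    lem = solve-∀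

  module Prime₂ = ModPrime 2 prime[2]
  open Prime₂ using (P)

  P^-sqrt : ∀ k {x} → P ^ suc (k ℕ.+ k) ∣ x * x → P ^ suc k ∣ x
  P^-sqrt k {x} h with P-divides-root (∣-trans (∣m⇒∣m*n (P ^ (k ℕ.+ k)) (∣-refl {P})) h)
    where
    P-divides-root : P ∣ x * x → P ∣ x
    P-divides-root h with Prime₂.P-euclid x x h
    ... | inj₁ a = a
    ... | inj₂ a = a
  P^-sqrt zero    {x} h | h′ = subst (_∣ x) (sym (*-identityʳ P)) h′
  P^-sqrt (suc k) {x} h | divides y refl = ∣-respʳ (*-comm P y) (*-monoʳ-∣ P (P^-sqrt k (*-cancelˡ-∣ P (*-cancelˡ-∣ P
    (subst₂ _∣_ (cong (λ t → P * (P * P ^ t)) (ℕ.+-suc k k)) (lem y P) h)))))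
    where
    lem : ∀ y p → y * p * (y * p) ≡ p * (p * (y * y))
    lem = solve-∀

  -- Since w_i ∙ A^m w_i is the Gram entry of w_{2i} and w_m up to a power of c, a quadratic relation modulo 4
  -- between w_0, ..., w_r becomes a linear relation modulo 4 between the even-indexed rows of the Gram matrix.
  module Quadratic {n′ c} (G : Degreed (suc n′) c) (a : ℤ) (A-diag : ∀ i → A G i i ≡ a * d G i) (d-even : P ∣ 𝟙 ∙ d G)
    (r : ℕ) (r+r≤n′ : r ℕ.+ r ℕ.≤ n′) where

    open EvenGram G a A-diag d-even

    private
      n : ℕ
      n = suc n′

    X : Mat (suc r) n
    X b = w G (toℕ b)

    -- Cross terms occur twice with even Gram entries, so only the squares survive modulo 4. The
    -- pairing of 𝟙 with itself may be odd, but is no cross term.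
    diagonal : (g : Vec (suc r)) → ∀ l → P * P ∣ (g ⋆ X) ∙ pow (A G) l (g ⋆ X) →
      P * P ∣ ∑ (λ b → g b * (g b * (pow (A G) l (X b) ∙ X b)))
    diagonal g l h = ∣-respʳ (lem (total S) (∑ (λ b → S b b))) (∣m∣n⇒∣m-n (∣-respʳ eq h) (symmetric-total P S S-sym off))
      where
      Y : Mat (suc r) n
      Y b = pow (A G) l (X b)
      S : Mat (suc r) (suc r)
      S b e = g b * (g e * (Y b ∙ X e))
      lem : ∀ t s → t - (t - s) ≡ s
      lem = solve-∀
      Y-X : ∀ b e → Y b ∙ X e ≡ Y e ∙ X b
      Y-X b e = trans (sym (pow-adjoint (A-sym G) l (X b) (X e))) (∙-comm (X b) (Y e))
      S-sym : Symmetric S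
      S-sym b e = trans (lem′ (g b) (g e) (Y b ∙ X e)) (cong (λ t → g e * (g b * t)) (Y-X b e))
        where
        lem′ : ∀ x y z → x * (y * z) ≡ y * (x * z)
        lem′ = solve-∀
      nonzero : ∀ b e → b ≢ e → toℕ {suc r} b ≢ 0 ⊎ toℕ {suc r} e ≢ 0
      nonzero zero    zero    b≢e = ⊥-elim (b≢e refl)
      nonzero (suc b) e       b≢e = inj₁ (λ ())
      nonzero zero    (suc e) b≢e = inj₂ (λ ())
      off : ∀ b e → b ≢ e → P ∣ S b e
      off b e b≢e = ∣n⇒∣m*n (g b) (∣n⇒∣m*n (g e) (∣-respʳ (pow-adjoint (A-sym G) l (X b) (X e)) (gram-even l (toℕ b) (toℕ e) (nonzero b e b≢e))))
      eq : (g ⋆ X) ∙ pow (A G) l (g ⋆ X) ≡ total S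
      eq = begin
        (g ⋆ X) ∙ pow (A G) l (g ⋆ X)   ≡⟨ ∙-cong (λ _ → refl) (pow-⋆ (A G) l g X) ⟩
        (g ⋆ X) ∙ (g ⋆ Y)   ≡⟨ ∙-∑ʳ (g ⋆ X) g Y ⟩
        g ∙ (λ b → (g ⋆ X) ∙ Y b)   ≡⟨ ∙-cong (λ _ → refl) (λ b → trans (∙-comm (g ⋆ X) (Y b)) (∙-∑ʳ (Y b) g X)) ⟩
        g ∙ (λ b → g ∙ (λ e → Y b ∙ X e)) ≡⟨ ∙-∑ g (λ b → g ∙ (λ e → Y b ∙ X e)) ⟩
        ∑ (λ b → g b * (g ∙ (λ e → Y b ∙ X e))) ≡⟨ ∑-cong (λ b → trans (cong (g b *_) (∙-∑ g (λ e → Y b ∙ X e))) (*-distribˡ-∑ (g b) (λ e → g e * (Y b ∙ X e)))) ⟩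
        total S   ∎

    opaque
      τ : Fin (suc r) → Fin n
      τ b = fromℕ< (ℕ.s≤s (ℕ.≤-trans (ℕ.+-mono-≤ (ℕ.≤-pred (toℕ<n b)) (ℕ.≤-pred (toℕ<n b))) r+r≤n′))

      toℕ-τ : ∀ b → toℕ (τ b) ≡ toℕ b ℕ.+ toℕ b
      toℕ-τ b = toℕ-fromℕ< _

    τ-injective : ∀ {b e} → τ b ≡ τ e → b ≡ e
    τ-injective {b} {e} p = toℕ-injective (double-injective (toℕ b) (toℕ e) (trans (sym (toℕ-τ b)) (trans (cong toℕ p) (toℕ-τ e))))

    T : Mat n n
    T i j = w G (toℕ i) ∙ w G (toℕ j)

    -- The extra `c` makes `doubled` hold at index 0 as well: `ε m` is needed to pass from w_m to
    -- A^m w₀, and c = γ m ε m. An even `c` hides the parity of `g zero`; the conclusions concern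
    -- `g (suc i)` only.
    weight : (g : Vec (suc r)) → Vec (suc r)
    weight g zero    = c * (g zero * g zero)
    weight g (suc i) = g (suc i) * g (suc i)

    doubled : ∀ g b m → weight g b * (w G (toℕ b ℕ.+ toℕ b) ∙ w G m) ≡ γ G m * (g b * (g b * (pow (A G) m (X b) ∙ X b)))
    doubled g zero m = trans (lem c (g zero) (𝟙 ∙ w G m)) (trans (cong (λ t → t * (g zero * (g zero * (𝟙 ∙ w G m)))) (γε m))
      (trans (lem′ (γ G m) (ε G m) (g zero) (𝟙 ∙ w G m)) (cong (λ t → γ G m * (g zero * (g zero * t))) (begin
        ε G m * (𝟙 ∙ w G m)   ≡⟨ ∙-scaleʳ (ε G m) (w G m) 𝟙 ⟨
        𝟙 ∙ (λ i → ε G m * w G m i)   ≡⟨ ∙-cong (λ _ → refl) (pow-𝟙 G m) ⟨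
        𝟙 ∙ pow (A G) m 𝟙   ≡⟨ ∙-comm 𝟙 (pow (A G) m 𝟙) ⟩
        pow (A G) m 𝟙 ∙ 𝟙   ∎))))
      where
      lem : ∀ c g x → c * (g * g) * x ≡ c * (g * (g * x))
      lem = solve-∀
      lem′ : ∀ γ ε g x → γ * ε * (g * (g * x)) ≡ γ * (g * (g * (ε * x)))
      lem′ = solve-∀
      γε : ∀ m → c ≡ γ G m * ε G m
      γε zero    = sym (*-identityʳ c)
      γε (suc m) = sym (*-identityˡ c)
    doubled g (suc b) m = trans (cong (g (suc b) * g (suc b) *_) (gram m (toℕ b))) (lem (g (suc b)) (γ G m) (pow (A G) m (X (suc b)) ∙ X (suc b)))
      where
      lem : ∀ g γ x → g * g * (γ * x) ≡ γ * (g * (g * x))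
      lem = solve-∀
      gram : ∀ m i → w G (suc i ℕ.+ suc i) ∙ w G m ≡ γ G m * (pow (A G) m (w G (suc i)) ∙ w G (suc i))
      gram zero i = begin
        pow (A G) (i ℕ.+ suc i) (d G) ∙ 𝟙   ≡⟨ ∙-comm (pow (A G) (i ℕ.+ suc i) (d G)) 𝟙 ⟩
        𝟙 ∙ pow (A G) (i ℕ.+ suc i) (d G)   ≡⟨ cong (λ t → 𝟙 ∙ pow (A G) t (d G)) (ℕ.+-suc i i) ⟩
        𝟙 ∙ pow (A G) (suc (i ℕ.+ i)) (d G)   ≡⟨ 𝟙-pow-suc (i ℕ.+ i) ⟩
        c * dd (i ℕ.+ i)   ≡⟨ cong (c *_) (pow-∙-pow (A-sym G) i i (d G) (d G)) ⟨
        c * (w G (suc i) ∙ w G (suc i))   ∎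
      gram (suc l) i = begin
        pow (A G) (i ℕ.+ suc i) (d G) ∙ pow (A G) l (d G)   ≡⟨ pow-∙-pow (A-sym G) (i ℕ.+ suc i) l (d G) (d G) ⟩
        dd (i ℕ.+ suc i ℕ.+ l)   ≡⟨ cong dd (trans (ℕ.+-comm (i ℕ.+ suc i) l) (trans (sym (ℕ.+-assoc l i (suc i))) (ℕ.+-suc (l ℕ.+ i) i))) ⟩
        dd (suc l ℕ.+ i ℕ.+ i)   ≡⟨ pow-∙-pow (A-sym G) (suc l ℕ.+ i) i (d G) (d G) ⟨
        pow (A G) (suc l ℕ.+ i) (d G) ∙ pow (A G) i (d G)   ≡⟨ ∙-cong (λ k → pow-+ (A G) (suc l) i (d G) k) (λ _ → refl) ⟨
        pow (A G) (suc l) (w G (suc i)) ∙ w G (suc i)   ≡⟨ *-identityˡ (pow (A G) (suc l) (w G (suc i)) ∙ w G (suc i)) ⟨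
        1ℤ * (pow (A G) (suc l) (w G (suc i)) ∙ w G (suc i))  ∎

    gram-relation : (g : Vec (suc r)) → (∀ l → P * P ∣ (g ⋆ X) ∙ pow (A G) l (g ⋆ X)) → ∀ k → P * P ∣ (weight g ⋆ (T ∘ τ)) k
    gram-relation g h k = ∣-respʳ (sym eq) (∣n⇒∣m*n (γ G m) (diagonal g m (h m)))
      where
      m : ℕ
      m = toℕ k
      F : Vec (suc r)
      F b = g b * (g b * (pow (A G) m (X b) ∙ X b))
      eq : (weight g ⋆ (T ∘ τ)) k ≡ γ G m * ∑ F
      eq = begin
        (weight g ⋆ (T ∘ τ)) k   ≡⟨ ∙-∑ (weight g) (λ b → T (τ b) k) ⟩
        ∑ (λ b → weight g b * T (τ b) k)   ≡⟨ ∑-cong (λ b → trans (cong (λ t → weight g b * (w G t ∙ w G m)) (toℕ-τ b)) (doubled g b m)) ⟩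
        ∑ (λ b → γ G m * F b)   ≡⟨ *-distribˡ-∑ (γ G m) F ⟨
        γ G m * ∑ F   ∎

    det-T : detℤ T ≡ detℤ (W G) * detℤ (W G)
    det-T = trans (detℤ-· (W G ᵀ) (W G)) (cong (_* detℤ (W G)) (detℤ-ᵀ (W G)))

    replaced : ∀ (h : Vec (suc r)) b → detℤ (T [ τ b ]≔ (h ⋆ (T ∘ τ))) ≡ h b * detℤ T
    replaced h b = begin
      detℤ (T [ τ b ]≔ (h ⋆ (T ∘ τ)))   ≡⟨ RowForm.F-∑ detℤ-rowForm T (τ b) h (T ∘ τ) ⟩
      h ∙ (λ e → detℤ (T [ τ b ]≔ T (τ e)))   ≡⟨ ∙-∑ h (λ e → detℤ (T [ τ b ]≔ T (τ e))) ⟩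
      ∑ (λ e → h e * detℤ (T [ τ b ]≔ T (τ e)))   ≡⟨ ∑-single (λ e → h e * detℤ (T [ τ b ]≔ T (τ e))) b off ⟩
      h b * detℤ (T [ τ b ]≔ T (τ b))   ≡⟨ cong (h b *_) (detℤ-cong ([]≔-self T (τ b))) ⟩
      h b * detℤ T   ∎
      where
      off : ∀ e → e ≢ b → h e * detℤ (T [ τ b ]≔ T (τ e)) ≡ 0ℤ
      off e e≢b = trans (cong (h e *_) (detℤ-equal {i = τ b} {τ e} (λ p → e≢b (sym (τ-injective p))) (T [ τ b ]≔ T (τ e))
        (λ k → cong (λ v → v k) (trans ([]≔-row T (τ b) (T (τ e))) (sym ([]≔-other T (T (τ e)) (λ p → e≢b (τ-injective p)))))))) (*-zeroʳ (h e))

    -- Row 2(i + 1) of the Gram matrix is replaced by the relation: this multiplies the determinant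
    -- by the weight and makes the row divisible by 4. The other rows are even, except row 0, of
    -- which only divisibility by `q₀` is assumed.
    2-adic : (g : Vec (suc r)) → (∀ l → P * P ∣ (g ⋆ X) ∙ pow (A G) l (g ⋆ X)) → ∀ i q₀ → (∀ k → q₀ ∣ T zero k) →
      q₀ * (P * P ^ n′) ∣ g (suc i) * g (suc i) * (detℤ (W G) * detℤ (W G))
    2-adic g h i q₀ hq₀ with τ (suc i) in τ≡
    ... | zero   with () ← trans (sym (cong toℕ τ≡)) (toℕ-τ (suc i))
    ... | suc b′ = subst₂ _∣_ (cong (q₀ *_) (∏-bump P P b′)) (trans (replaced (weight g) (suc i)) (cong (g (suc i) * g (suc i) *_) det-T))
        (detℤ-rows-∣ q (T [ τ (suc i) ]≔ (weight g ⋆ (T ∘ τ))) rows)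
      where
      q : Vec n
      q = q₀ ∷ updateAt (λ _ → P) b′ (λ _ → P * P)
      q-τ : q (τ (suc i)) ≡ P * P
      q-τ = trans (cong q τ≡) (updateAt-updates b′ (λ _ → P))
      q-other : ∀ k → k ≢ τ (suc i) → ∀ j → q k ∣ T k j
      q-other zero    _   j = hq₀ j
      q-other (suc k) k≢τ j = subst (_∣ T (suc k) j) (sym (updateAt-minimal k b′ (λ _ → P) (λ p → k≢τ (trans (cong suc p) (sym τ≡)))))
        (gram-even 0 (suc (toℕ k)) (toℕ j) (inj₁ (λ ())))
      rows : ∀ k j → q k ∣ (T [ τ (suc i) ]≔ (weight g ⋆ (T ∘ τ))) k j
      rows k j = []≔-elim T (τ (suc i)) (weight g ⋆ (T ∘ τ)) (λ k v → q k ∣ v j)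
        (subst (_∣ (weight g ⋆ (T ∘ τ)) j) (sym q-τ) (gram-relation g h j)) (λ k k≢τ → q-other k k≢τ j) k

    -- The two parities of n = n′ + 1; the excluded exponent is ⌊n/2⌋ + 1 in both.
    data Size : Set where
      odd-size  : n′ ≡ r ℕ.+ r → ¬ P ^ suc r ∣ detℤ (W G) → Size
      even-size : n′ ≡ suc (r ℕ.+ r) → ¬ P ^ suc (suc r) ∣ detℤ (W G) → Size

    n-even : n′ ≡ suc (r ℕ.+ r) → P ∣ 𝟙 {n} ∙ 𝟙
    n-even e = ∣-respʳ (sym (trans (𝟙∙𝟙 n) (cong (λ t → + suc t) e))) (divides (+ suc r) (trans (cong +_ (lem r)) (pos-* (suc r) 2)))
      where
      lem : ∀ r → suc (suc (r ℕ.+ r)) ≡ suc r ℕ.* 2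
      lem r = cong (λ t → suc (suc t)) (trans (cong (r ℕ.+_) (sym (ℕ.+-identityʳ r))) (ℕ.*-comm 2 r))

    -- If a coefficient were odd, `2-adic` would put 2^(2r+1), or 2^(2r+3) for even n, into det² W.
    -- The exponent is odd, so the square root rounds up to exactly the excluded power. For even n
    -- row 0 is even too and `q₀` is 2.
    even-coefficients : Size → (g : Vec (suc r)) → (∀ l → P * P ∣ (g ⋆ X) ∙ pow (A G) l (g ⋆ X)) → ∀ i → P ∣ g (suc i)
    even-coefficients size g h i with P ∣? g (suc i)
    ... | yes e = e
    ... | no ¬e = ⊥-elim (absurd size)
      where
      ¬g² : ¬ P ∣ g (suc i) * g (suc i)
      ¬g² k = ¬e (Prime₂.P-cancel ¬e k)
      absurd : Size → ⊥
      absurd (odd-size e ¬P^) = ¬P^ (P^-sqrt r (Prime₂.P^-cancel (suc (r ℕ.+ r)) ¬g²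
        (subst (_∣ g (suc i) * g (suc i) * (detℤ (W G) * detℤ (W G))) (trans (*-identityˡ (P * P ^ n′)) (cong (λ t → P * P ^ t) e))
          (2-adic g h i 1ℤ (λ k → divides (T zero k) (sym (*-identityʳ (T zero k))))))))
      absurd (even-size e ¬P^) = ¬P^ (P^-sqrt (suc r) (Prime₂.P^-cancel (suc (suc r ℕ.+ suc r)) ¬g²
        (subst (_∣ g (suc i) * g (suc i) * (detℤ (W G) * detℤ (W G))) (cong (λ t → P * (P * P ^ t)) (trans e (sym (ℕ.+-suc r r))))
          (2-adic g h i P rows))))
        where
        rows : ∀ k → P ∣ T zero k
        rows zero    = n-even e
        rows (suc k) = gram-even 0 0 (suc (toℕ k)) (inj₂ (λ ()))

  -- Columns of V with an odd entry when N is even.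

  module TwoStep {n′ c} {G H : Degreed (suc n′) c} (c≢0 : c ≢ 0ℤ) {N V} (S : Similar G H N V)
    (a : ℤ) (A-diag : ∀ i → A G i i ≡ a * d G i) (d-even : P ∣ 𝟙 ∙ d G) (r : ℕ) (r+r≤n′ : r ℕ.+ r ℕ.≤ n′) where

    open Similarity {G = G} {H} c≢0
    open Consequences S
    open EvenGram G a A-diag d-even using (gram-even)
    open Quadratic G a A-diag d-even r r+r≤n′ public

    module _ (size : Size) (P∣N : P ∣ N) (j₀ : Fin (suc n′)) (i₀ : Fin (suc n′)) (¬vi : ¬ P ∣ V i₀ j₀) where

      private
        n : ℕ
        n = suc n′
        v : Vec n
        v = column j₀

      v-form : ∀ l → P * P ∣ pow (A G) l v ∙ v
      v-form l = ∣-respʳ (trans (sym (column-form l j₀)) (∙-comm v (pow (A G) l v))) (∣m⇒∣m*n (pow (A H) l (δ j₀) j₀) (∣-*-pres P∣N P∣N))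

      -- With x = 2β - g₀ v, the cross terms carry one 2 and double by symmetry, and the form at `v`
      -- is divisible by N², hence by 4.
      relation-form : ∀ g₀ (x : Vec n) → (∀ i → P ∣ g₀ * v i + x i) → ∀ l → P * P ∣ x ∙ pow (A G) l x
      relation-form g₀ x h l = ∣-respʳ (sym eq) (∣m∣n⇒∣m+n (∣m∣n⇒∣m+n (∣m⇒∣m*n (B β ∙ β) (∣-refl {P * P})) (∣n⇒∣m*n (- g₀ * (B v ∙ β)) (∣-refl {P * P})))
          (∣n⇒∣m*n (g₀ * g₀) (v-form l)))
        where
        B : Vec n → Vec n
        B = pow (A G) l
        β : Vec n
        β = proj₁ (factor (λ i → g₀ * v i + x i) h)
        x≡ : ∀ i → x i ≡ P * β i + - g₀ * v i
        x≡ i = trans (lem g₀ (v i) (x i)) (cong (λ t → t + - g₀ * v i) (proj₂ (factor (λ i → g₀ * v i + x i) h) i))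
          where
          lem : ∀ g v x → x ≡ g * v + x + - g * v
          lem = solve-∀
        flip-B : ∀ u → u ∙ B x ≡ P * (B u ∙ β) + - g₀ * (B u ∙ v)
        flip-B u = trans (pow-adjoint (A-sym G) l u x) (trans (∙-cong (λ _ → refl) x≡) (∙-linearʳ P (- g₀) β v (B u)))
        lem : ∀ P b g y q → P * (P * b + - g * y) + - g * (P * y + - g * q) ≡ P * P * b + - g * y * (P + P) + g * g * q
        lem = solve-∀
        eq : x ∙ B x ≡ P * P * (B β ∙ β) + - g₀ * (B v ∙ β) * (P * P) + g₀ * g₀ * (B v ∙ v)
        eq = begin
          x ∙ B x
            ≡⟨ ∙-cong x≡ (λ _ → refl) ⟩
          (λ i → P * β i + - g₀ * v i) ∙ B x
            ≡⟨ ∙-linearˡ P (- g₀) β v (B x) ⟩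
          P * (β ∙ B x) + - g₀ * (v ∙ B x)
            ≡⟨ cong₂ (λ s t → P * s + - g₀ * t) (flip-B β) (flip-B v) ⟩
          P * (P * (B β ∙ β) + - g₀ * (B β ∙ v)) + - g₀ * (P * (B v ∙ β) + - g₀ * (B v ∙ v))
            ≡⟨ cong (λ t → P * (P * (B β ∙ β) + - g₀ * t) + - g₀ * (P * (B v ∙ β) + - g₀ * (B v ∙ v))) (trans (sym (pow-adjoint (A-sym G) l β v)) (∙-comm β (B v))) ⟩
          P * (P * (B β ∙ β) + - g₀ * (B v ∙ β)) + - g₀ * (P * (B v ∙ β) + - g₀ * (B v ∙ v))
            ≡⟨ lem P (B β ∙ β) g₀ (B v ∙ β) (B v ∙ v) ⟩
          P * P * (B β ∙ β) + - g₀ * (B v ∙ β) * (P * P) + g₀ * g₀ * (B v ∙ v) ∎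

      relation-even : ∀ g₀ (g : Vec (suc r)) → (∀ i → P ∣ g₀ * v i + (g ⋆ X) i) → ∀ b → P ∣ g (suc b)
      relation-even g₀ g h = even-coefficients size g (relation-form g₀ (g ⋆ X) h)

      V₁ : Mat (suc r) n
      V₁ = v ∷ (λ b → w G (suc (toℕ b)))

      V₁-independent : Prime₂.Independent V₁
      V₁-independent g h = λ { zero → g-zero ; (suc b) → g-suc b }
        where
        expand : ∀ i → (g ⋆ V₁) i ≡ g zero * v i + ((0ℤ ∷ (g ∘ suc)) ⋆ X) i
        expand i = trans (∙-∷ g (λ b → V₁ b i)) (cong (λ t → g zero * v i + t)
          (sym (trans (∙-∷ (0ℤ ∷ (g ∘ suc)) (λ b → X b i)) (+-identityˡ ((g ∘ suc) ∙ (λ b → w G (suc (toℕ b)) i))))))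
        g-suc : ∀ b → P ∣ g (suc b)
        g-suc = relation-even (g zero) (0ℤ ∷ (g ∘ suc)) (λ i → ∣-respʳ (expand i) (h i))
        g-zero : P ∣ g zero
        g-zero = Prime₂.P-cancel ¬vi (∣-respʳ (lem (g zero) (v i₀) ((g ∘ suc) ∙ tail)) (∣m∣n⇒∣m-n (∣-respʳ (∙-∷ g (λ b → V₁ b i₀)) (h i₀))
          (∣-respʳ (∙-comm tail (g ∘ suc)) (∙-∣ tail g-suc))))
          where
          tail : Vec r
          tail b = w G (suc (toℕ b)) i₀
          lem : ∀ g v t → g * v + t - t ≡ v * g
          lem = solve-∀

      V₂ : Mat (suc (suc r)) n
      V₂ = v ∷ X

      -- The quadratic relation leaves the coefficient of 𝟙 open. Once the others are even, a
      -- relation between `v` and 𝟙 remains, and an even entry of `v` isolates that coefficient.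
      V₂-independent : (∃ λ i → P ∣ v i) → Prime₂.Independent V₂
      V₂-independent (i₁ , P∣vi₁) g h = λ { zero → g-zero ; (suc zero) → g-one ; (suc (suc b)) → g-suc b }
        where
        g-suc : ∀ b → P ∣ g (suc (suc b))
        g-suc = relation-even (g zero) (g ∘ suc) (λ i → ∣-respʳ (∙-∷ g (λ b → V₂ b i)) (h i))
        head-relation : ∀ i → P ∣ g zero * v i + g (suc zero)
        head-relation i = ∣-respʳ (lem (g zero) (v i) (g (suc zero)) ((λ b → g (suc (suc b))) ∙ tail)) (∣m∣n⇒∣m-n
          (∣-respʳ (trans (∙-∷ g (λ b → V₂ b i)) (cong (λ t → g zero * v i + t) (∙-∷ (g ∘ suc) (λ b → X b i)))) (h i))
          (∣-respʳ (∙-comm tail (λ b → g (suc (suc b)))) (∙-∣ tail g-suc)))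
          where
          tail : Vec r
          tail b = w G (suc (toℕ b)) i
          lem : ∀ g v k t → g * v + (k * 1ℤ + t) - t ≡ g * v + k
          lem = solve-∀
        g-one : P ∣ g (suc zero)
        g-one = ∣m+n∣m⇒∣n (head-relation i₁) (∣n⇒∣m*n (g zero) P∣vi₁)
        g-zero : P ∣ g zero
        g-zero = Prime₂.P-cancel ¬vi (∣-respʳ (*-comm (g zero) (v i₀)) (∣m+n∣n⇒∣m (head-relation i₀) g-one))

      v-kernel : ∀ {q} → q ∣ N → ∀ k → q ∣ (v ⋆ W G) k
      v-kernel h k = ∣-respʳ (sym (column-⋆-W j₀ k)) (∣m⇒∣m*n (w H (toℕ k) j₀) h)

      -- The count reaches the excluded exponent. For odd n the r + 1 vectors of `V₁` suffice; for
      -- even n one more factor comes from counting `v` twice if 4 divides N, or from 𝟙 in `V₂`,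
      -- which is a kernel vector because n is even.
      odd-entry-absurd : P * P ∣ N ⊎ (∃ λ i → P ∣ v i) → ⊥
      odd-entry-absurd hyp = go size hyp
        where
        w-kernel : ∀ b k → P ∣ (w G (suc b) ⋆ W G) k
        w-kernel b k = gram-even 0 (suc b) (toℕ k) (inj₁ (λ ()))
        go : Size → P * P ∣ N ⊎ (∃ λ i → P ∣ v i) → ⊥
        go (odd-size _ ¬P^) _ = ¬P^ (Prime₂.kernel-power₁ V₁ (W G) V₁-independent (λ { zero → v-kernel P∣N ; (suc b) → w-kernel (toℕ b) }))
        go (even-size _ ¬P^) (inj₁ P²∣N) = ¬P^ (Prime₂.kernel-power 1 V₁ (W G) V₁-independent
          (v-kernel (subst (_∣ N) (cong (P *_) (sym (*-identityʳ P))) P²∣N)) (λ b → w-kernel (toℕ b)))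
        go (even-size e ¬P^) (inj₂ i₁) = ¬P^ (Prime₂.kernel-power₁ V₂ (W G) (V₂-independent i₁)
          (λ { zero → v-kernel P∣N ; (suc zero) → 𝟙-kernel ; (suc (suc b)) → w-kernel (toℕ b) }))
          where
          𝟙-kernel : ∀ k → P ∣ (𝟙 ⋆ W G) k
          𝟙-kernel zero    = n-even e
          𝟙-kernel (suc k) = gram-even 0 0 (suc (toℕ k)) (inj₂ (λ ()))

    two-step : Size → P ∣ N → (P * P ∣ N ⊎ (∀ j → ∃ λ i → P ∣ V i j)) → ∀ i j → P ∣ V i j
    two-step size P∣N hyp i j with P ∣? V i j
    ... | yes h = h
    ... | no ¬h = ⊥-elim (odd-entry-absurd size P∣N j i ¬h (pick hyp))
      where
      pick : P * P ∣ N ⊎ (∀ j → ∃ λ i → P ∣ V i j) → P * P ∣ N ⊎ (∃ λ i → P ∣ V i j)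
      pick (inj₁ h) = inj₁ h
      pick (inj₂ f) = inj₂ (f j)

  -- Descent to a permutation matrix

  odd-prime-divisor : ∀ b → b ≢ 0 → b ≢ 1 → ¬ 2 ℕ.∣ b → ∃ λ p → Prime p × p ≢ 2 × p ℕ.∣ b
  odd-prime-divisor b b≢0 b≢1 ¬2 with factorise b {{ℕ.≢-nonZero b≢0}}
  ... | record { factors = List.[] ; isFactorisation = e } = ⊥-elim (b≢1 e)
  ... | record { factors = p List.∷ ps ; isFactorisation = e ; factorsPrime = pp All.∷ _ } =
    p , pp , (λ { refl → ¬2 p∣b }) , p∣b
    where
    p∣b : p ℕ.∣ b
    p∣b = subst (p ℕ.∣_) (sym e) (ℕ.m∣m*n _)

  odd-prime-divisor-4∤ : ∀ a → a ≢ 0 → a ≢ 1 → a ≢ 2 → ¬ 4 ℕ.∣ a → ∃ λ p → Prime p × p ≢ 2 × p ℕ.∣ a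
  odd-prime-divisor-4∤ a a≢0 a≢1 a≢2 ¬4 with 2 ℕ.∣? a
  ... | no ¬2 = odd-prime-divisor a a≢0 a≢1 ¬2
  ... | yes (ℕ.divides b refl) with odd-prime-divisor b (λ { refl → a≢0 refl }) (λ { refl → a≢2 refl }) (λ { (ℕ.divides q refl) → ¬4 (ℕ.divides q (ℕ.*-assoc q 2 2)) })
  ...   | p , pp , p≢2 , p∣b = p , pp , p≢2 , ℕ.∣m⇒∣m*n 2 p∣b

  0≤x² : ∀ x → 0ℤ ℤ.≤ x * x
  0≤x² (+ zero)    = +≤+ ℕ.z≤n
  0≤x² (+ (suc k)) = +≤+ ℕ.z≤n
  0≤x² -[1+ k ]    = +≤+ ℕ.z≤n

  1≤x² : ∀ x → x ≢ 0ℤ → 1ℤ ℤ.≤ x * x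
  1≤x² (+ zero)    x≢0 = ⊥-elim (x≢0 refl)
  1≤x² (+ (suc k)) x≢0 = +≤+ (ℕ.s≤s ℕ.z≤n)
  1≤x² -[1+ k ]    x≢0 = +≤+ (ℕ.s≤s ℕ.z≤n)

  0≤x²-x : ∀ x → 0ℤ ℤ.≤ x * x - x
  0≤x²-x (+ zero)    = +≤+ ℕ.z≤n
  0≤x²-x (+ (suc k)) = i≤j⇒0≤j-i (+≤+ (ℕ.m≤m*n (suc k) (suc k)))
  0≤x²-x -[1+ k ]    = +≤+ ℕ.z≤n

  ∑-≥ : ∀ {n} (f : Vec n) → (∀ i → 1ℤ ℤ.≤ f i) → + n ℤ.≤ ∑ f
  ∑-≥ {zero}  f h = ≤-reflexive (sym (∑-[] f))
  ∑-≥ {suc n} f h = ≤-trans (+-mono-≤ (h zero) (∑-≥ (f ∘ suc) (h ∘ suc))) (≤-reflexive (sym (∑-∷ f)))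

  ∑-nonneg : ∀ {n} (f : Vec n) → (∀ i → 0ℤ ℤ.≤ f i) → 0ℤ ℤ.≤ ∑ f
  ∑-nonneg {zero}  f h = ≤-reflexive (sym (∑-[] f))
  ∑-nonneg {suc n} f h = ≤-trans (+-mono-≤ (h zero) (∑-nonneg (f ∘ suc) (h ∘ suc))) (≤-reflexive (sym (∑-∷ f)))

  nonneg-+-zero : ∀ {x y} → 0ℤ ℤ.≤ x → 0ℤ ℤ.≤ y → x + y ≡ 0ℤ → x ≡ 0ℤ × y ≡ 0ℤ
  nonneg-+-zero {+ zero}  {y} _ _ e = refl , trans (sym (+-identityˡ y)) e
  nonneg-+-zero {+ suc k} {+ l} _ _ ()

  ∑-nonneg-zero : ∀ {n} (f : Vec n) → (∀ i → 0ℤ ℤ.≤ f i) → ∑ f ≡ 0ℤ → ∀ i → f i ≡ 0ℤ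
  ∑-nonneg-zero {suc n} f h e with nonneg-+-zero (h zero) (∑-nonneg (f ∘ suc) (h ∘ suc)) (trans (sym (∑-∷ f)) e)
  ... | f₀ , rest = λ { zero → f₀ ; (suc i) → ∑-nonneg-zero (f ∘ suc) (h ∘ suc) rest i }

  -- The sum of the nonnegative numbers v_i² - v_i is zero.
  idempotent-entries : ∀ {n} (v : Vec n) → v ∙ v ≡ 1ℤ → 𝟙 ∙ v ≡ 1ℤ → ∀ i → v i * v i - v i ≡ 0ℤ
  idempotent-entries v vv 𝟙v = ∑-nonneg-zero (λ i → v i * v i - v i) (λ i → 0≤x²-x (v i)) (trans (∑-minus (λ i → v i * v i) v)
    (cong₂ _-_ (trans (sym (∙-∑ v v)) vv) (trans (∑-cong (λ i → sym (*-identityˡ (v i)))) (trans (sym (∙-∑ 𝟙 v)) 𝟙v))))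

  -- The entries are 0 or 1. Subtracting the unit vector at an entry 1 leaves nonnegative entries
  -- with sum zero.
  unit-vector : ∀ {n} (v : Vec n) → v ∙ v ≡ 1ℤ → 𝟙 ∙ v ≡ 1ℤ → ∃ λ k → ∀ i → v i ≡ δ k i
  unit-vector {n} v vv 𝟙v with any? (λ i → v i ℤ.≟ 1ℤ)
  ... | no none = ⊥-elim (1≢0 (trans (sym 𝟙v) (trans (∙-∑ 𝟙 v) (∑-zero (λ i → 1ℤ * v i) (λ i → trans (*-identityˡ (v i)) (zero-entry i))))))
    where
    1≢0 : 1ℤ ≢ 0ℤ
    1≢0 ()
    zero-entry : ∀ i → v i ≡ 0ℤ
    zero-entry i with i*j≡0⇒i≡0∨j≡0 (v i) {v i - 1ℤ} (trans (lem (v i)) (idempotent-entries v vv 𝟙v i))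
      where
      lem : ∀ x → x * (x - 1ℤ) ≡ x * x - x
      lem = solve-∀
    ... | inj₁ e = e
    ... | inj₂ e = ⊥-elim (none (i , i-j≡0⇒i≡j (v i) 1ℤ e))
  ... | yes (k , vk) = k , λ i → i-j≡0⇒i≡j (v i) (δ k i) (∑-nonneg-zero (λ i → v i - δ k i) nonneg sum-zero i)
    where
    nonneg : ∀ i → 0ℤ ℤ.≤ v i - δ k i
    nonneg i with k ≟ i
    ... | yes refl = ≤-reflexive (sym (cong (_- 1ℤ) vk))
    ... | no k≢i   = subst (0ℤ ℤ.≤_) (trans (i-j≡0⇒i≡j (v i * v i) (v i) (idempotent-entries v vv 𝟙v i)) (sym (+-identityʳ (v i)))) (0≤x² (v i))
    sum-zero : ∑ (λ i → v i - δ k i) ≡ 0ℤ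
    sum-zero = trans (∑-minus v (δ k)) (cong₂ _-_ (trans (∑-cong (λ i → sym (*-identityˡ (v i)))) (trans (sym (∙-∑ 𝟙 v)) 𝟙v))
      (trans (∑-cong (λ i → sym (*-identityˡ (δ k i)))) (trans (sym (∙-∑ 𝟙 (δ k))) (∙-δ 𝟙 k))))

  -- The conditions in `Similar` are homogeneous in `V` and `N` together, so a common factor
  -- cancels.
  divide : ∀ {n c} {G H : Degreed n c} {N V} k N′ V′ → k ≢ 0ℤ → N ≡ k * N′ → (∀ i j → V i j ≡ k * V′ i j) →
    Similar G H N V → Similar G H N′ V′
  divide {G = G} {H} {N} {V} k N′ V′ k≢0 N≡ V≡ S = record
    { orth = •-cancel (*-≢0 k≢0 k≢0) (  ≐-sym (•-• k k (V′ ᵀ · V′)) ⟫ •-cong k (≐-sym (•-·ʳ k (V′ ᵀ) V′)) ⟫ ≐-sym (•-·ˡ k (V′ ᵀ) (k • V′))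
        ⟫ ·-cong (λ i j → sym (V≡ j i)) (λ i j → sym (V≡ i j)) ⟫ orth ⟫ (λ i j → trans (cong (λ t → t * t * δ i j) N≡) (lem k N′ (δ i j))))
    ; comm = •-cancel k≢0 (≐-sym (•-·ʳ k (A G) V′) ⟫ ·-cong (≐-refl {A = A G}) (λ i j → sym (V≡ i j)) ⟫ comm ⟫ ·-cong V≡ ≐-refl ⟫ •-·ˡ k V′ (A H))
    ; ones = λ j → cancel-* k≢0 (trans (sym (∙-scaleʳ k (λ i → V′ i j) 𝟙)) (trans (∙-cong (λ _ → refl) (λ i → sym (V≡ i j))) (trans (ones j) N≡))) }
    where
    open Similar S
    lem : ∀ k n x → k * n * (k * n) * x ≡ k * k * (n * n * x)
    lem = solve-∀

  record Permuted {n c} (G H : Degreed n c) : Set where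
    field
      σ σ⁻¹ : Fin n → Fin n
      σ-σ⁻¹ : ∀ i → σ (σ⁻¹ i) ≡ i
      σ⁻¹-σ : ∀ i → σ⁻¹ (σ i) ≡ i
      A-σ   : ∀ i j → A G (σ i) (σ j) ≡ A H i j

  permutation : ∀ {n c} {G H : Degreed n c} {V} → Similar G H 1ℤ V → Permuted G H
  permutation {n} {c} {G} {H} {V} S = record
    { σ = σ ; σ⁻¹ = σ⁻¹ ; σ-σ⁻¹ = σ-σ⁻¹ ; σ⁻¹-σ = λ i → injective (σ-σ⁻¹ (σ i)) ; A-σ = A-σ }
    where
    open Similar S
    unit : ∀ j → ∃ λ k → ∀ i → V i j ≡ δ k i
    unit j = unit-vector (λ i → V i j) (trans (orth j j) (trans (*-identityˡ (δ j j)) (δ-refl j))) (ones j)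
    opaque
      σ : Fin n → Fin n
      σ j = proj₁ (unit j)
      V-σ : ∀ i j → V i j ≡ δ (σ j) i
      V-σ i j = proj₂ (unit j) i
    δ-injective : ∀ {n} {i j : Fin n} → δ i j ≡ 1ℤ → i ≡ j
    δ-injective {i = i} {j} e with i ≟ j
    ... | yes p = p
    δ-injective () | no _
    injective : ∀ {j k} → σ j ≡ σ k → j ≡ k
    injective {j} {k} e = δ-injective (trans (sym (trans (orth j k) (*-identityˡ (δ j k)))) (trans (∙-cong (λ i → V-σ i j) (λ i → V-σ i k))
      (trans (δ-∙ (δ (σ k)) (σ j)) (trans (cong (δ (σ k)) e) (δ-refl (σ k))))))
    VVᵀ : V · V ᵀ ≐ 1ℤ • δ
    VVᵀ = scalar-inverse-comm {a = 1ℤ} (V ᵀ) V (λ ()) orth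
    -- A value missed by `σ` would give `V` a zero row, against V Vᵀ = I.
    preimage : ∀ i → ∃ λ j → σ j ≡ i
    preimage i with any? (λ j → σ j ≟ i)
    ... | yes r = r
    ... | no ¬r = ⊥-elim (1≢0 (trans (sym (trans (VVᵀ i i) (trans (*-identityˡ (δ i i)) (δ-refl i)))) (trans (∙-∑ (V i) (V i))
            (∑-zero (λ j → V i j * V i j) (λ j → trans (cong (_* V i j) (trans (V-σ i j) (δ-≢ (λ e → ¬r (j , e))))) refl)))))
      where
      1≢0 : 1ℤ ≢ 0ℤ
      1≢0 ()
    σ⁻¹ : Fin n → Fin n
    σ⁻¹ i = proj₁ (preimage i)
    σ-σ⁻¹ : ∀ i → σ (σ⁻¹ i) ≡ i
    σ-σ⁻¹ i = proj₂ (preimage i)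
    V-row : ∀ i k → V (σ i) k ≡ δ i k
    V-row i k = trans (V-σ (σ i) k) (by-cases (k ≟ i))
      where
      by-cases : Dec (k ≡ i) → δ (σ k) (σ i) ≡ δ i k
      by-cases (yes refl) = trans (δ-refl (σ i)) (sym (δ-refl i))
      by-cases (no k≢i)   = trans (δ-≢ (λ e → k≢i (injective e))) (sym (δ-≢ (k≢i ∘ sym)))
    A-σ : ∀ i j → A G (σ i) (σ j) ≡ A H i j
    A-σ i j = begin
      A G (σ i) (σ j)   ≡⟨ ∙-δ (A G (σ i)) (σ j) ⟨
      A G (σ i) ∙ δ (σ j)   ≡⟨ ∙-cong (λ _ → refl) (λ k → V-σ k j) ⟨
      (A G · V) (σ i) j   ≡⟨ comm (σ i) j ⟩
      V (σ i) ∙ (λ k → A H k j)   ≡⟨ ∙-cong (V-row i) (λ _ → refl) ⟩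
      δ i ∙ (λ k → A H k j)   ≡⟨ δ-∙ (λ k → A H k j) i ⟩
      A H i j   ∎

  module Descent {n′ c} {G H : Degreed (suc n′) c} (c≢0 : c ≢ 0ℤ) (5≤n : 5 ℕ.≤ suc n′)
    (a : ℤ) (A-diag : ∀ i → A G i i ≡ a * d G i) (d-even : P ∣ 𝟙 ∙ d G) (r : ℕ) (r+r≤n′ : r ℕ.+ r ℕ.≤ n′)
    (size : Quadratic.Size G a A-diag d-even r r+r≤n′)
    (square-free : ∀ p (pp : Prime p) → p ≢ 2 → ¬ (+ p) ^ 2 ∣ detℤ (W G))
    (full-rank : ∀ p (pp : Prime p) → p ≢ 2 → + p ∣ c → ∀ (x : Vec (suc n′)) → (∀ i → + p ∣ (W G ▹ x) i) → ∀ j → + p ∣ x j)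
    where

    open Similarity {G = G} {H} c≢0

    odd-divides : ∀ {N V} → Similar G H N V → ∀ p → Prime p → p ≢ 2 → + p ∣ N → ∀ i j → + p ∣ V i j
    odd-divides {N} {V} S p pp p≢2 p∣N with + p ∣? c
    ... | no ¬p∣c = OddStep.odd-step {G = G} {H} c≢0 S p pp ¬p∣c p∣N (square-free p pp p≢2)
    ... | yes p∣c = λ i j → decide i j (+ p ∣? V i j)
      where
      open Consequences S
      open ModPrime p pp using (right-kernel)
      decide : ∀ i j → Dec (+ p ∣ V i j) → + p ∣ V i j
      decide i j (yes h) = h
      decide i j (no ¬h) with right-kernel (W G) (column j) i ¬h (λ k → ∣-respʳ (sym (column-⋆-W j k)) (∣m⇒∣m*n (w H (toℕ k) j) p∣N))
      ... | x , kills , k , ¬xk = ⊥-elim (¬xk (full-rank p pp p≢2 p∣c x kills k))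

    even-entry : ∀ {N V} → Similar G H N V → abs N ≡ 2 → ∀ j → ∃ λ i → P ∣ V i j
    even-entry {N} {V} S |N|≡2 j with any? (λ i → P ∣? V i j)
    ... | yes h = h
    ... | no none = ⊥-elim (5≰4 (drop‿+≤+ (≤-trans (+≤+ 5≤n) (≤-trans bound (≤-reflexive four)))))
      where
      open Consequences S
      5≰4 : ¬ 5 ℕ.≤ 4
      5≰4 (ℕ.s≤s (ℕ.s≤s (ℕ.s≤s (ℕ.s≤s ()))))
      bound : + suc n′ ℤ.≤ column j ∙ column j
      bound = ≤-trans (∑-≥ (λ i → V i j * V i j) (λ i → 1≤x² (V i j) (λ e → none (i , ∣-respʳ (sym e) ∣-0)))) (≤-reflexive (sym (∙-∑ (column j) (column j))))
      N² : N * N ≡ + 4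
      N² = square N |N|≡2
        where
        square : ∀ N → abs N ≡ 2 → N * N ≡ + 4
        square (+ .2)     refl = refl
        square -[1+ .1 ]  refl = refl
      four : column j ∙ column j ≡ + 4
      four = trans (column-form 0 j) (trans (cong (N * N *_) (δ-refl j)) (trans (*-identityʳ (N * N)) N²))

    two-divides : ∀ {N V} → Similar G H N V → P ∣ N → P * P ∣ N ⊎ abs N ≡ 2 → ∀ i j → P ∣ V i j
    two-divides {N} {V} S P∣N hyp = TwoStep.two-step {G = G} {H} c≢0 S a A-diag d-even r r+r≤n′ size P∣N (split hyp)
      where
      split : P * P ∣ N ⊎ abs N ≡ 2 → P * P ∣ N ⊎ (∀ j → ∃ λ i → P ∣ V i j)
      split (inj₁ h) = inj₁ h
      split (inj₂ e) = inj₂ (even-entry S e)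

    -- The order of the cases matters: if 4 does not divide N, odd primes are removed first, so that
    -- a last factor 2 is removed only when |N| = 2, where the columns of V have squared length 4.
    reducible : ∀ {N V} → Similar G H N V → N ≢ 0ℤ → abs N ≢ 1 → ∃ λ p → Prime p × + p ∣ N × (∀ i j → + p ∣ V i j)
    reducible {N} S N≢0 |N|≢1 with P * P ∣? N
    ... | yes h = 2 , prime[2] , ∣-trans (∣m⇒∣m*n P (∣-refl {P})) h , two-divides S (∣-trans (∣m⇒∣m*n P (∣-refl {P})) h) (inj₁ h)
    ... | no ¬4 with abs N ℕ.≟ 2
    ...   | yes e = 2 , prime[2] , P∣N , two-divides S P∣N (inj₂ e)
      where
      P∣N : P ∣ N
      P∣N = ∣ᵤ⇒∣ (subst (2 ℕ.∣_) (sym e) ℕ.∣-refl)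
    ...   | no |N|≢2 with odd-prime-divisor-4∤ (abs N) (λ e → N≢0 (∣i∣≡0⇒i≡0 e)) |N|≢1 |N|≢2 (λ h → ¬4 (∣ᵤ⇒∣ h))
    ...     | p , pp , p≢2 , p∣N = p , pp , ∣ᵤ⇒∣ p∣N , odd-divides S p pp p≢2 (∣ᵤ⇒∣ p∣N)

    descend : ∀ k {N V} → abs N ≡ k → N ≢ 0ℤ → Similar G H N V → ∃ λ V′ → Similar G H 1ℤ V′
    descend = <-rec _ step
      where
      step : ∀ k → (∀ {l} → l ℕ.< k → ∀ {N V} → abs N ≡ l → N ≢ 0ℤ → Similar G H N V → ∃ λ V′ → Similar G H 1ℤ V′) →
        ∀ {N V} → abs N ≡ k → N ≢ 0ℤ → Similar G H N V → ∃ λ V′ → Similar G H 1ℤ V′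
      step k IH {N} {V} e N≢0 S with abs N ℕ.≟ 1
      ... | yes |N|≡1 = normalise N |N|≡1 S
        where
        normalise : ∀ N → abs N ≡ 1 → Similar G H N V → ∃ λ V′ → Similar G H 1ℤ V′
        normalise (+ .1)     refl S = V , S
        -- For N = -1, negating `V` restores the column sums 1.
        normalise -[1+ .0 ]  refl S = (λ i j → - V i j) , divide {G = G} {H} (- 1ℤ) 1ℤ (λ i j → - V i j) (λ ()) refl (λ i j → lem (V i j)) S
          where
          lem : ∀ x → x ≡ - 1ℤ * - x
          lem = solve-∀
      ... | no |N|≢1 with reducible S N≢0 |N|≢1
      ...   | p , pp , divides N′ N≡ , hV = IH smaller refl N′≢0 (divide {G = G} {H} (+ p) N′ V′ p≢0 (trans N≡ (*-comm N′ (+ p)))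
                (λ i j → trans (_∣_.equality (hV i j)) (*-comm (V′ i j) (+ p))) S)
        where
        V′ : Mat _ _
        V′ i j = _∣_.quotient (hV i j)
        p≢0 : + p ≢ 0ℤ
        p≢0 e = ℕ.≢-nonZero⁻¹ p {{prime⇒nonZero pp}} (cong abs e)
        N′≢0 : N′ ≢ 0ℤ
        N′≢0 refl = N≢0 N≡
        smaller : abs N′ ℕ.< k
        smaller = subst (abs N′ ℕ.<_) (trans (sym (trans (cong abs N≡) (abs-* N′ (+ p)))) e)
          (ℕ.m<m*n (abs N′) p {{ℕ.≢-nonZero (λ h → N′≢0 (∣i∣≡0⇒i≡0 h))}} (ℕ.nonTrivial⇒n>1 p {{prime⇒nonTrivial pp}}))

    permuted : (∀ k → walks (A G) k ≡ walks (A H) k) → detℤ (W G) ≢ 0ℤ → Permuted G H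
    permuted walks≡ W≢0 = permutation (proj₂ (descend (abs (detℤ (W G))) refl W≢0 (proj₂ (construct walks≡ W≢0))))

  -- Graphs and rational matrices

  open import Defs

  ℚ-ring : AlmostCommutativeRing _ _
  ℚ-ring = fromCommutativeRing ℚ.+-*-commutativeRing (λ x → dec⇒maybe (0ℚ ℚ.≟ x))

  ι : ℤ → ℚ
  ι = ℤtoℚ

  toℚᵘ-ι : ∀ x → toℚᵘ (ι x) ℚᵘ.≃ mkℚᵘ x 0
  toℚᵘ-ι x = ℚ.toℚᵘ-fromℚᵘ (mkℚᵘ x 0)

  ι-+ : ∀ x y → ι (x + y) ≡ ι x ⊕ ι y
  ι-+ x y = ℚ.toℚᵘ-injective (ℚᵘ.≃-trans (toℚᵘ-ι (x + y)) (ℚᵘ.≃-sym (ℚᵘ.≃-trans (ℚ.toℚᵘ-homo-+ (ι x) (ι y))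
    (ℚᵘ.≃-trans (ℚᵘ.+-cong (toℚᵘ-ι x) (toℚᵘ-ι y)) (*≡* (lem x y))))))
    where
    lem : ∀ x y → (x * 1ℤ + y * 1ℤ) * 1ℤ ≡ (x + y) * 1ℤ
    lem = solve-∀

  ι-* : ∀ x y → ι (x * y) ≡ ι x ⊗ ι y
  ι-* x y = ℚ.toℚᵘ-injective (ℚᵘ.≃-trans (toℚᵘ-ι (x * y)) (ℚᵘ.≃-sym (ℚᵘ.≃-trans (ℚ.toℚᵘ-homo-* (ι x) (ι y))
    (ℚᵘ.≃-trans (ℚᵘ.*-cong (toℚᵘ-ι x) (toℚᵘ-ι y)) (*≡* refl)))))

  ι-neg : ∀ x → ι (- x) ≡ ⊖ ι x
  ι-neg x = ℚ.toℚᵘ-injective (ℚᵘ.≃-trans (toℚᵘ-ι (- x)) (ℚᵘ.≃-sym (ℚᵘ.≃-trans (ℚ.toℚᵘ-homo‿- (ι x))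
    (ℚᵘ.-‿cong (toℚᵘ-ι x)))))

  ι-minus : ∀ x y → ι (x - y) ≡ ι x ⊝ ι y
  ι-minus x y = trans (ι-+ x (- y)) (cong (λ t → ι x ⊕ t) (ι-neg y))

  ι-injective : ∀ {x y} → ι x ≡ ι y → x ≡ y
  ι-injective {x} {y} e with ℚᵘ.≃-trans (ℚᵘ.≃-sym (toℚᵘ-ι x)) (ℚᵘ.≃-trans (ℚᵘ.≃-reflexive (cong toℚᵘ e)) (toℚᵘ-ι y))
  ... | *≡* p = trans (sym (*-identityʳ x)) (trans p (*-identityʳ y))

  sumFin-ι : ∀ {n} {f : Fin n → ℚ} (g : Vec n) → (∀ i → f i ≡ ι (g i)) → sumFin f ≡ ι (∑ g)
  sumFin-ι {zero}  g h = sym (cong ι (∑-[] g))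
  sumFin-ι {suc n} g h = trans (cong₂ _⊕_ (h zero) (sumFin-ι (g ∘ suc) (h ∘ suc))) (trans (sym (ι-+ (g zero) (∑ (g ∘ suc)))) (cong ι (sym (∑-∷ g))))

  -- Clearing denominators in determinants of rational matrices.

  minor-term : ∀ n → Matrix (suc n) → Fin (suc n) → ℚ
  minor-term n M j = M zero j ⊗ det (λ a b → M (suc a) (punchIn j b))

  -- The alternating sum inside det is a local function and has no name outside Defs; it is recovered by
  -- unification from the unfolding of det on a matrix with at least two rows.
  mutual
    det-tail : ∀ n → Matrix (suc (suc n)) → ℚ
    det-tail = _

    det-unfold : ∀ n (M : Matrix (suc (suc n))) →
      det M ≡ 1ℚ ⊗ minor-term _ M zero ⊕ (⊖ 1ℚ ⊗ minor-term _ M (suc zero) ⊕ det-tail n M)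
    det-unfold n M = refl

  mutual
    alt-sum : ∀ p → Matrix (suc p) → ∀ m → ℚ → (Fin m → ℚ) → ℚ
    alt-sum = _

    det-tail-alt-sum : ∀ n (M : Matrix (suc (suc n))) →
      det-tail n M ≡ alt-sum (suc n) M n (⊖ (⊖ 1ℚ)) (λ i → minor-term _ M (suc (suc i)))
    -- Abstracting the arguments to variables turns the equation into a pattern, from which
    -- unification reads off the local function at all arguments.
    det-tail-alt-sum n M with suc n | M | ⊖ (⊖ 1ℚ) | (λ i → minor-term (suc n) M (suc (suc i)))
    ... | p | M′ | s | f = refl

  alt-sum-ι : ∀ p M m κ s (f : Fin m → ℚ) (g : Vec m) → (∀ j → κ ⊗ f j ≡ ι (g j)) →
    κ ⊗ alt-sum p M m (ι s) f ≡ ι (s * ∑ (λ j → sgn j * g j))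
  alt-sum-ι p M zero    κ s f g h = trans (ℚ.*-zeroʳ κ) (cong ι (sym (trans (cong (s *_) (∑-[] (λ j → sgn j * g j))) (*-zeroʳ s))))
  alt-sum-ι p M (suc m) κ s f g h = begin
    κ ⊗ (ι s ⊗ f zero ⊕ alt-sum p M m (⊖ ι s) (f ∘ suc))
      ≡⟨ cong (λ t → κ ⊗ (ι s ⊗ f zero ⊕ alt-sum p M m t (f ∘ suc))) (sym (ι-neg s)) ⟩
    κ ⊗ (ι s ⊗ f zero ⊕ alt-sum p M m (ι (- s)) (f ∘ suc))
      ≡⟨ ring₁ κ (ι s) (f zero) (alt-sum p M m (ι (- s)) (f ∘ suc)) ⟩
    ι s ⊗ (κ ⊗ f zero) ⊕ κ ⊗ alt-sum p M m (ι (- s)) (f ∘ suc)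
      ≡⟨ cong₂ _⊕_ (cong (ι s ⊗_) (h zero)) (alt-sum-ι p M m κ (- s) (f ∘ suc) (g ∘ suc) (h ∘ suc)) ⟩
    ι s ⊗ ι (g zero) ⊕ ι (- s * ∑ (λ j → sgn j * g (suc j)))
      ≡⟨ cong (_⊕ ι (- s * ∑ (λ j → sgn j * g (suc j)))) (ι-* s (g zero)) ⟨
    ι (s * g zero) ⊕ ι (- s * ∑ (λ j → sgn j * g (suc j)))
      ≡⟨ ι-+ (s * g zero) (- s * ∑ (λ j → sgn j * g (suc j))) ⟨
    ι (s * g zero + - s * ∑ (λ j → sgn j * g (suc j)))
      ≡⟨ cong ι (sym (begin
        s * ∑ (λ j → sgn j * g j)   ≡⟨ cong (s *_) (∑-∷ (λ j → sgn j * g j)) ⟩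
        s * (1ℤ * g zero + ∑ (λ j → - sgn j * g (suc j)))   ≡⟨ cong (λ t → s * (1ℤ * g zero + t)) (trans (∑-cong (λ j → lem (sgn j) (g (suc j)))) (sym (*-distribˡ-∑ (- 1ℤ) (λ j → sgn j * g (suc j))))) ⟩
        s * (1ℤ * g zero + - 1ℤ * ∑ (λ j → sgn j * g (suc j)))   ≡⟨ lem′ s (g zero) (∑ (λ j → sgn j * g (suc j))) ⟩
        s * g zero + - s * ∑ (λ j → sgn j * g (suc j))   ∎)) ⟩
    ι (s * ∑ (λ j → sgn j * g j)) ∎
    where
    ring₁ : ∀ κ s x y → κ ⊗ (s ⊗ x ⊕ y) ≡ s ⊗ (κ ⊗ x) ⊕ κ ⊗ y
    ring₁ = RingSolver.solve-∀ ℚ-ring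
    lem : ∀ x y → - x * y ≡ - 1ℤ * (x * y)
    lem = solve-∀
    lem′ : ∀ s x t → s * (1ℤ * x + - 1ℤ * t) ≡ s * x + - s * t
    lem′ = solve-∀

  powℚ : ℚ → ℕ → ℚ
  powℚ κ zero    = 1ℚ
  powℚ κ (suc n) = κ ⊗ powℚ κ n

  -- One factor κ is spent per row. It will be 1 for the walk matrix, sc for the graph and -sc for
  -- its complement.
  det-ι : ∀ n κ (M : Matrix n) (Z : Mat n n) → (∀ i j → κ ⊗ M i j ≡ ι (Z i j)) → powℚ κ n ⊗ det M ≡ ι (detℤ Z)
  det-ι zero    κ M Z h = trans (ℚ.*-identityˡ 1ℚ) (cong ι (sym (detℤ-[] Z)))
  det-ι (suc n) κ M Z h = trans (alt-sum-ι n M (suc n) (κ ⊗ powℚ κ n) 1ℤ (minor-term n M) (λ j → Z zero j * detℤ (sub Z zero j)) terms)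
    (cong ι (trans (*-identityˡ _) (sym (detℤ-row Z))))
    where
    ring₁ : ∀ κ k x y → κ ⊗ k ⊗ (x ⊗ y) ≡ (κ ⊗ x) ⊗ (k ⊗ y)
    ring₁ = RingSolver.solve-∀ ℚ-ring
    terms : ∀ j → κ ⊗ powℚ κ n ⊗ minor-term n M j ≡ ι (Z zero j * detℤ (sub Z zero j))
    terms j = trans (ring₁ κ (powℚ κ n) (M zero j) (det (λ a b → M (suc a) (punchIn j b))))
      (trans (cong₂ _⊗_ (h zero j) (det-ι n κ (λ a b → M (suc a) (punchIn j b)) (sub Z zero j) (λ a b → h (suc a) (punchIn j b))))
             (sym (ι-* (Z zero j) (detℤ (sub Z zero j)))))

  -- Integral matrices of graphs and of their complements.

  module _ {n} (K : Graph n) where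

    adjℤ : Mat n n
    adjℤ i j = if Graph.adj K i j then 1ℤ else 0ℤ

    deg : Vec n
    deg i = ∑ (adjℤ i)

    adjℤ-sym : Symmetric adjℤ
    adjℤ-sym i j = cong (λ b → if b then 1ℤ else 0ℤ) (adj-sym K i j)

    adjℤ-irrefl : ∀ i → adjℤ i i ≡ 0ℤ
    adjℤ-irrefl i = cong (λ b → if b then 1ℤ else 0ℤ) (adj-irrefl K i)

    deg-even : 2ℤ ∣ 𝟙 ∙ deg
    deg-even = ∣-respʳ (begin
      total adjℤ - ∑ (λ i → adjℤ i i)   ≡⟨ cong (λ t → total adjℤ - t) (∑-zero (λ i → adjℤ i i) adjℤ-irrefl) ⟩
      total adjℤ - 0ℤ   ≡⟨ +-identityʳ (total adjℤ) ⟩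
      total adjℤ   ≡⟨ ∑-cong (λ i → sym (*-identityˡ (deg i))) ⟩
      ∑ (λ i → 1ℤ * deg i)   ≡⟨ ∙-∑ 𝟙 deg ⟨
      𝟙 ∙ deg   ∎)
      (symmetric-total 1ℤ adjℤ adjℤ-sym (λ i j _ → divides (adjℤ i j) (sym (*-identityʳ (adjℤ i j)))))

    integral : ∀ a b {c} → a + b ≡ c → Degreed n c
    integral a b {c} a+b≡c = record
      { A     = B
      ; d     = deg
      ; A-sym = λ i j → cong₂ (λ s t → a * s + b * t) (degree-sym i j) (adjℤ-sym i j)
      ; A-𝟙   = row-sum }
      where
      B : Mat n n
      B i j = a * (δ i j * deg i) + b * adjℤ i j
      degree-sym : ∀ i j → δ i j * deg i ≡ δ j i * deg j
      degree-sym i j with i ≟ j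
      ... | yes refl = cong (_* deg i) (sym (δ-refl i))
      ... | no i≢j   = cong (_* deg j) (sym (δ-≢ (i≢j ∘ sym)))
      row-sum : ∀ i → (B ▹ 𝟙) i ≡ c * deg i
      row-sum i = begin
        B i ∙ 𝟙
          ≡⟨ ∙-linearˡ a b (λ j → δ i j * deg i) (adjℤ i) 𝟙 ⟩
        a * ((λ j → δ i j * deg i) ∙ 𝟙) + b * (adjℤ i ∙ 𝟙)
          ≡⟨ cong₂ (λ s t → a * s + b * t) (trans (∙-cong (λ j → *-comm (δ i j) (deg i)) (λ _ → refl)) (trans (∙-scaleˡ (deg i) (δ i) 𝟙) (trans (cong (deg i *_) (δ-∙ 𝟙 i)) (*-identityʳ (deg i)))))
               (trans (∙-∑ (adjℤ i) 𝟙) (∑-cong (λ j → *-identityʳ (adjℤ i j)))) ⟩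
        a * deg i + b * deg i
          ≡⟨ *-distribʳ-+ (deg i) a b ⟨
        (a + b) * deg i
          ≡⟨ cong (_* deg i) a+b≡c ⟩
        c * deg i ∎

    integral-diagonal : ∀ a b {c} (e : a + b ≡ c) i → A (integral a b e) i i ≡ a * deg i
    integral-diagonal a b e i = trans (cong₂ (λ s t → a * (s * deg i) + b * t) (δ-refl i) (adjℤ-irrefl i)) (lem a b (deg i))
      where
      lem : ∀ a b g → a * (1ℤ * g) + b * 0ℤ ≡ a * g
      lem = solve-∀

    identity-ι : ∀ (i j : Fin n) → identity i j ≡ ι (δ i j)
    identity-ι i j with i ≟ j
    ... | yes _ = refl
    ... | no _  = refl

    adjMatrix-ι : ∀ i j → adjMatrix K i j ≡ ι (adjℤ i j)
    adjMatrix-ι i j with Graph.adj K i j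
    ... | true  = refl
    ... | false = refl

    degree-ι : ∀ i → degree K i ≡ ι (deg i)
    degree-ι i = sumFin-ι (adjℤ i) (adjMatrix-ι i)

    degMatrix-ι : ∀ i j → degMatrix K i j ≡ ι (δ i j) ⊗ ι (deg i)
    degMatrix-ι i j with i ≟ j
    ... | yes _ = trans (degree-ι i) (sym (ℚ.*-identityˡ (ι (deg i))))
    ... | no _  = sym (ℚ.*-zeroˡ (ι (deg i)))

  reciprocal : ∀ p → p ≢ 0ℚ → ∃ λ t → p ⊗ t ≡ 1ℚ
  reciprocal p p≢0 = ℚ.1/_ p {{ℚ.≢-nonZero p≢0}} , ℚ.*-inverseʳ p {{ℚ.≢-nonZero p≢0}}

  adjℤ-complement : ∀ {n} (K : Graph n) i j → adjℤ (complement K) i j ≡ 1ℤ - δ i j - adjℤ K i j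
  adjℤ-complement K i j with i ≟ j
  ... | yes refl rewrite adj-irrefl K i = refl
  ... | no _ with Graph.adj K i j
  ...   | true  = refl
  ...   | false = refl

  deg-complement : ∀ {n} (K : Graph n) i → deg (complement K) i ≡ + n - 1ℤ - deg K i
  deg-complement {n} K i = begin
    ∑ (adjℤ (complement K) i)   ≡⟨ ∑-cong (adjℤ-complement K i) ⟩
    ∑ (λ j → 1ℤ - δ i j - adjℤ K i j)   ≡⟨ ∑-minus (λ j → 1ℤ - δ i j) (adjℤ K i) ⟩
    ∑ (λ j → 1ℤ - δ i j) - deg K i   ≡⟨ cong (_- deg K i) (∑-minus (λ _ → 1ℤ) (δ i)) ⟩
    ∑ {n} (λ _ → 1ℤ) - ∑ (δ i) - deg K i   ≡⟨ cong₂ (λ s t → s - t - deg K i) (trans (sym (∙-∑ 𝟙 𝟙)) (𝟙∙𝟙 n))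
                                                      (trans (∑-cong (λ j → sym (*-identityʳ (δ i j)))) (trans (sym (∙-∑ (δ i) 𝟙)) (δ-∙ 𝟙 i))) ⟩
    + n - 1ℤ - deg K i   ∎

  module Scaled (α : ℚ) (c′ : ℕ) (a b : ℤ) (Cα : ℕtoℚ (suc c′) ⊗ α ≡ ι a) (Cβ : ℕtoℚ (suc c′) ⊗ (1ℚ ⊝ α) ≡ ι b) where

    c : ℤ
    c = + suc c′

    C β : ℚ
    C = ℕtoℚ (suc c′)
    β = 1ℚ ⊝ α

    a+b≡c : a + b ≡ c
    a+b≡c = ι-injective (trans (ι-+ a b) (trans (cong₂ _⊕_ (sym Cα) (sym Cβ)) (ring C α)))
      where
      ring : ∀ C α → C ⊗ α ⊕ C ⊗ (1ℚ ⊕ ⊖ α) ≡ C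
      ring = RingSolver.solve-∀ ℚ-ring

    C-inverse : ∀ y → C ⊗ y ⊗ (+ 1 ℚ./ suc c′) ≡ y
    C-inverse y = trans (ring C y (+ 1 ℚ./ suc c′)) (trans (cong (_⊗ y) unit) (ℚ.*-identityˡ y))
      where
      ring : ∀ C y k → C ⊗ y ⊗ k ≡ C ⊗ k ⊗ y
      ring = RingSolver.solve-∀ ℚ-ring
      unit : C ⊗ (+ 1 ℚ./ suc c′) ≡ 1ℚ
      unit = ℚ.toℚᵘ-injective (ℚᵘ.≃-trans (ℚ.toℚᵘ-homo-* C (+ 1 ℚ./ suc c′))
        (ℚᵘ.≃-trans (ℚᵘ.*-cong (toℚᵘ-ι c) (ℚ.toℚᵘ-fromℚᵘ (mkℚᵘ (+ 1) c′))) (*≡* (lem c))))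
        where
        lem : ∀ c → c * 1ℤ * 1ℤ ≡ 1ℤ * (1ℤ * c)
        lem = solve-∀

    module _ {n} (K : Graph n) where

      D : Degreed n c
      D = integral K a b a+b≡c

      Aα-entry : ∀ i j → Aα α K i j ≡ α ⊗ (ι (δ i j) ⊗ ι (deg K i)) ⊕ β ⊗ ι (adjℤ K i j)
      Aα-entry i j = cong₂ (λ s t → α ⊗ s ⊕ β ⊗ t) (degMatrix-ι K i j) (adjMatrix-ι K i j)

      A-ι : ∀ i j → ι (A D i j) ≡ ι a ⊗ (ι (δ i j) ⊗ ι (deg K i)) ⊕ ι b ⊗ ι (adjℤ K i j)
      A-ι i j = trans (ι-+ (a * (δ i j * deg K i)) (b * adjℤ K i j)) (cong₂ _⊕_ (trans (ι-* a (δ i j * deg K i)) (cong (ι a ⊗_) (ι-* (δ i j) (deg K i)))) (ι-* b (adjℤ K i j)))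

      Ac-ι : ∀ i j → Ac α (suc c′) K i j ≡ ι (A D i j)
      Ac-ι i j = begin
        C ⊗ Aα α K i j   ≡⟨ cong (C ⊗_) (Aα-entry i j) ⟩
        C ⊗ (α ⊗ (ι (δ i j) ⊗ ι (deg K i)) ⊕ β ⊗ ι (adjℤ K i j))   ≡⟨ ring C α β (ι (δ i j) ⊗ ι (deg K i)) (ι (adjℤ K i j)) ⟩
        (C ⊗ α) ⊗ (ι (δ i j) ⊗ ι (deg K i)) ⊕ (C ⊗ β) ⊗ ι (adjℤ K i j)   ≡⟨ cong₂ (λ s t → s ⊗ (ι (δ i j) ⊗ ι (deg K i)) ⊕ t ⊗ ι (adjℤ K i j)) Cα Cβ ⟩
        ι a ⊗ (ι (δ i j) ⊗ ι (deg K i)) ⊕ ι b ⊗ ι (adjℤ K i j)   ≡⟨ A-ι i j ⟨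
        ι (A D i j)   ∎
        where
        ring : ∀ C α β s t → C ⊗ (α ⊗ s ⊕ β ⊗ t) ≡ (C ⊗ α) ⊗ s ⊕ (C ⊗ β) ⊗ t
        ring = RingSolver.solve-∀ ℚ-ring

      matVec-ι : ∀ {M : Matrix n} {Z : Mat n n} {v : Vector n} {u : Vec n} → (∀ i j → M i j ≡ ι (Z i j)) → (∀ i → v i ≡ ι (u i)) →
        ∀ i → matVec M v i ≡ ι ((Z ▹ u) i)
      matVec-ι {Z = Z} {u = u} hM hv i = trans (sumFin-ι (λ j → Z i j * u j) (λ j → trans (cong₂ _⊗_ (hM i j) (hv j)) (sym (ι-* (Z i j) (u j)))))
        (cong ι (sym (∙-∑ (Z i) u)))

      powVec-ι : ∀ k i → powVec (Ac α (suc c′) K) k ones i ≡ ι (pow (A D) k 𝟙 i)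
      powVec-ι zero    i = refl
      powVec-ι (suc k) i = matVec-ι {Z = A D} {u = pow (A D) k 𝟙} Ac-ι (powVec-ι k) i

      Wtilde-ι : ∀ i k → Wtilde α (suc c′) K i k ≡ ι (W D i k)
      Wtilde-ι i zero    = refl
      Wtilde-ι i (suc k) = begin
        powVec (Ac α (suc c′) K) (suc (toℕ k)) ones i ⊗ (+ 1 ℚ./ suc c′)
          ≡⟨ cong (_⊗ (+ 1 ℚ./ suc c′)) (trans (powVec-ι (suc (toℕ k)) i) (trans (cong ι (pow-𝟙 D (suc (toℕ k)) i)) (ι-* c (w D (suc (toℕ k)) i)))) ⟩
        C ⊗ ι (w D (suc (toℕ k)) i) ⊗ (+ 1 ℚ./ suc c′)
          ≡⟨ C-inverse (ι (w D (suc (toℕ k)) i)) ⟩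
        ι (w D (suc (toℕ k)) i) ∎

      det-Wtilde : det (Wtilde α (suc c′) K) ≡ ι (detℤ (W D))
      det-Wtilde = trans (sym (trans (cong (_⊗ det (Wtilde α (suc c′) K)) (one-power n)) (ℚ.*-identityˡ _)))
        (det-ι n 1ℚ (Wtilde α (suc c′) K) (W D) (λ i j → trans (ℚ.*-identityˡ (Wtilde α (suc c′) K i j)) (Wtilde-ι i j)))
        where
        one-power : ∀ n → powℚ 1ℚ n ≡ 1ℚ
        one-power zero    = refl
        one-power (suc n) = trans (ℚ.*-identityˡ (powℚ 1ℚ n)) (one-power n)

      module _ (s : ℤ) (t : ℚ) (κt : ι s ⊗ C ⊗ t ≡ 1ℚ) where

        -- By `κt` the point `t` is 1/(sc), so multiplying tI - Aα by sc gives I - sA.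
        charPoly-ι : powℚ (ι s ⊗ C) n ⊗ charPolyAt (Aα α K) t ≡ ι (detℤ (Resolvent.resolvent (A D) s))
        charPoly-ι = det-ι n (ι s ⊗ C) _ (Resolvent.resolvent (A D) s) entry
          where
          ring : ∀ S C t E α β D X → S ⊗ C ⊗ (t ⊗ E ⊕ ⊖ (α ⊗ D ⊕ β ⊗ X)) ≡ S ⊗ C ⊗ t ⊗ E ⊕ ⊖ (S ⊗ ((C ⊗ α) ⊗ D ⊕ (C ⊗ β) ⊗ X))
          ring = RingSolver.solve-∀ ℚ-ring
          entry : ∀ i j → ι s ⊗ C ⊗ (t ⊗ identity i j ⊝ Aα α K i j) ≡ ι (δ i j - s * A D i j)
          entry i j = begin
            ι s ⊗ C ⊗ (t ⊗ identity i j ⊝ Aα α K i j)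
              ≡⟨ cong₂ (λ e m → ι s ⊗ C ⊗ (t ⊗ e ⊝ m)) (identity-ι K i j) (Aα-entry i j) ⟩
            ι s ⊗ C ⊗ (t ⊗ ι (δ i j) ⊝ (α ⊗ Dᵢⱼ ⊕ β ⊗ ι (adjℤ K i j)))
              ≡⟨ ring (ι s) C t (ι (δ i j)) α β Dᵢⱼ (ι (adjℤ K i j)) ⟩
            ι s ⊗ C ⊗ t ⊗ ι (δ i j) ⊝ ι s ⊗ ((C ⊗ α) ⊗ Dᵢⱼ ⊕ (C ⊗ β) ⊗ ι (adjℤ K i j))
              ≡⟨ cong₂ (λ k m → k ⊗ ι (δ i j) ⊝ ι s ⊗ m) κt (cong₂ (λ p q → p ⊗ Dᵢⱼ ⊕ q ⊗ ι (adjℤ K i j)) Cα Cβ) ⟩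
            1ℚ ⊗ ι (δ i j) ⊝ ι s ⊗ (ι a ⊗ Dᵢⱼ ⊕ ι b ⊗ ι (adjℤ K i j))
              ≡⟨ cong₂ (λ e m → e ⊝ ι s ⊗ m) (ℚ.*-identityˡ (ι (δ i j))) (sym (A-ι i j)) ⟩
            ι (δ i j) ⊝ ι s ⊗ ι (A D i j)
              ≡⟨ trans (ι-minus (δ i j) (s * A D i j)) (cong (λ m → ι (δ i j) ⊝ m) (ι-* s (A D i j))) ⟨
            ι (δ i j - s * A D i j) ∎
            where
            Dᵢⱼ : ℚ
            Dᵢⱼ = ι (δ i j) ⊗ ι (deg K i)

        -- Since Aα (complement K) = (α (n - 1) - β) I + β J - Aα K with β = 1 - α.
        complement-point : ℚ
        complement-point = (α ⊗ ι (+ n - 1ℤ) ⊝ β) ⊝ t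

        -- At this point the matrix for the complement is Aα - tI - βJ; scaling by -sc turns it into
        -- I - sA + sbJ, a rank-one update of the resolvent.
        charPoly-complement-ι : powℚ (⊖ (ι s ⊗ C)) n ⊗ charPolyAt (Aα α (complement K)) complement-point
          ≡ ι (detℤ (λ i j → Resolvent.resolvent (A D) s i j + s * b))
        charPoly-complement-ι = det-ι n (⊖ (ι s ⊗ C)) _ (λ i j → Resolvent.resolvent (A D) s i j + s * b) entry
          where
          ring : ∀ S C t E α β M g X →
            ⊖ (S ⊗ C) ⊗ (((α ⊗ M ⊕ ⊖ β) ⊕ ⊖ t) ⊗ E ⊕ ⊖ (α ⊗ (E ⊗ (M ⊕ ⊖ g)) ⊕ β ⊗ ((1ℚ ⊕ ⊖ E) ⊕ ⊖ X)))
            ≡ (S ⊗ C ⊗ t ⊗ E ⊕ ⊖ (S ⊗ ((C ⊗ α) ⊗ (E ⊗ g) ⊕ (C ⊗ β) ⊗ X))) ⊕ S ⊗ (C ⊗ β)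
          ring = RingSolver.solve-∀ ℚ-ring
          entry : ∀ i j → ⊖ (ι s ⊗ C) ⊗ (complement-point ⊗ identity i j ⊝ Aα α (complement K) i j) ≡ ι (δ i j - s * A D i j + s * b)
          entry i j = begin
            ⊖ (ι s ⊗ C) ⊗ (complement-point ⊗ identity i j ⊝ Aα α (complement K) i j)
              ≡⟨ cong₂ (λ e m → ⊖ (ι s ⊗ C) ⊗ (complement-point ⊗ e ⊝ m)) (identity-ι K i j)
                   (cong₂ (λ p q → α ⊗ p ⊕ β ⊗ q)
                     (trans (degMatrix-ι (complement K) i j) (cong (ι (δ i j) ⊗_) (trans (cong ι (deg-complement K i)) (ι-minus (+ n - 1ℤ) (deg K i)))))
                     (trans (adjMatrix-ι (complement K) i j) (trans (cong ι (adjℤ-complement K i j)) (trans (ι-minus (1ℤ - δ i j) (adjℤ K i j)) (cong (_⊝ ι (adjℤ K i j)) (ι-minus 1ℤ (δ i j))))))) ⟩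
            ⊖ (ι s ⊗ C) ⊗ (complement-point ⊗ ι (δ i j) ⊝ (α ⊗ (ι (δ i j) ⊗ (ι (+ n - 1ℤ) ⊝ ι (deg K i))) ⊕ β ⊗ ((1ℚ ⊝ ι (δ i j)) ⊝ ι (adjℤ K i j))))
              ≡⟨ ring (ι s) C t (ι (δ i j)) α β (ι (+ n - 1ℤ)) (ι (deg K i)) (ι (adjℤ K i j)) ⟩
            (ι s ⊗ C ⊗ t ⊗ ι (δ i j) ⊝ ι s ⊗ ((C ⊗ α) ⊗ Dᵢⱼ ⊕ (C ⊗ β) ⊗ ι (adjℤ K i j))) ⊕ ι s ⊗ (C ⊗ β)
              ≡⟨ cong₂ (λ y z → y ⊕ ι s ⊗ z) (cong₂ (λ k m → k ⊗ ι (δ i j) ⊝ ι s ⊗ m) κt (cong₂ (λ p q → p ⊗ Dᵢⱼ ⊕ q ⊗ ι (adjℤ K i j)) Cα Cβ)) Cβ ⟩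
            (1ℚ ⊗ ι (δ i j) ⊝ ι s ⊗ (ι a ⊗ Dᵢⱼ ⊕ ι b ⊗ ι (adjℤ K i j))) ⊕ ι s ⊗ ι b
              ≡⟨ cong (_⊕ (ι s ⊗ ι b)) (cong₂ (λ e m → e ⊝ ι s ⊗ m) (ℚ.*-identityˡ (ι (δ i j))) (sym (A-ι i j))) ⟩
            (ι (δ i j) ⊝ ι s ⊗ ι (A D i j)) ⊕ ι s ⊗ ι b
              ≡⟨ trans (ι-+ (δ i j - s * A D i j) (s * b)) (cong₂ _⊕_ (trans (ι-minus (δ i j) (s * A D i j)) (cong (λ m → ι (δ i j) ⊝ m) (ι-* s (A D i j)))) (ι-* s b)) ⟨
            ι (δ i j - s * A D i j + s * b) ∎
            where
            Dᵢⱼ : ℚ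
            Dᵢⱼ = ι (δ i j) ⊗ ι (deg K i)

    module _ {n} (K L : Graph n) (spectra : SameGenSpectrum α K L) where

      scale-reciprocal : ∀ s → s ≢ 0ℤ → ∃ λ t → ι s ⊗ C ⊗ t ≡ 1ℚ
      scale-reciprocal s s≢0 = reciprocal (ι s ⊗ C) (λ e → *-≢0 {s} {c} s≢0 (λ ()) (ι-injective {s * c} {0ℤ} (trans (ι-* s c) e)))

      det-resolvent≡ : ∀ s → s ≢ 0ℤ → detℤ (Resolvent.resolvent (A (D K)) s) ≡ detℤ (Resolvent.resolvent (A (D L)) s)
      det-resolvent≡ s s≢0 = at (scale-reciprocal s s≢0)
        where
        at : (∃ λ t → ι s ⊗ C ⊗ t ≡ 1ℚ) → detℤ (Resolvent.resolvent (A (D K)) s) ≡ detℤ (Resolvent.resolvent (A (D L)) s)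
        at (t , κt) = ι-injective (trans (sym (charPoly-ι K s t κt)) (trans (cong (powℚ (ι s ⊗ C) n ⊗_) (proj₁ spectra t)) (charPoly-ι L s t κt)))

      det-resolvent⁺≡ : ∀ s → s ≢ 0ℤ → detℤ (λ i j → Resolvent.resolvent (A (D K)) s i j + s * b) ≡ detℤ (λ i j → Resolvent.resolvent (A (D L)) s i j + s * b)
      det-resolvent⁺≡ s s≢0 = at (scale-reciprocal s s≢0)
        where
        at : (∃ λ t → ι s ⊗ C ⊗ t ≡ 1ℚ) → detℤ (λ i j → Resolvent.resolvent (A (D K)) s i j + s * b) ≡ detℤ (λ i j → Resolvent.resolvent (A (D L)) s i j + s * b)
        at (t , κt) = ι-injective (trans (sym (charPoly-complement-ι K s t κt)) (trans (cong (powℚ (⊖ (ι s ⊗ C)) n ⊗_) (proj₂ spectra (complement-point K s t κt))) (charPoly-complement-ι L s t κt)))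

      same-walks : b ≢ 0ℤ → ∀ k → walks (A (D K)) k ≡ walks (A (D L)) k
      same-walks b≢0 = EqualWalks.walks≡ (A (D K)) (A (D L)) b b≢0 det-resolvent≡ det-resolvent⁺≡

      -- Off the diagonal the integral matrix is `b` times the adjacency matrix, so preserving it
      -- preserves adjacency; on the diagonal there are no loops.
      isomorphic : b ≢ 0ℤ → Permuted (D K) (D L) → Isomorphic K L
      isomorphic b≢0 π = mk↔ₛ′ σ⁻¹ σ σ⁻¹-σ σ-σ⁻¹ , λ i j → begin
        Graph.adj L (σ⁻¹ i) (σ⁻¹ j)   ≡⟨ adj-σ (σ⁻¹ i) (σ⁻¹ j) ⟨
        Graph.adj K (σ (σ⁻¹ i)) (σ (σ⁻¹ j))   ≡⟨ cong₂ (Graph.adj K) (σ-σ⁻¹ i) (σ-σ⁻¹ j) ⟩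
        Graph.adj K i j   ∎
        where
        open Permuted π
        bool : ∀ {p q} → (if p then 1ℤ else 0ℤ) ≡ (if q then 1ℤ else 0ℤ) → p ≡ q
        bool {false} {false} _ = refl
        bool {true}  {true}  _ = refl
        bool {false} {true}  ()
        bool {true}  {false} ()
        off-diagonal : ∀ K i j → i ≢ j → A (D K) i j ≡ b * adjℤ K i j
        off-diagonal K i j i≢j = trans (cong (λ e → a * (e * deg K i) + b * adjℤ K i j) (δ-≢ i≢j)) (lem a (deg K i) (b * adjℤ K i j))
          where
          lem : ∀ a g y → a * (0ℤ * g) + y ≡ y
          lem = solve-∀
        σ-injective : ∀ {i j} → σ i ≡ σ j → i ≡ j
        σ-injective {i} {j} e = trans (sym (σ⁻¹-σ i)) (trans (cong σ⁻¹ e) (σ⁻¹-σ j))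
        by-cases : ∀ i j → Dec (i ≡ j) → Graph.adj K (σ i) (σ j) ≡ Graph.adj L i j
        by-cases i j (yes refl) = trans (adj-irrefl K (σ i)) (sym (adj-irrefl L i))
        by-cases i j (no i≢j)   = bool (cancel-* {b} {adjℤ K (σ i) (σ j)} {adjℤ L i j} b≢0
          (trans (sym (off-diagonal K (σ i) (σ j) (i≢j ∘ σ-injective))) (trans (A-σ i j) (off-diagonal L i j i≢j))))
        adj-σ : ∀ i j → Graph.adj K (σ i) (σ j) ≡ Graph.adj L i j
        adj-σ i j = by-cases i j (i ≟ j)

  -- Powers of two, the parity of n and the prime factors of the determinant.

  module PrimePowers where

    pos-^ : ∀ p k → + (p ℕ.^ k) ≡ (+ p) ^ k
    pos-^ p zero    = refl
    pos-^ p (suc k) = trans (pos-* p (p ℕ.^ k)) (cong (+ p *_) (pos-^ p k))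

    double : ∀ r → r ℕ.+ r ≡ r ℕ.* 2
    double r = trans (cong (r ℕ.+_) (sym (ℕ.+-identityʳ r))) (ℕ.*-comm 2 r)

    half : ∀ n′ → ∃ λ r → (n′ ≡ r ℕ.+ r × suc n′ ℕ./ 2 ≡ r) ⊎ (n′ ≡ suc (r ℕ.+ r) × suc n′ ℕ./ 2 ≡ suc r)
    half n′ with halve n′
    ... | r , inj₁ refl = r , inj₁ (refl , trans (cong (λ t → suc t ℕ./ 2) (double r)) (trans (ℕ.+-distrib-/-∣ʳ 1 (ℕ.n∣m*n r {2})) (ℕ.m*n/n≡m r 2)))
    ... | r , inj₂ refl = r , inj₂ (refl , trans (cong (λ t → suc (suc t) ℕ./ 2) (double r)) (ℕ.m*n/n≡m (suc r) 2))

    ¬2^suc : ∀ k m → OddInt m → ¬ P ^ suc k ∣ P ^ k * m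
    ¬2^suc k m m-odd h = m-odd (∣⇒∣ᵤ (cancel-*-∣ (^-≢0 k (λ ())) (subst (_∣ P ^ k * m) (*-comm P (P ^ k)) h)))

    ¬p² : ∀ k m → SquareFreeInt m → ∀ p (pp : Prime p) → p ≢ 2 → ¬ (+ p) ^ 2 ∣ P ^ k * m
    ¬p² k m m-sf p pp p≢2 h = m-sf p (ℕ.nonTrivial⇒n>1 p {{prime⇒nonTrivial pp}})
      (∣⇒∣ᵤ (subst (_∣ m) (trans (cong (+ p *_) (*-identityʳ (+ p))) (sym (pos-* p p))) (Q.P^-cancel 2 (¬p∣2^ k) h)))
      where
      module Q = ModPrime p pp
      ¬p∣2 : ¬ + p ∣ P
      ¬p∣2 h with prime⇒irreducible prime[2] (∣⇒∣ᵤ h)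
      ... | inj₁ p≡1 = ℕ.nonTrivial⇒≢1 {{prime⇒nonTrivial pp}} p≡1
      ... | inj₂ p≡2 = p≢2 p≡2
      ¬p∣2^ : ∀ k → ¬ + p ∣ P ^ k
      ¬p∣2^ zero    h = Q.P∤1 h
      ¬p∣2^ (suc k) h with Q.P-euclid P (P ^ k) h
      ... | inj₁ e = ¬p∣2 e
      ... | inj₂ e = ¬p∣2^ k e

  open PrimePowers

  determined : (n : ℕ) → 5 ℕ.≤ n → (G : Graph n) → (α : ℚ) → α ℚ.< 1ℚ → (c : ℕ) → IsCα α c →
    (∃ λ m → det (Wtilde α c G) ≡ ℤtoℚ (+ (2 ℕ.^ (n ℕ./ 2))) ⊗ ℤtoℚ m × OddInt m × SquareFreeInt m) →
    (∀ p → Prime p → p ≢ 2 → p ℕ.∣ c → FullRankModP p (Wtilde α c G)) → DGAαS α G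
  determined (suc n′) 5≤n G α α<1 (suc c′) (_ , (a , Cα) , (b , Cβ) , _) (m , det≡ , m-odd , m-sf) full-rank H spectra =
    isomorphic G H spectra b≢0 (choose-size (half n′))
    where
    open Scaled α c′ a b Cα Cβ
    k : ℕ
    k = suc n′ ℕ./ 2
    detW : detℤ (W (D G)) ≡ P ^ k * m
    detW = trans (ι-injective (trans (sym (det-Wtilde G)) (trans det≡ (sym (ι-* (+ (2 ℕ.^ k)) m))))) (cong (_* m) (pos-^ 2 k))
    W≢0 : detℤ (W (D G)) ≢ 0ℤ
    W≢0 e = *-≢0 (^-≢0 k (λ ())) (λ { refl → m-odd (∣⇒∣ᵤ {+ 2} {0ℤ} ∣-0) }) (trans (sym detW) e)
    b≢0 : b ≢ 0ℤ
    b≢0 refl = ℚ.<-irrefl (sym (trans (sym (ring α)) (trans (cong (_⊕ α) β≡0) (ℚ.+-identityˡ α)))) α<1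
      where
      ring : ∀ α → (1ℚ ⊕ ⊖ α) ⊕ α ≡ 1ℚ
      ring = RingSolver.solve-∀ ℚ-ring
      β≡0 : 1ℚ ⊝ α ≡ 0ℚ
      β≡0 = trans (sym (C-inverse (1ℚ ⊝ α))) (trans (cong (_⊗ (+ 1 ℚ./ suc c′)) Cβ) (ℚ.*-zeroˡ (+ 1 ℚ./ suc c′)))
    square-free : ∀ p (pp : Prime p) → p ≢ 2 → ¬ (+ p) ^ 2 ∣ detℤ (W (D G))
    square-free p pp p≢2 h = ¬p² k m m-sf p pp p≢2 (∣-respʳ detW h)
    injective : ∀ p (pp : Prime p) → p ≢ 2 → + p ∣ c → ∀ (y : Vec (suc n′)) → (∀ i → + p ∣ (W (D G) ▹ y) i) → ∀ j → + p ∣ y j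
    injective p pp p≢2 p∣c y h j = ∣ᵤ⇒∣ (full-rank p pp p≢2 (∣⇒∣ᵤ p∣c) y (λ i → _∣_.quotient (h i) ,
      trans (matVec-ι G {Z = W (D G)} {u = y} (Wtilde-ι G) (λ _ → refl) i) (cong ι (trans (_∣_.equality (h i)) (*-comm (_∣_.quotient (h i)) (+ p))))) j)
    descent : ∀ r (r+r≤n′ : r ℕ.+ r ℕ.≤ n′) → Quadratic.Size (D G) a (integral-diagonal G a b a+b≡c) (deg-even G) r r+r≤n′ → Permuted (D G) (D H)
    descent r r+r≤n′ size = Descent.permuted {G = D G} {D H} (λ ()) 5≤n a (integral-diagonal G a b a+b≡c) (deg-even G) r r+r≤n′ size square-free injective
      (same-walks G H spectra b≢0) W≢0
    choose-size : (∃ λ r → (n′ ≡ r ℕ.+ r × k ≡ r) ⊎ (n′ ≡ suc (r ℕ.+ r) × k ≡ suc r)) → Permuted (D G) (D H)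
    choose-size (r , inj₁ (n′≡ , k≡)) = descent r (ℕ.≤-reflexive (sym n′≡)) (Quadratic.odd-size n′≡
      (λ h → ¬2^suc r m m-odd (∣-respʳ (trans detW (cong (λ t → P ^ t * m) k≡)) h)))
    choose-size (r , inj₂ (n′≡ , k≡)) = descent r (ℕ.≤-trans (ℕ.n≤1+n (r ℕ.+ r)) (ℕ.≤-reflexive (sym n′≡))) (Quadratic.even-size n′≡
      (λ h → ¬2^suc (suc r) m m-odd (∣-respʳ (trans detW (cong (λ t → P ^ t * m) k≡)) h)))

open import Defs
open import Data.Nat using (ℕ; _≤_; _^_; _/_; _*_)
open import Data.Nat.Primality using (Prime)
open import Data.Nat.Divisibility using (_∣_)
open import Data.Integer using (ℤ; +_)
open import Data.Rational using (ℚ; 0ℚ; 1ℚ; _<_) renaming (_≤_ to _≤ℚ_; _*_ to _*ℚ_)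
open import Data.Product using (∃; _×_)
open import Relation.Nullary using (¬_)
open import Relation.Binary.PropositionalEquality using (_≡_; _≢_)

theorem1p1 : (n : ℕ) → 5 ≤ n → (G : Graph n) → Connected G →
    (α : ℚ) → 0ℚ ≤ℚ α → α < 1ℚ →
    (c : ℕ) → IsCα α c →
    ¬ ((2 ∣ n) × ¬ (2 ∣ c) × 3 ≤ c) →
    (∃ λ (m : ℤ) → det (Wtilde α c G) ≡ ℤtoℚ (+ (2 ^ (n / 2))) *ℚ ℤtoℚ m × OddInt m × SquareFreeInt m) →
    ((p : ℕ) → Prime p → p ≢ 2 → p ∣ c → FullRankModP p (Wtilde α c G)) →
    DGAαS α G
theorem1p1 n 5≤n G _ α _ α<1 c c-min _ det-W full-rank = Development.determined n 5≤n G α α<1 c c-min det-W full-rank
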